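{- Let $T$ be a finite alphabet. If a language $L\subseteq T^*$ is the string language of some string abstract categorial grammar $G=(\Sigma,Str_T,\phi,S)$, then $L=L(G')$ for some linear logic grammar $G'$ over the alphabet $T$.
   Context: Linear $\lambda$-calculus. Linear implicational types over a set $N$ of atomic types: atoms, and $A\multimap B$ for types $A,B$. Linear $\lambda$-terms over variables $X$ and constants $C$: variables, constants, applications $(ts)$ with $t,s$ having disjoint free variables, and abstractions $\lambda x.t$ where $x$ occurs free in $t$ exactly once. Typing judgements $x_1:A_1,\dots,x_n:A_n\vdash t:A$ ($x_i$ distinct) are derived by: $x:A\vdash x:A$; from $\Gamma\vdash t:A\multimap B$ and $\Delta\vdash s:A$ infer $\Gamma,\Delta\vdash (ts):B$; from $\Gamma,x:A,\Delta\vdash t:B$ infer $\Gamma,\Delta\vdash\lambda x.t:A\multimap B$. A linear signature $\Sigma=(N,C,\mathfrak T)$ consists of finite sets $N$ of atomic types and $C$ of constants and a type $\mathfrak T(c)$ for each $c\in C$; $\Gamma\vdash_\Sigma t:A$ means derivable using additionally the axioms $\vdash c:\mathfrak T(c)$. A map of signatures $\phi:\Sigma_1\to\Sigma_2$ consists of a map $F$ on types with $F(A\multimap B)=F(A)\multimap F(B)$ and a map $G$ from constants of $\Sigma_1$ to terms with $\vdash_{\Sigma_2}G(c):F(\mathfrak T_1(c))$, extended to terms by $G(x)=x$, $G(ts)=G(t)G(s)$, $G(\lambda x.t)=\lambda x.G(t)$; write $\phi$ for both. An abstract categorial grammar (ACG) is $G=(\Sigma_{abstr},\Sigma_{obj},\phi,S)$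 with linear signatures, a map $\phi:\Sigma_{abstr}\to\Sigma_{obj}$ and an atomic type $S$ of $\Sigma_{abstr}$. The string signature $Str_T$ has one atomic type $O$, constants $T$, and $\mathfrak T(c)=O\multimap O$ for all $c\in T$; write $str=O\multimap O$. For $a_1\dots a_n\in T^*$ let $\rho(a_1\dots a_n)=\lambda x.a_1(\dots(a_n x)\dots)$. A string ACG is an ACG with $\Sigma_{obj}=Str_T$; its string language is $L(G)=\{w\in T^*:\rho(w)\text{ is }\beta\eta\text{ -equivalent to }\phi(t)\text{ for some closed }t\text{ with }\vdash_{\Sigma}t:S\}$. Linear logic grammars (LLG). (Cowordisms.) A boundary $X$ is a natural number $|X|$ with a subset $X_l\subseteq\{1,\dots,|X|\}$ of left endpoints; $X_r$ is its complement. $X\otimes Y$: $|X\otimes Y|=|X|+|Y|$, $(X\otimes Y)_l=X_l\cup\{|X|+i:i\in Y_l\}$; $\mathbf 1$ has cardinality $0$; $X^\perp$: $|X^\perp|=|X|$, $(X^\perp)_l=\{|X|+1-i:i\in X_r\}$. A regular multiword with boundary $X$ over $T$ is a perfect matching of $\{1,\dots,|X|\}$ by edges $(i,w,j)$, $w\in T^*$, each from a left endpoint $i$ to a right endpoint $j$; a multiword also carries a finite multiset of cyclic words (its singular part) and is regular if this is empty. A cowordism $\sigma:X\to Y$ is a multiword with boundary $Y\otimes X^\perp$ (vertex $|Y|+|X|+1-i$ representing vertex $i$ of $X$). Composition glues vertex $i$ of $\sigma:X\to Y$ to vertex $|Z|+|Y|+1-i$ of $\tau:Y\to Z$, concatenating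 labels along paths and collecting closed cycles as cyclic words; $\mathrm{id}_X$ consists of $\epsilon$-labelled edges joining $i$ and $2|X|+1-i$. (Logic.) LL formulas over positive literals $N$: literals $P,P^\perp$ combined by $\otimes,\wp$, with De Morgan negation; rules Id $\vdash A^\perp,A$, Cut, Exchange, $\wp$ (from $\vdash\Gamma,A,B$ infer $\vdash\Gamma,A\wp B$), $\otimes$ (from $\vdash\Gamma,A$ and $\vdash B,\Delta$ infer $\vdash\Gamma,A\otimes B,\Delta$). With boundaries $[P]$ for literals, $[A\otimes B]=[A]\otimes[B]$, $[A^\perp]=[A]^\perp$, $[A_1,\dots,A_n]=[A_n]\otimes\dots\otimes[A_1]$; derivations are interpreted as multiwords with boundary $[\Gamma]$: Id as $\mathrm{id}_{[A]}$, Ex by permuting vertex blocks, $\wp$ trivially, $\otimes$ as the union of multiwords with blocks arranged as $[\Delta]\otimes[A]\otimes[B]\otimes[\Gamma]$, Cut by gluing the $[A]$ block of one premise to the $[A]^\perp$ block of the other (order-reversingly) as in composition. An LLG $G'=(N,T,Lex,S)$ has finite $N$ of literals with boundaries, a finite lexicon $Lex$ of pairs $\sigma/\vdash\Gamma$ ($\sigma$ a multiword with boundary $[\Gamma]$), and $S\in N$ with $[S]$ having one left and one right endpoint; $\sigma/\vdash\Gamma$ is derivable if some LL derivation of $\vdash\Gamma$ from lexicon sequents (interpreted by their cowordisms) has interpretation $\sigma$; $L(G')$ is the set of labels $w$ of the single edge of regular $\sigma$ with $\sigma/\vdash S$ derivable. -}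

module Defs where

open import Data.Nat using (ℕ; zero; suc; _+_)
open import Data.Nat.Properties using (+-comm; +-identityʳ; +-assoc)
open import Data.Fin using (Fin; zero; suc; _↑ˡ_; _↑ʳ_; splitAt; cast; opposite)
import Data.Fin.Properties as FinP
open import Data.Bool using (Bool; true; false; not; if_then_else_)
open import Data.List using (List; []; _∷_; _++_; map; concatMap; filter; foldr; allFin; mapMaybe)
open import Data.List.Membership.Propositional using (_∈_; _∉_)
open import Data.List.Relation.Unary.All using (All)
open import Data.List.Relation.Unary.Unique.Propositional using (Unique)
open import Data.List.Relation.Binary.Permutation.Propositional using (_↭_)
open import Data.Maybe using (Maybe; just; nothing)
import Data.Maybe as Maybe
open import Data.Product using (Σ; _×_; _,_; proj₁; proj₂)
open import Data.Sum using (_⊎_; inj₁; inj₂; [_,_]′)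
open import Relation.Nullary using (does; ¬?)
open import Relation.Binary.PropositionalEquality using (_≡_; refl; sym; trans; cong; cong₂)
open import Relation.Binary.Construct.Closure.Equivalence using (EqClosure)
import Data.Nat.Properties as NatP
open import Data.Nat.ListAction using (sum)

infixr 5 _⊸_
data Ty (n : ℕ) : Set where
  atom : Fin n → Ty n
  _⊸_  : Ty n → Ty n → Ty n

-- Linear signature (N , C , 𝔗) with N = Fin nAt, C = Fin nC (finite sets)
record Sig : Set where
  field
    nAt    : ℕ
    nC     : ℕ
    typeOf : Fin nC → Ty nAt
open Sig public

data Tm (m : ℕ) : Set where
  var : ℕ → Tm m
  con : Fin m → Tm m
  app : Tm m → Tm m → Tm m
  lam : ℕ → Tm m → Tm m

Cx : ℕ → Set
Cx n = List (ℕ × Ty n)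

-- Typing judgement Γ ⊢_Σ t : A, rules exactly as in the paper; the
-- side condition of the application rule records that the judgement
-- Γ,Δ ⊢ (ts) has distinct variables (t and s have disjoint free variables).
data Typed (sg : Sig) : Cx (nAt sg) → Tm (nC sg) → Ty (nAt sg) → Set where
  ax  : ∀ {x A} → Typed sg ((x , A) ∷ []) (var x) A
  cn  : ∀ c → Typed sg [] (con c) (typeOf sg c)
  app : ∀ {Γ Δ t s A B} → Typed sg Γ t (A ⊸ B) → Typed sg Δ s A →
        Unique (map proj₁ (Γ ++ Δ)) → Typed sg (Γ ++ Δ) (app t s) B
  lam : ∀ {Γ Δ x t A B} → Typed sg (Γ ++ (x , A) ∷ Δ) t B →
        Typed sg (Γ ++ Δ) (lam x t) (A ⊸ B)

mapTy : ∀ {n n'} → (Fin n → Ty n') → Ty n → Ty n'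
mapTy F (atom p) = F p
mapTy F (A ⊸ B)  = mapTy F A ⊸ mapTy F B

record SigMap (s₁ s₂ : Sig) : Set where
  field
    F       : Fin (nAt s₁) → Ty (nAt s₂)
    G       : Fin (nC s₁) → Tm (nC s₂)
    G-typed : ∀ c → Typed s₂ [] (G c) (mapTy F (typeOf s₁ c))
open SigMap public

mapTm : ∀ {s₁ s₂} → SigMap s₁ s₂ → Tm (nC s₁) → Tm (nC s₂)
mapTm φ (var x)   = var x
mapTm φ (con c)   = G φ c
mapTm φ (app t s) = app (mapTm φ t) (mapTm φ s)
mapTm φ (lam x t) = lam x (mapTm φ t)

module _ {m : ℕ} where

  fv : Tm m → List ℕ
  fv (var x)   = x ∷ []
  fv (con c)   = []
  fv (app t s) = fv t ++ fv s
  fv (lam x t) = filter (λ y → ¬? (y NatP.≟ x)) (fv t)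

  binders : Tm m → List ℕ
  binders (var x)   = []
  binders (con c)   = []
  binders (app t s) = binders t ++ binders s
  binders (lam x t) = x ∷ binders t

  vars : Tm m → List ℕ
  vars t = fv t ++ binders t

  -- naive substitution t[s/x] (only used when it is capture-free)
  _[_/_] : Tm m → Tm m → ℕ → Tm m
  var y   [ s / x ] = if does (x NatP.≟ y) then s else var y
  con c   [ s / x ] = con c
  app t u [ s / x ] = app (t [ s / x ]) (u [ s / x ])
  lam y t [ s / x ] = if does (x NatP.≟ y) then lam y t else lam y (t [ s / x ])

  data _⟶_ : Tm m → Tm m → Set where
    α    : ∀ {x y t} → y ∉ vars t → lam x t ⟶ lam y (t [ var y / x ])
    β    : ∀ {x t s} → (∀ {y} → y ∈ binders t → y ∉ fv s) →
           app (lam x t) s ⟶ (t [ s / x ])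
    η    : ∀ {x t} → x ∉ fv t → lam x (app t (var x)) ⟶ t
    ξ    : ∀ {x t t'} → t ⟶ t' → lam x t ⟶ lam x t'
    appˡ : ∀ {t t' s} → t ⟶ t' → app t s ⟶ app t' s
    appʳ : ∀ {t s s'} → s ⟶ s' → app t s ⟶ app t s'

  _≈βη_ : Tm m → Tm m → Set
  _≈βη_ = EqClosure _⟶_

StrSig : ℕ → Sig
StrSig k = record { nAt = 1 ; nC = k ; typeOf = λ _ → atom zero ⊸ atom zero }

record ACG (obj : Sig) : Set where
  field
    abstr : Sig
    φ     : SigMap abstr obj
    S     : Fin (nAt abstr)
open ACG public

StringACG : ℕ → Set
StringACG k = ACG (StrSig k)

ρ : ∀ {k} → List (Fin k) → Tm k
ρ w = lam 0 (foldr (λ a t → app (con a) t) (var 0) w)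

LangACG : ∀ {k} → StringACG k → List (Fin k) → Set
LangACG G w = Σ (Tm (nC (abstr G))) λ t →
  Typed (abstr G) [] t (atom (S G)) × (ρ w ≈βη mapTm (φ G) t)

-- Boundaries: |X| = size, X_l = {i | left i ≡ true} (0-based vertices)
record Bd : Set where
  constructor bd
  field
    size : ℕ
    left : Fin size → Bool
open Bd public

_⊗B_ : Bd → Bd → Bd
X ⊗B Y = bd (size X + size Y) (λ i → [ left X , left Y ]′ (splitAt (size X) i))

𝟏B : Bd
𝟏B = bd 0 (λ ())

_⊥B : Bd → Bd
X ⊥B = bd (size X) (λ i → not (left X (opposite i)))

numLeft : Bd → ℕ
numLeft X = sum (map (λ i → if left X i then 1 else 0) (allFin (size X)))

-- Edges (i , w , j) from a left endpoint i to a right endpoint j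
Edge : Set → Set → Set
Edge T V = V × List T × V

endpoints : ∀ {T V} → List (Edge T V) → List V
endpoints = concatMap (λ e → proj₁ e ∷ proj₂ (proj₂ e) ∷ [])

-- Multiword with boundary X over T: a perfect matching (each vertex is
-- an endpoint of exactly one edge) by edges from left to right endpoints,
-- together with a finite multiset (list) of cyclic words (singular part).
record Multiword (T : Set) (X : Bd) : Set where
  field
    edges    : List (Edge T (Fin (size X)))
    cycles   : List (List T)
    oriented : All (λ e → left X (proj₁ e) ≡ true × left X (proj₂ (proj₂ e)) ≡ false) edges
    perfect  : endpoints edges ↭ allFin (size X)
open Multiword public

data Fm (n : ℕ) : Set where
  pos neg : Fin n → Fm n
  _⊗_ _⅋_ : Fm n → Fm n → Fm n

_⁻ : ∀ {n} → Fm n → Fm n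
pos P ⁻   = neg P
neg P ⁻   = pos P
(A ⊗ B) ⁻ = (A ⁻) ⅋ (B ⁻)
(A ⅋ B) ⁻ = (A ⁻) ⊗ (B ⁻)

RawMW : Set → Set → Set
RawMW T V = List (Edge T V) × List (List T)

module LL (T : Set) (n : ℕ) (litBd : Fin n → Bd) where

  -- [P] given, [A ⊗ B] = [A] ⊗ [B], [A^⊥] = [A]^⊥,
  -- hence [A ⅋ B] = [(A^⊥ ⊗ B^⊥)^⊥] = ([A]^⊥ ⊗ [B]^⊥)^⊥
  ⟦_⟧ : Fm n → Bd
  ⟦ pos P ⟧   = litBd P
  ⟦ neg P ⟧   = litBd P ⊥B
  ⟦ A ⊗ B ⟧   = ⟦ A ⟧ ⊗B ⟦ B ⟧
  ⟦ A ⅋ B ⟧   = ((⟦ A ⟧ ⊥B) ⊗B (⟦ B ⟧ ⊥B)) ⊥B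

  ∣_∣ : Fm n → ℕ
  ∣ A ∣ = size ⟦ A ⟧

  ⟦_⟧ᶜ : List (Fm n) → Bd
  ⟦ [] ⟧ᶜ    = 𝟏B
  ⟦ A ∷ Γ ⟧ᶜ = ⟦ Γ ⟧ᶜ ⊗B ⟦ A ⟧

  sz : List (Fm n) → ℕ
  sz Γ = size ⟦ Γ ⟧ᶜ

  sizeNeg : ∀ A → ∣ A ⁻ ∣ ≡ ∣ A ∣
  sizeNeg (pos P) = refl
  sizeNeg (neg P) = refl
  sizeNeg (A ⊗ B) = cong₂ _+_ (sizeNeg A) (sizeNeg B)
  sizeNeg (A ⅋ B) = cong₂ _+_ (sizeNeg A) (sizeNeg B)

  sz++ : ∀ Γ Δ → sz (Γ ++ Δ) ≡ sz Δ + sz Γ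
  sz++ [] Δ      = sym (+-identityʳ (sz Δ))
  sz++ (A ∷ Γ) Δ = trans (cong (_+ ∣ A ∣) (sz++ Γ Δ)) (+-assoc (sz Δ) (sz Γ) ∣ A ∣)

  record Entry : Set where
    field
      seq : List (Fm n)
      mw  : Multiword T ⟦ seq ⟧ᶜ

  module Derivations (Lex : List Entry) where

    data Deriv : List (Fm n) → Set where
      lex  : ∀ e → e ∈ Lex → Deriv (Entry.seq e)
      idR  : ∀ A → Deriv (A ⁻ ∷ A ∷ [])
      cut  : ∀ {Γ Δ} A → Deriv (Γ ++ A ∷ []) → Deriv (A ⁻ ∷ Δ) → Deriv (Γ ++ Δ)
      exR  : ∀ Γ {Δ} A B → Deriv (Γ ++ A ∷ B ∷ Δ) → Deriv (Γ ++ B ∷ A ∷ Δ)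
      parR : ∀ Γ A B → Deriv (Γ ++ A ∷ B ∷ []) → Deriv (Γ ++ (A ⅋ B) ∷ [])
      tenR : ∀ Γ {Δ} A B → Deriv (Γ ++ A ∷ []) → Deriv (B ∷ Δ) → Deriv (Γ ++ (A ⊗ B) ∷ Δ)

    ren : ∀ {V W} → (V → W) → RawMW T V → RawMW T W
    ren f (es , cs) = map (λ e → f (proj₁ e) , proj₁ (proj₂ e) , f (proj₂ (proj₂ e))) es , cs

    union : ∀ {V} → RawMW T V → RawMW T V → RawMW T V
    union (es , cs) (es' , cs') = es ++ es' , cs ++ cs'

    extract : ∀ {E : Set} → (E → Bool) → List E → Maybe (E × List E)
    extract p [] = nothing
    extract p (e ∷ es) = if p e then just (e , es)
                         else Maybe.map (λ r → proj₁ r , e ∷ proj₂ r) (extract p es)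

    isNode : ∀ {a b} → Fin b → Fin a ⊎ Fin b → Bool
    isNode k (inj₁ _)  = false
    isNode k (inj₂ k') = does (k FinP.≟ k')

    -- gluing at internal node k: the edge (i,w,k) entering k and the edge
    -- (k,w',j) leaving k become (i,ww',j); a loop (k,w,k) becomes a cycle w.
    contract : ∀ {a b} → Fin b → RawMW T (Fin a ⊎ Fin b) → RawMW T (Fin a ⊎ Fin b)
    contract {a} {b} k (es , cs) = step₁ (extract (λ e → isNode k (proj₂ (proj₂ e))) es)
      where
      step₂ : Edge T (Fin a ⊎ Fin b) → Maybe (Edge T (Fin a ⊎ Fin b) × List (Edge T (Fin a ⊎ Fin b))) →
              RawMW T (Fin a ⊎ Fin b)
      step₂ e nothing = es , cs
      step₂ (i , w , _) (just ((_ , w' , j) , rest)) = (i , w ++ w' , j) ∷ rest , cs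
      step₁ : Maybe (Edge T (Fin a ⊎ Fin b) × List (Edge T (Fin a ⊎ Fin b))) → RawMW T (Fin a ⊎ Fin b)
      step₁ nothing = es , cs
      step₁ (just ((i , w , j) , rest)) =
        if isNode k i then (rest , w ∷ cs)
        else step₂ (i , w , j) (extract (λ e → isNode k (proj₁ e)) rest)

    outer : ∀ {a b} → Edge T (Fin a ⊎ Fin b) → Maybe (Edge T (Fin a))
    outer (inj₁ i , w , inj₁ j) = just (i , w , j)
    outer _ = nothing

    interp : ∀ {Γ} → Deriv Γ → RawMW T (Fin (sz Γ))
    interp (lex e _) = edges (Entry.mw e) , cycles (Entry.mw e)
    interp (idR A) = map edge (allFin ∣ A ∣) , []
      where
      partner : Fin ∣ A ∣ → Fin (∣ A ∣ + ∣ A ⁻ ∣)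
      partner i = ∣ A ∣ ↑ʳ cast (sym (sizeNeg A)) (opposite i)
      edge : Fin ∣ A ∣ → Edge T (Fin (∣ A ∣ + ∣ A ⁻ ∣))
      edge i = if left ⟦ A ⟧ i then (i ↑ˡ ∣ A ⁻ ∣ , [] , partner i)
               else (partner i , [] , i ↑ˡ ∣ A ⁻ ∣)
    interp (cut {Γ} {Δ} A d₁ d₂) =
      ren (cast (sym (sz++ Γ Δ)))
        (Data.List.mapMaybe outer (proj₁ glued) , proj₂ glued)
      where
      V = Fin (sz Δ + sz Γ) ⊎ Fin ∣ A ∣
      c₁ : Fin (sz (Γ ++ A ∷ [])) → V
      c₁ x = [ inj₂ , (λ j → inj₁ (sz Δ ↑ʳ j)) ]′ (splitAt ∣ A ∣ (cast (sz++ Γ (A ∷ [])) x))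
      c₂ : Fin (sz (A ⁻ ∷ Δ)) → V
      c₂ y = [ (λ k → inj₁ (k ↑ˡ sz Γ)) , (λ a → inj₂ (opposite (cast (sizeNeg A) a))) ]′
               (splitAt (sz Δ) y)
      glued : RawMW T V
      glued = foldr contract (union (ren c₁ (interp d₁)) (ren c₂ (interp d₂))) (allFin ∣ A ∣)
    interp (exR Γ {Δ} A B d) = ren f (interp d)
      where
      d' = sz Δ ; a = ∣ A ∣ ; b = ∣ B ∣ ; g = sz Γ
      sw : Fin (((d' + b) + a) + g) → Fin (((d' + a) + b) + g)
      sw x = [ (λ y → [ (λ y' → [ (λ u → ((u ↑ˡ a) ↑ˡ b) ↑ˡ g)
                                      , (λ v → ((d' + a) ↑ʳ v) ↑ˡ g) ]′ (splitAt d' y'))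
                        , (λ z → ((d' ↑ʳ z) ↑ˡ b) ↑ˡ g) ]′ (splitAt (d' + b) y))
             , (λ y → ((d' + a) + b) ↑ʳ y) ]′ (splitAt ((d' + b) + a) x)
      f : Fin (sz (Γ ++ A ∷ B ∷ Δ)) → Fin (sz (Γ ++ B ∷ A ∷ Δ))
      f x = cast (sym (sz++ Γ (B ∷ A ∷ Δ))) (sw (cast (sz++ Γ (A ∷ B ∷ Δ)) x))
    interp (parR Γ A B d) =
      ren (cast (trans (sz++ Γ (A ∷ B ∷ []))
                  (trans (cong (_+ sz Γ) (+-comm ∣ B ∣ ∣ A ∣ ))
                         (sym (sz++ Γ ((A ⅋ B) ∷ []))))))
          (interp d)
    interp (tenR Γ {Δ} A B d₁ d₂) = union (ren t₁ (interp d₁)) (ren t₂ (interp d₂))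
      where
      back : Fin ((sz Δ + (∣ A ∣ + ∣ B ∣)) + sz Γ) → Fin (sz (Γ ++ (A ⊗ B) ∷ Δ))
      back = cast (sym (sz++ Γ ((A ⊗ B) ∷ Δ)))
      t₁ : Fin (sz (Γ ++ A ∷ [])) → Fin (sz (Γ ++ (A ⊗ B) ∷ Δ))
      t₁ x = back ([ (λ i → (sz Δ ↑ʳ (i ↑ˡ ∣ B ∣)) ↑ˡ sz Γ)
                   , (λ j → (sz Δ + (∣ A ∣ + ∣ B ∣)) ↑ʳ j) ]′
                   (splitAt ∣ A ∣ (cast (sz++ Γ (A ∷ [])) x)))
      t₂ : Fin (sz (B ∷ Δ)) → Fin (sz (Γ ++ (A ⊗ B) ∷ Δ))
      t₂ y = back ([ (λ k → (k ↑ˡ (∣ A ∣ + ∣ B ∣)) ↑ˡ sz Γ)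
                   , (λ c → (sz Δ ↑ʳ (∣ A ∣ ↑ʳ c)) ↑ˡ sz Γ) ]′
                   (splitAt (sz Δ) y))

record LLG (T : Set) : Set where
  field
    nLit       : ℕ
    litBd      : Fin nLit → Bd
    lexicon    : List (LL.Entry T nLit litBd)
    start      : Fin nLit
    start-size : size (litBd start) ≡ 2
    start-left : numLeft (litBd start) ≡ 1
open LLG public

LangLLG : ∀ {T} → LLG T → List T → Set
LangLLG {T} G w =
  Σ (Deriv (pos (start G) ∷ [])) λ d →
    proj₂ (interp d) ≡ [] ×
    Σ (Fin (sz (pos (start G) ∷ []))) λ i → Σ (Fin (sz (pos (start G) ∷ []))) λ j →
      proj₁ (interp d) ≡ (i , w , j) ∷ []
  where
  open LL T (nLit G) (litBd G)
  open Derivations (lexicon G)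

{-# OPTIONS --safe #-}
module Submission where

-- Multiwords are read as relations: every vertex carries a value in a set D on which the labels
-- act, and an edge (i , w , j) relates the values at i and at j through the action of w.  A type
-- whose atoms carry values is again a linear type.  Hence a solution for the multiword of a
-- derivation turns the derivation into one over refined literals, and a solution for the multiword
-- of a λ-term is a refined typing of the term.
--
-- From terms to derivations: a typed term is a derivation with cuts.  For two values and trivial
-- labels, the solutions of a derivation form a clique in the sense of coherence spaces, and a closed
-- cycle would leave the value of a cut vertex undetermined; so no cycles arise.  The multiword is
-- then a matching, which has a solution; for the start type it is a single edge and gives a typing
-- of φ t by ε ⊸ w'.  If ρ w is convertible to φ t then w = w', because an extensional filter model
-- of the untyped calculus contains the refined types as pairwise incomparable points.
--
-- From derivations to terms: a phase model whose pole is intuitionistic derivability with exactly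
-- one output turns a refined derivation into a linear λ-term t, and realizability turns the typing
-- of φ t by ε ⊸ w into a conversion between φ t and ρ w.
--
-- If the start type is not str, then only ε can be generated, φ t being an identity of type E ⊸ E.
-- This is recognised by refining the abstract types with colours and asking for the point v ⊸ v,
-- where v has pairwise distinct colours; the refined grammar can be given the start type str.

open import Defs
open import Data.Bool using (Bool; false; if_then_else_; not; true)
import Data.Bool.Properties as BoolP
open import Data.Empty using (⊥; ⊥-elim)
open import Data.Fin using (Fin; _↑ʳ_; _↑ˡ_; cast; opposite; splitAt; suc; toℕ; zero)
import Data.Fin.Properties as FinP
open import Data.Integer as ℤ using (0ℤ; ℤ) renaming (+_ to +ᶻ_)
import Data.Integer.Properties as ℤP
open import Data.List using (List; []; _++_; _∷_; allFin; concatMap; filter; foldr; length; lookup; map; mapMaybe; tabulate)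
open import Data.List.Membership.Propositional using (_∈_; _∉_; find; lose)
open import Data.List.Membership.Propositional.Properties using (∈-++⁺ʳ; ∈-++⁺ˡ; ∈-++⁻; ∈-allFin; ∈-concatMap⁺; ∈-filter⁺; ∈-filter⁻; ∈-map⁺; ∈-map⁻; ∈-∃++)
open import Data.List.Properties using (++-assoc; ++-conicalʳ; ++-conicalˡ; ++-identityʳ; length-++; length-map; map-++; map-tabulate; map-∘; ∷-injective)
open import Data.List.Relation.Binary.Permutation.Propositional as Perm using (_↭_; ↭-refl; ↭-sym; ↭-trans; ↭-reflexive; prep; swap)
import Data.List.Relation.Binary.Permutation.Propositional.Properties as PermP
import Data.List.Relation.Binary.Permutation.Setoid.Properties as PermSet
open import Data.List.Relation.Unary.All as All using (All; []; _∷_)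
import Data.List.Relation.Unary.All.Properties as AllP
open import Data.List.Relation.Unary.AllPairs using ([]; _∷_)
open import Data.List.Relation.Unary.Any as Any using (Any; here; there)
import Data.List.Relation.Unary.Any.Properties as AnyP
open import Data.List.Relation.Unary.Unique.Propositional using (Unique)
open import Data.List.Relation.Unary.Unique.Propositional.Properties as UniqueP using (allFin⁺)
open import Data.Maybe using (Maybe; just; nothing)
open import Data.Nat as ℕ using (_+_; _<_; _≤_; suc; s≤s; zero; ℕ)
open import Data.Nat.ListAction using (sum)
import Data.Nat.Properties as NatP
open import Data.Product using (_,_; _×_; proj₁; proj₂; Σ; ∃)
open import Data.Sum using ([_,_]′; _⊎_; inj₁; inj₂)
import Data.Sum.Properties as SumP
open import Data.Vec as Vec using (Vec; []; _∷_)
import Data.Vec.Properties as VecP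
open import Function using (_∘_; id)
open import Function.Bundles using (Equivalence; _⇔_; mk⇔)
import Relation.Binary.Construct.Closure.Equivalence as Eq
open import Relation.Binary.Construct.Closure.ReflexiveTransitive using (_◅_; _◅◅_; ε)
open import Relation.Binary.Construct.Closure.Symmetric using (bwd; fwd)
open import Relation.Binary.Definitions using (DecidableEquality)
open import Relation.Binary.PropositionalEquality using (_≡_; _≢_; cong; cong₂; module ≡-Reasoning; refl; setoid; subst; sym; trans; ≢-sym)
open import Relation.Nullary using (Dec; no; yes; ¬?; ¬_)
open import Relation.Nullary.Decidable using (_×-dec_; dec-false; dec-true)

-- Refined linear typings

-- Membership on the ACG side is convertibility of untyped named terms, on the LLG side a
-- computation with multiwords. No confluence or normalization theorem links the two: the filter
-- model takes the place of unique normal forms, and realizability that of normalization, since it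
-- produces a conversion from a typing alone. The conservativity step is forced by the LLG: its
-- derivations may cut on formulas that are images of no implicational type, so they cannot be read
-- as λ-terms rule by rule. The start literal of an LLG must have one left and one right endpoint,
-- which singles out str among the types over one atom. For another start type `E ⊸ E` the language
-- is empty or consists of ε, and it is not decided which: the refined grammar is written down in
-- either case, and its start symbol is inhabited exactly when the original grammar generates ε. A
-- signature is finite, so the colours have to be finite in number; one for each vertex of `E` and a
-- default suffice.

infixr 5 _⊸ˢ_
data STy (L : Set) : Set where
  at   : L → STy L
  _⊸ˢ_ : STy L → STy L → STy L

bindS : ∀ {L M} → (L → STy M) → STy L → STy M
bindS f (at l)    = f l
bindS f (a ⊸ˢ b) = bindS f a ⊸ˢ bindS f b

SCx : Set → Set
SCx L = List (ℕ × STy L)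

-- `R` is a relation because a constant receives one type for every solution of its multiword. The
-- rules are those of `Typed`, so a typing erases rule by rule.
data STyped {L : Set} {m : ℕ} (R : Fin m → STy L → Set) : SCx L → Tm m → STy L → Set where
  ax  : ∀ {x a} → STyped R ((x , a) ∷ []) (var x) a
  cn  : ∀ {c a} → R c a → STyped R [] (con c) a
  app : ∀ {Γ Δ t s a b} → STyped R Γ t (a ⊸ˢ b) → STyped R Δ s a →
        Unique (map proj₁ (Γ ++ Δ)) → STyped R (Γ ++ Δ) (app t s) b
  lam : ∀ {Γ Δ x t a b} → STyped R (Γ ++ (x , a) ∷ Δ) t b →
        STyped R (Γ ++ Δ) (lam x t) (a ⊸ˢ b)

map-++⁻ : ∀ {A B : Set} (f : A → B) xs {ys} (zs : List A) → map f zs ≡ xs ++ ys →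
          ∃ λ zs₁ → ∃ λ zs₂ → zs ≡ zs₁ ++ zs₂ × map f zs₁ ≡ xs × map f zs₂ ≡ ys
map-++⁻ f [] zs e = [] , zs , refl , refl , e
map-++⁻ f (x ∷ xs) (z ∷ zs) e with ∷-injective e
... | refl , e' with map-++⁻ f xs zs e'
... | zs₁ , zs₂ , refl , e₁ , e₂ = z ∷ zs₁ , zs₂ , refl , cong (f z ∷_) e₁ , e₂

mapCx : ∀ {L M : Set} → (L → M) → List (ℕ × L) → List (ℕ × M)
mapCx f = map (λ p → proj₁ p , f (proj₂ p))

names-mapCx : ∀ {L M : Set} (f : L → M) Γ → map proj₁ (mapCx f Γ) ≡ map proj₁ Γ
names-mapCx f Γ = sym (map-∘ Γ)

-- Substituting types for atoms does not interfere with replacing constants, so one induction serves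
-- for `mapTm`, for renaming constants and for terms that stay fixed.
STyped-bind : ∀ {L M m m'} {R : Fin m → STy L → Set} {R' : Fin m' → STy M → Set}
  (f : L → STy M) (g : Tm m → Tm m') →
  (∀ x → g (var x) ≡ var x) → (∀ t s → g (app t s) ≡ app (g t) (g s)) →
  (∀ x t → g (lam x t) ≡ lam x (g t)) →
  (∀ c a → R c a → STyped R' [] (g (con c)) (bindS f a)) →
  ∀ {Γ t a} → STyped R Γ t a → STyped R' (mapCx (bindS f) Γ) (g t) (bindS f a)
STyped-bind f g gv ga gl h (ax {x}) rewrite gv x = ax
STyped-bind f g gv ga gl h (cn {c} {a} r) = h c a r
STyped-bind {R' = R'} f g gv ga gl h (app {Γ} {Δ} {t} {s} {a} {b} d e u)
  rewrite ga t s =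
  subst (λ Θ → STyped R' Θ (app (g t) (g s)) (bindS f b)) (sym (map-++ _ Γ Δ))
    (app (STyped-bind f g gv ga gl h d) (STyped-bind f g gv ga gl h e)
      (subst Unique (trans (sym (names-mapCx (bindS f) (Γ ++ Δ))) (cong (map proj₁) (map-++ _ Γ Δ))) u))
STyped-bind {R' = R'} f g gv ga gl h (lam {Γ} {Δ} {x} {t} {a} {b} d)
  rewrite gl x t =
  subst (λ Θ → STyped R' Θ (lam x (g t)) _) (sym (map-++ _ Γ Δ))
    (lam {Γ = mapCx (bindS f) Γ}
      (subst (λ Θ → STyped R' Θ (g t) (bindS f b)) (map-++ _ Γ ((x , a) ∷ Δ))
        (STyped-bind f g gv ga gl h d)))

eraseTy : ∀ {L n} → (L → Fin n) → STy L → Ty n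
eraseTy f (at l)    = atom (f l)
eraseTy f (a ⊸ˢ b) = eraseTy f a ⊸ eraseTy f b

STyped⇒Typed : ∀ {L} {sg : Sig} {R : Fin (nC sg) → STy L → Set} (f : L → Fin (nAt sg)) →
  (∀ c a → R c a → eraseTy f a ≡ typeOf sg c) →
  ∀ {Γ t a} → STyped R Γ t a → Typed sg (mapCx (eraseTy f) Γ) t (eraseTy f a)
STyped⇒Typed f h ax = ax
STyped⇒Typed {sg = sg} f h (cn {c} {a} r) = subst (Typed sg [] (con c)) (sym (h c a r)) (cn c)
STyped⇒Typed {sg = sg} f h (app {Γ} {Δ} {t} {s} {a} {b} d e u) =
  subst (λ Θ → Typed sg Θ (app t s) (eraseTy f b)) (sym (map-++ _ Γ Δ))
    (app (STyped⇒Typed f h d) (STyped⇒Typed f h e)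
      (subst Unique (trans (sym (names-mapCx (eraseTy f) (Γ ++ Δ))) (cong (map proj₁) (map-++ _ Γ Δ))) u))
STyped⇒Typed {sg = sg} f h (lam {Γ} {Δ} {x} {t} {a} {b} d) =
  subst (λ Θ → Typed sg Θ (lam x t) _) (sym (map-++ _ Γ Δ))
    (lam {Γ = mapCx (eraseTy f) Γ}
      (subst (λ Θ → Typed sg Θ t (eraseTy f b)) (map-++ _ Γ ((x , a) ∷ Δ))
        (STyped⇒Typed f h d)))

Unique-drop : ∀ {A : Set} (xs : List A) {x ys} → Unique (xs ++ x ∷ ys) →
              Unique (xs ++ ys) × All (x ≢_) (xs ++ ys)
Unique-drop [] (p ∷ u) = u , p
Unique-drop (y ∷ xs) (p ∷ u) with Unique-drop xs u | AllP.++⁻ʳ xs p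
... | u' , q | y≢x ∷ _ = AllP.++⁺ (AllP.++⁻ˡ xs p) (All.tail (AllP.++⁻ʳ xs p)) ∷ u' , ≢-sym y≢x ∷ q

STyped-lam-unique : ∀ {L : Set} (Γ : SCx L) {x a Δ} → Unique (map proj₁ (Γ ++ (x , a) ∷ Δ)) →
                    Unique (map proj₁ (Γ ++ Δ)) × All (x ≢_) (map proj₁ (Γ ++ Δ))
STyped-lam-unique Γ {x} {a} {Δ} u rewrite map-++ proj₁ Γ ((x , a) ∷ Δ) | map-++ proj₁ Γ Δ =
  Unique-drop (map proj₁ Γ) u

STyped-unique : ∀ {L m} {R : Fin m → STy L → Set} {Γ t a} → STyped R Γ t a → Unique (map proj₁ Γ)
STyped-unique ax = [] ∷ []
STyped-unique (cn _) = []
STyped-unique (app _ _ u) = u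
STyped-unique (lam {Γ} d) = proj₁ (STyped-lam-unique Γ (STyped-unique d))

-- Multiplicities in lists

module Counting {A : Set} (_≟_ : DecidableEquality A) where

  ind : A → A → ℕ
  ind y x with y ≟ x
  ... | yes _ = 1
  ... | no _  = 0

  cnt : A → List A → ℕ
  cnt y []       = 0
  cnt y (x ∷ xs) = ind y x + cnt y xs

  ind-refl : ∀ x → ind x x ≡ 1
  ind-refl x with x ≟ x
  ... | yes _ = refl
  ... | no n = ⊥-elim (n refl)

  ind-≢ : ∀ {y x} → y ≢ x → ind y x ≡ 0
  ind-≢ {y} {x} n with y ≟ x
  ... | yes e = ⊥-elim (n e)
  ... | no _ = refl

  cnt-++ : ∀ y xs ys → cnt y (xs ++ ys) ≡ cnt y xs + cnt y ys
  cnt-++ y [] ys = refl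
  cnt-++ y (x ∷ xs) ys = trans (cong (ind y x +_) (cnt-++ y xs ys)) (sym (NatP.+-assoc (ind y x) _ _))

  cnt-∉ : ∀ {y} xs → y ∉ xs → cnt y xs ≡ 0
  cnt-∉ [] h = refl
  cnt-∉ {y} (x ∷ xs) h rewrite ind-≢ (h ∘ here) = cnt-∉ xs (h ∘ there)

  cnt-∈ : ∀ {y} xs → y ∈ xs → cnt y xs ≢ 0
  cnt-∈ {y} (x ∷ xs) (here refl) rewrite ind-refl x = λ ()
  cnt-∈ {y} (x ∷ xs) (there i) e = cnt-∈ xs i (NatP.m+n≡0⇒n≡0 (ind y x) e)

  cnt-↭ : ∀ {y xs ys} → xs ↭ ys → cnt y xs ≡ cnt y ys
  cnt-↭ Perm.refl = refl
  cnt-↭ {y} (Perm.prep x p) = cong (ind y x +_) (cnt-↭ p)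
  cnt-↭ {y} {xs = _ ∷ _ ∷ xs} {ys = _ ∷ _ ∷ ys} (Perm.swap x z p) =
    trans (cong (λ k → ind y x + (ind y z + k)) (cnt-↭ p))
      (trans (sym (NatP.+-assoc (ind y x) (ind y z) (cnt y ys)))
        (trans (cong (_+ cnt y ys) (NatP.+-comm (ind y x) (ind y z))) (NatP.+-assoc (ind y z) (ind y x) (cnt y ys))))
  cnt-↭ (Perm.trans p q) = trans (cnt-↭ p) (cnt-↭ q)

  cnt-tabulate : ∀ {n} {y} (h : Fin n → A) i → (∀ j → h j ≡ y → j ≡ i) → cnt y (tabulate h) ≡ ind y (h i)
  cnt-tabulate {suc n} {y} h zero u =
    trans (cong (ind y (h zero) +_) (rest (h ∘ suc) λ j e → FinP.0≢1+n (sym (u (suc j) e)))) (NatP.+-identityʳ _)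
    where
    rest : ∀ {n} (h : Fin n → A) → (∀ j → h j ≢ y) → cnt y (tabulate h) ≡ 0
    rest {zero} h u = refl
    rest {suc n} h u rewrite ind-≢ {y} {h zero} (u zero ∘ sym) = rest (h ∘ suc) (λ j → u (suc j))
  cnt-tabulate {suc n} {y} h (suc i) u
    rewrite ind-≢ {y} {h zero} (λ e → FinP.0≢1+n (u zero (sym e))) =
    cnt-tabulate (h ∘ suc) i λ j e → FinP.suc-injective (u (suc j) e)

module _ {A B : Set} (_≟_ : DecidableEquality A) (_≟′_ : DecidableEquality B) where
  open Counting

  cnt-map : ∀ (f : A → B) → (∀ {x y} → f x ≡ f y → x ≡ y) → ∀ y xs → cnt _≟′_ (f y) (map f xs) ≡ cnt _≟_ y xs
  cnt-map f inj y [] = refl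
  cnt-map f inj y (x ∷ xs) with y ≟ x
  ... | yes refl rewrite ind-refl _≟′_ (f y) = cong suc (cnt-map f inj y xs)
  ... | no n rewrite ind-≢ _≟′_ (n ∘ inj) = cnt-map f inj y xs

cnt-map-∉ : ∀ {A B : Set} (_≟′_ : DecidableEquality B) (f : A → B) {z} → (∀ x → f x ≢ z) → ∀ xs → Counting.cnt _≟′_ z (map f xs) ≡ 0
cnt-map-∉ _≟′_ f n [] = refl
cnt-map-∉ _≟′_ f {z} n (x ∷ xs) rewrite Counting.ind-≢ _≟′_ {z} {f x} (λ e → n x (sym e)) = cnt-map-∉ _≟′_ f n xs

-- An extensional filter model of the λβη-calculus

module FilterModel (D : Set) {m : ℕ} (Q : Fin m → D → D → Set) where

  infixr 5 _⇒_
  data Pnt : Set where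
    atm : Maybe D → Pnt
    _⇒_ : List Pnt → Pnt → Pnt

  -- Extensionality: every point is a function point.  The atom d is identified
  -- with {⋆} ⇒ d, where ⋆ = nothing is an atom that occurs in no type; this keeps
  -- the points of distinct types incomparable.
  ⋆ : Pnt
  ⋆ = atm nothing

  hd : Pnt → List Pnt
  hd (atm d) = ⋆ ∷ []
  hd (u ⇒ p) = u

  tl : Pnt → Pnt
  tl (atm d) = atm d
  tl (u ⇒ p) = p

  infix 4 _⊑_
  -- Larger points are weaker, as for intersection types: `step` compares arguments contravariantly
  -- and reads an atom as a function through `hd` and `tl`. The choice `g` is a function and not a
  -- nested `All` of `Any`, which keeps transitivity a structural recursion.
  data _⊑_ : Pnt → Pnt → Set where
    atom : ∀ {d} → atm d ⊑ atm d
    step : ∀ {p q} → tl p ⊑ tl q →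
           (g : ∀ {x} → x ∈ hd p → Pnt) (g∈ : ∀ {x} (i : x ∈ hd p) → g i ∈ hd q)
           (g⊑ : ∀ {x} (i : x ∈ hd p) → g i ⊑ x) → p ⊑ q

  mutual
    ⊑-refl : ∀ p → p ⊑ p
    ⊑-refl (atm d) = atom
    ⊑-refl (u ⇒ p) = step (⊑-refl p) (λ {x} _ → x) id (⊑-refl∈ u)

    ⊑-refl∈ : ∀ u {x} → x ∈ u → x ⊑ x
    ⊑-refl∈ (y ∷ u) (here refl) = ⊑-refl y
    ⊑-refl∈ (y ∷ u) (there i) = ⊑-refl∈ u i

  ⊑-trans : ∀ {p q r} → p ⊑ q → q ⊑ r → p ⊑ r
  ⊑-trans atom e = e
  ⊑-trans (step d g g∈ g⊑) atom = step d g g∈ g⊑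
  ⊑-trans (step d g g∈ g⊑) (step e h h∈ h⊑) =
    step (⊑-trans d e) (λ i → h (g∈ i)) (λ i → h∈ (g∈ i)) (λ i → ⊑-trans (h⊑ (g∈ i)) (g⊑ i))

  target : Pnt → Maybe D
  target (atm d) = d
  target (u ⇒ p) = target p

  target-tl : ∀ p → target (tl p) ≡ target p
  target-tl (atm d) = refl
  target-tl (u ⇒ p) = refl

  ⊑-target : ∀ {p q} → p ⊑ q → target p ≡ target q
  ⊑-target atom = refl
  ⊑-target {p} {q} (step d _ _ _) = trans (sym (target-tl p)) (trans (⊑-target d) (target-tl q))

  emb : STy D → Pnt
  emb (at d)    = atm (just d)
  emb (a ⊸ˢ b) = (emb a ∷ []) ⇒ emb b

  emb≢⋆ : ∀ a → target (emb a) ≢ nothing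
  emb≢⋆ (at d) ()
  emb≢⋆ (a ⊸ˢ b) = emb≢⋆ b

  ∈-one : ∀ {A : Set} {x y : A} → x ∈ y ∷ [] → x ≡ y
  ∈-one (here e) = e

  -- `_⊑_` preserves targets, and the only argument of an atom is `⋆`; comparing an atom with an
  -- arrow would need an embedded type comparable with `⋆`, whose target is `nothing`. Between
  -- arrows the argument lists are singletons, so the comparison descends to the components.
  emb-⊑ : ∀ a b → emb a ⊑ emb b → a ≡ b
  emb-⊑ (at d) (at .d) atom = refl
  emb-⊑ (at d) (at e) (step p _ _ _) = emb-⊑ (at d) (at e) p
  emb-⊑ (at d) (a ⊸ˢ b) (step p g g∈ g⊑) =
    ⊥-elim (emb≢⋆ a (trans (cong target (sym (∈-one (g∈ (here refl))))) (⊑-target (g⊑ (here refl)))))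
  emb-⊑ (a ⊸ˢ b) (at d) (step p g g∈ g⊑) =
    ⊥-elim (emb≢⋆ a (trans (sym (⊑-target (g⊑ (here refl)))) (cong target (∈-one (g∈ (here refl))))))
  emb-⊑ (a ⊸ˢ b) (a' ⊸ˢ b') (step p g g∈ g⊑) =
    cong₂ _⊸ˢ_ (sym (emb-⊑ a' a (subst (_⊑ emb a) (∈-one (g∈ (here refl))) (g⊑ (here refl)))))
                (emb-⊑ b b' p)

  PSet : Set₁
  PSet = Pnt → Set

  infix 4 _⊆_
  _⊆_ : PSet → PSet → Set
  X ⊆ Y = ∀ {p} → X p → Y p

  Up : PSet → Set
  Up X = ∀ {p q} → p ⊑ q → X p → X q

  ↑ : List Pnt → PSet
  ↑ u q = Any (_⊑ q) u

  ↑-up : ∀ u → Up (↑ u)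
  ↑-up u d = Any.map (λ e → ⊑-trans e d)

  ⊆↑ : ∀ {u p} → p ∈ u → ↑ u p
  ⊆↑ {p = p} i = lose i (⊑-refl p)

  ↑⊆ : ∀ {u X} → Up X → All X u → ↑ u ⊆ X
  ↑⊆ up xs i with find i
  ... | _ , j , d = up d (All.lookup xs j)

  Env : Set₁
  Env = ℕ → PSet

  pick : ∀ {x y : ℕ} → Dec (x ≡ y) → PSet → PSet → PSet
  pick (yes _) X Y = X
  pick (no _)  X Y = Y

  _[_≔_] : Env → ℕ → PSet → Env
  (γ [ x ≔ X ]) y = pick (x NatP.≟ y) X (γ y)

  -- An abstraction treats an atom `d` as `⋆ ⇒ d`, which is what makes η valid. A constant denotes
  -- the upward closure of its step functions.
  ⟦_⟧_ : Tm m → Env → PSet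
  (⟦ var x ⟧ γ) p   = γ x p
  (⟦ con c ⟧ γ) p   = ∃ λ x → ∃ λ y → Q c x y × ((atm (just x) ∷ []) ⇒ atm (just y)) ⊑ p
  (⟦ app t s ⟧ γ) p = ∃ λ u → (⟦ t ⟧ γ) (u ⇒ p) × All (⟦ s ⟧ γ) u
  (⟦ lam x t ⟧ γ) p = (⟦ t ⟧ (γ [ x ≔ ↑ (hd p) ])) (tl p)

  upd-⊆ : ∀ {γ δ X Y} x y → X ⊆ Y → (x ≢ y → γ y ⊆ δ y) → (γ [ x ≔ X ]) y ⊆ (δ [ x ≔ Y ]) y
  upd-⊆ x y h k with x NatP.≟ y
  ... | yes _ = h
  ... | no n = k n

  fv-lam : ∀ {x y} (t : Tm m) → x ≢ y → y ∈ fv t → y ∈ fv (lam x t)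
  fv-lam {x} t n i = ∈-filter⁺ (λ y → ¬? (y NatP.≟ x)) i (n ∘ sym)

  mono : ∀ t {γ δ} → (∀ {x} → x ∈ fv t → γ x ⊆ δ x) → ⟦ t ⟧ γ ⊆ ⟦ t ⟧ δ
  mono (var x) h = h (here refl)
  mono (con c) h = id
  mono (app t s) h (u , a , b) =
    u , mono t (h ∘ ∈-++⁺ˡ) a , All.map (mono s (h ∘ ∈-++⁺ʳ (fv t))) b
  mono (lam x t) {γ} {δ} h = mono t λ {y} i → upd-⊆ {γ} {δ} x y id λ n → h (fv-lam t n i)

  UpE : Env → Set
  UpE γ = ∀ x → Up (γ x)

  upd-up : ∀ {γ X} x → UpE γ → Up X → UpE (γ [ x ≔ X ])
  upd-up x h k y with x NatP.≟ y
  ... | yes _ = k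
  ... | no _ = h y

  ⊑-hd : ∀ {p q} → p ⊑ q → ↑ (hd p) ⊆ ↑ (hd q)
  ⊑-hd atom = id
  ⊑-hd (step _ g g∈ g⊑) i with find i
  ... | _ , j , d = lose (g∈ j) (⊑-trans (g⊑ j) d)

  ⊑-tl : ∀ {p q} → p ⊑ q → tl p ⊑ tl q
  ⊑-tl atom = atom
  ⊑-tl (step d _ _ _) = d

  sem-up : ∀ t {γ} → UpE γ → Up (⟦ t ⟧ γ)
  sem-up (var x) h = h x
  sem-up (con c) h d (x , y , q , e) = x , y , q , ⊑-trans e d
  sem-up (app t s) h d (u , a , b) =
    u , sem-up t h (step d (λ {x} _ → x) id (⊑-refl∈ u)) a , b
  sem-up (lam x t) {γ} h {p} {q} d a =
    mono t (λ {y} _ → upd-⊆ {γ} {γ} x y (⊑-hd d) (λ _ → id))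
      (sem-up t (upd-up x h (↑-up (hd p))) (⊑-tl d) a)

  ∉-app : ∀ {y : ℕ} {xs ys : List ℕ} → y ∉ xs ++ ys → y ∉ xs × y ∉ ys
  ∉-app {xs = xs} h = h ∘ ∈-++⁺ˡ , h ∘ ∈-++⁺ʳ xs

  upd-skip : ∀ {γ X} x y → x ≢ y → γ y ⊆ (γ [ x ≔ X ]) y × (γ [ x ≔ X ]) y ⊆ γ y
  upd-skip x y n with x NatP.≟ y
  ... | yes e = ⊥-elim (n e)
  ... | no _ = id , id

  upd-swap : ∀ {γ X X' Y} x y z → x ≢ y → X ⊆ X' →
             ((γ [ y ≔ Y ]) [ x ≔ X ]) z ⊆ ((γ [ x ≔ X' ]) [ y ≔ Y ]) z
  upd-swap x y z n h with x NatP.≟ z | y NatP.≟ z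
  ... | yes refl | yes refl = ⊥-elim (n refl)
  ... | yes _ | no _ = h
  ... | no _ | yes _ = id
  ... | no _ | no _ = id

  upd-swap' : ∀ {γ X X' Y} x y z → x ≢ y → X ⊆ X' →
             ((γ [ x ≔ X ]) [ y ≔ Y ]) z ⊆ ((γ [ y ≔ Y ]) [ x ≔ X' ]) z
  upd-swap' x y z n h with x NatP.≟ z | y NatP.≟ z
  ... | yes refl | yes refl = ⊥-elim (n refl)
  ... | yes _ | no _ = h
  ... | no _ | yes _ = id
  ... | no _ | no _ = id

  upd-twice : ∀ {γ X Y} x z → (((γ [ x ≔ X ]) [ x ≔ Y ]) z ⊆ (γ [ x ≔ Y ]) z)
                            × ((γ [ x ≔ Y ]) z ⊆ ((γ [ x ≔ X ]) [ x ≔ Y ]) z)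
  upd-twice x z with x NatP.≟ z
  ... | yes _ = id , id
  ... | no _ = id , id

  -- No binder of `t` is free in `s`, so the value of `s` does not change when the environment is
  -- updated under such a binder.
  sem-sub : ∀ t s x {γ} → (∀ {y} → y ∈ binders t → y ∉ fv s) →
            (⟦ t [ s / x ] ⟧ γ ⊆ ⟦ t ⟧ (γ [ x ≔ ⟦ s ⟧ γ ])) ×
            (⟦ t ⟧ (γ [ x ≔ ⟦ s ⟧ γ ]) ⊆ ⟦ t [ s / x ] ⟧ γ)
  sem-sub (var y) s x h with x NatP.≟ y
  ... | yes e rewrite dec-true (x NatP.≟ y) e = id , id
  ... | no n rewrite dec-false (x NatP.≟ y) n = id , id
  sem-sub (con c) s x h = id , id
  sem-sub (app t t') s x h =
    let (a , a') = sem-sub t s x (h ∘ ∈-++⁺ˡ) ; (b , b') = sem-sub t' s x (h ∘ ∈-++⁺ʳ (binders t)) in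
    (λ (u , p , q) → u , a p , All.map b q) , (λ (u , p , q) → u , a' p , All.map b' q)
  sem-sub (lam y t) s x {γ} h with x NatP.≟ y
  ... | yes refl rewrite dec-true (x NatP.≟ x) refl = (λ {p} → mono t λ {z} _ → proj₂ (upd-twice {γ} {⟦ s ⟧ γ} x z))
                 , (λ {p} → mono t λ {z} _ → proj₁ (upd-twice {γ} {⟦ s ⟧ γ} x z))
  ... | no n rewrite dec-false (x NatP.≟ y) n =
    (λ {p} q → mono t (λ {z} _ → upd-swap {γ} x y z n (mono s λ {v} i → proj₂ (upd-skip {γ} y v (y∉ i))))
                (proj₁ (sem-sub t s x (h ∘ there)) q))
    , (λ {p} q → proj₂ (sem-sub t s x (h ∘ there))
                (mono t (λ {z} _ → upd-swap' {γ} x y z n (mono s λ {v} i → proj₁ (upd-skip {γ} y v (y∉ i)))) q))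
    where
    y∉ : ∀ {v} → v ∈ fv s → y ≢ v
    y∉ i refl = h (here refl) i

  ↑-mono : ∀ {u v} → (∀ {p} → p ∈ u → p ∈ v) → ↑ u ⊆ ↑ v
  ↑-mono h i with find i
  ... | _ , j , d = lose (h j) d

  mutual
    -- Continuity: a point of a denotation uses only finitely many points of the value of `x`. For
    -- β-expansion this yields the finite list that the semantics of an application asks for.
    compact : ∀ t x {γ X p} → Up X → (⟦ t ⟧ (γ [ x ≔ X ])) p →
              ∃ λ u → All X u × (⟦ t ⟧ (γ [ x ≔ ↑ u ])) p
    compact (var y) x {γ} {X} {p} up h with x NatP.≟ y
    ... | yes refl = p ∷ [] , h ∷ [] , here (⊑-refl p)
    ... | no n = [] , [] , h
    compact (con c) x up h = [] , [] , h
    compact (app t s) x {γ} up (v , a , b) =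
      let (u₁ , k₁ , r₁) = compact t x up a
          (u₂ , k₂ , r₂) = compacts s x v up b in
      u₁ ++ u₂ , AllP.++⁺ k₁ k₂ , v
      , mono t (λ {y} _ → upd-⊆ {γ} {γ} x y (↑-mono ∈-++⁺ˡ) (λ _ → id)) r₁
      , All.map (mono s (λ {y} _ → upd-⊆ {γ} {γ} x y (↑-mono (∈-++⁺ʳ u₁)) (λ _ → id))) r₂
    compact (lam y t) x {γ} {X} {p} up h with x NatP.≟ y
    ... | yes refl = [] , [] , mono t (λ {z} _ q → proj₂ (upd-twice {γ} {↑ []} x z) (proj₁ (upd-twice {γ} {X} x z) q)) h
    ... | no n =
      let (u , k , r) = compact t x up (mono t (λ {z} _ → upd-swap' {γ} x y z n id) h) in
      u , k , mono t (λ {z} _ → upd-swap {γ} x y z n id) r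

    compacts : ∀ t x v {γ X} → Up X → All (⟦ t ⟧ (γ [ x ≔ X ])) v →
               ∃ λ u → All X u × All (⟦ t ⟧ (γ [ x ≔ ↑ u ])) v
    compacts t x [] up [] = [] , [] , []
    compacts t x (p ∷ v) {γ} up (a ∷ b) =
      let (u₁ , k₁ , r₁) = compact t x up a
          (u₂ , k₂ , r₂) = compacts t x v up b in
      u₁ ++ u₂ , AllP.++⁺ k₁ k₂
      , mono t (λ {y} _ → upd-⊆ {γ} {γ} x y (↑-mono ∈-++⁺ˡ) (λ _ → id)) r₁
      ∷ All.map (mono t (λ {y} _ → upd-⊆ {γ} {γ} x y (↑-mono (∈-++⁺ʳ u₁)) (λ _ → id))) r₂

  _≃_ : Tm m → Tm m → Set₁
  t ≃ t' = ∀ {γ} → UpE γ → (⟦ t ⟧ γ ⊆ ⟦ t' ⟧ γ) × (⟦ t' ⟧ γ ⊆ ⟦ t ⟧ γ)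

  ⟶-sound : ∀ {t t'} → t ⟶ t' → t ≃ t'
  ⟶-sound (_⟶_.α {x} {y} {t} y∉) {γ} up =
    (λ {p} q → proj₂ (sub p) (mono t (proj₂ (env p)) q))
    , (λ {p} q → mono t (proj₁ (env p)) (proj₁ (sub p) q))
    where
    δ : Pnt → Env
    δ p = γ [ y ≔ ↑ (hd p) ]
    sub : ∀ p → (⟦ t [ var y / x ] ⟧ δ p ⊆ ⟦ t ⟧ (δ p [ x ≔ δ p y ])) × (⟦ t ⟧ (δ p [ x ≔ δ p y ]) ⊆ ⟦ t [ var y / x ] ⟧ δ p)
    sub p = sem-sub t (var y) x (λ { i (here refl) → proj₂ (∉-app y∉) i })
    δy : ∀ p → (δ p y ⊆ ↑ (hd p)) × (↑ (hd p) ⊆ δ p y)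
    δy p with y NatP.≟ y
    ... | yes _ = id , id
    ... | no n = ⊥-elim (n refl)
    env : ∀ p → (∀ {z} → z ∈ fv t → (δ p [ x ≔ δ p y ]) z ⊆ (γ [ x ≔ ↑ (hd p) ]) z)
              × (∀ {z} → z ∈ fv t → (γ [ x ≔ ↑ (hd p) ]) z ⊆ (δ p [ x ≔ δ p y ]) z)
    env p = (λ {z} i → upd-⊆ {δ p} {γ} x z (proj₁ (δy p)) (λ _ → proj₂ (upd-skip {γ} y z (ne i))))
          , (λ {z} i → upd-⊆ {γ} {δ p} x z (proj₂ (δy p)) (λ _ → proj₁ (upd-skip {γ} y z (ne i))))
      where
      ne : ∀ {z} → z ∈ fv t → y ≢ z
      ne i refl = proj₁ (∉-app y∉) i
  ⟶-sound (_⟶_.β {x} {t} {s} h) {γ} up =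
    (λ (u , a , b) → proj₂ (sem-sub t s x h)
        (mono t (λ {y} _ → upd-⊆ {γ} {γ} x y (↑⊆ (sem-up s up) b) (λ _ → id)) a))
    , (λ {p} q → let (u , k , r) = compact t x {γ} {⟦ s ⟧ γ} (sem-up s up) (proj₁ (sem-sub t s x h) q) in u , r , k)
  -- `u ⇒ tl p` lies below `p` because each element of `u` lies above one of `hd p`; conversely `p`
  -- lies below `hd p ⇒ tl p`. Both hold for an atom `p` too, by the choice of `hd` and `tl`.
  ⟶-sound (_⟶_.η {x} {t} x∉) {γ} up =
    (λ {p} (u , a , b) → sem-up t up
        (step (⊑-refl (tl p)) (λ i → proj₁ (find (b' p b i)))
              (λ i → proj₁ (proj₂ (find (b' p b i)))) (λ i → proj₂ (proj₂ (find (b' p b i)))))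
        (mono t (λ {z} i → proj₂ (upd-skip {γ} x z (ne i))) a))
    , (λ {p} q → hd p
        , mono t (λ {z} i → proj₁ (upd-skip {γ} x z (ne i)))
            (sem-up t up (step (⊑-refl (tl p)) (λ {x} _ → x) id (λ {x} _ → ⊑-refl x)) q)
        , All.tabulate (λ i → proj₂ (self p) (⊆↑ i)))
    where
    ne : ∀ {z} → z ∈ fv t → x ≢ z
    ne i refl = x∉ i
    self : ∀ p → ((γ [ x ≔ ↑ (hd p) ]) x ⊆ ↑ (hd p)) × (↑ (hd p) ⊆ (γ [ x ≔ ↑ (hd p) ]) x)
    self p with x NatP.≟ x
    ... | yes _ = id , id
    ... | no n = ⊥-elim (n refl)
    b' : ∀ p {u z} → All ((γ [ x ≔ ↑ (hd p) ]) x) u → z ∈ u → ↑ (hd p) z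
    b' p b i = proj₁ (self p) (All.lookup b i)
  ⟶-sound (_⟶_.ξ {x} r) up =
    (λ {p} → proj₁ (⟶-sound r (upd-up x up (↑-up (hd p))))) , (λ {p} → proj₂ (⟶-sound r (upd-up x up (↑-up (hd p)))))
  ⟶-sound (_⟶_.appˡ r) up =
    (λ (u , a , b) → u , proj₁ (⟶-sound r up) a , b) , (λ (u , a , b) → u , proj₂ (⟶-sound r up) a , b)
  ⟶-sound (_⟶_.appʳ r) up =
    (λ (u , a , b) → u , a , All.map (proj₁ (⟶-sound r up)) b) , (λ (u , a , b) → u , a , All.map (proj₂ (⟶-sound r up)) b)

  ≈-sound : ∀ {t t'} → t ≈βη t' → t ≃ t'
  ≈-sound ε up = id , id
  ≈-sound (fwd r ◅ rs) up =
    let (a , b) = ⟶-sound r up ; (c , d) = ≈-sound rs up in (λ x → c (a x)) , (λ x → b (d x))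
  ≈-sound (bwd r ◅ rs) up =
    let (a , b) = ⟶-sound r up ; (c , d) = ≈-sound rs up in (λ x → c (b x)) , (λ x → a (d x))

  QTy : Fin m → STy D → Set
  QTy c a = ∃ λ x → ∃ λ y → a ≡ (at x ⊸ˢ at y) × Q c x y

  lookup-up : ∀ {γ : Env} {X} x → X ⊆ (γ [ x ≔ X ]) x
  lookup-up x with x NatP.≟ x
  ... | yes _ = id
  ... | no n = ⊥-elim (n refl)

  typed-sound : ∀ {Γ t a} → STyped QTy Γ t a →
                ∀ {γ} → UpE γ → All (λ b → γ (proj₁ b) (emb (proj₂ b))) Γ → (⟦ t ⟧ γ) (emb a)
  typed-sound ax up (h ∷ []) = h
  typed-sound (cn (x , y , refl , q)) up h = x , y , q , ⊑-refl _
  typed-sound (app {Γ} {a = a} d e _) up h =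
    emb a ∷ [] , typed-sound d up (AllP.++⁻ˡ Γ h) , typed-sound e up (AllP.++⁻ʳ Γ h) ∷ []
  typed-sound (lam {Γ} {Δ} {x} {t} {a} d) {γ} up h = typed-sound d (upd-up x up (↑-up _))
      (AllP.++⁺ (skip Γ (AllP.++⁻ˡ _ x≢) (AllP.++⁻ˡ Γ h))
                (lookup-up {γ} x (here (⊑-refl _)) ∷ skip Δ (AllP.++⁻ʳ (map proj₁ Γ) x≢) (AllP.++⁻ʳ Γ h)))
    where
    x≢ : All (x ≢_) (map proj₁ Γ ++ map proj₁ Δ)
    x≢ = subst (All (x ≢_)) (map-++ proj₁ Γ Δ) (proj₂ (STyped-lam-unique Γ (STyped-unique d)))
    skip : ∀ Ξ → All (x ≢_) (map proj₁ Ξ) → All (λ b → γ (proj₁ b) (emb (proj₂ b))) Ξ →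
           All (λ b → (γ [ x ≔ ↑ (emb a ∷ []) ]) (proj₁ b) (emb (proj₂ b))) Ξ
    skip [] [] [] = []
    skip ((y , b) ∷ Ξ) (n ∷ ns) (k ∷ ks) = proj₁ (upd-skip {γ} x y n) k ∷ skip Ξ ns ks

  Q* : List (Fin m) → D → D → Set
  Q* []      x y = x ≡ y
  Q* (c ∷ w) x y = ∃ λ z → Q* w x z × Q c z y

  word : List (Fin m) → Tm m
  word = foldr (λ c t → app (con c) t) (var 0)

  sem-word : ∀ w {γ h p} → (γ 0 ⊆ ↑ (h ∷ [])) → (⟦ word w ⟧ γ) p →
             (w ≡ [] × h ⊑ p) ⊎ (∃ λ x → ∃ λ y → Q* w x y × h ⊑ atm (just x) × atm (just y) ⊑ p)
  sem-word [] k q with k q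
  ... | here d = inj₁ (refl , d)
  sem-word (c ∷ w) k (u , (x , y , q , step d g g∈ g⊑) , us)
    with sem-word w k (All.lookup us (g∈ (here refl)))
  ... | inj₁ (refl , e) = inj₂ (x , y , (x , refl , q) , ⊑-trans e (g⊑ (here refl)) , d)
  -- The result of one letter lies below the argument of the next. Embedded atoms are incomparable,
  -- so the two values agree and the path continues.
  ... | inj₂ (x' , y' , q' , e , e') with emb-⊑ (at y') (at x) (⊑-trans e' (g⊑ (here refl)))
  ...   | refl = inj₂ (x' , y , (x , q' , q) , e , d)

  sem-ρ : ∀ w {γ} s → (⟦ ρ w ⟧ γ) (emb s) →
          (w ≡ [] × ∃ λ a → s ≡ (a ⊸ˢ a)) ⊎ (∃ λ x → ∃ λ y → s ≡ (at x ⊸ˢ at y) × Q* w x y)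
  sem-ρ w (at d) q with sem-word w id q
  ... | inj₁ (_ , e) with ⊑-target e
  ...   | ()
  sem-ρ w (at d) q | inj₂ (x , y , _ , e , _) with ⊑-target e
  ...   | ()
  sem-ρ w (a ⊸ˢ b) q with sem-word w id q
  ... | inj₁ (e , d) with emb-⊑ a b d
  ...   | refl = inj₁ (e , a , refl)
  sem-ρ w (a ⊸ˢ b) q | inj₂ (x , y , q' , e , e') with emb-⊑ a (at x) e | emb-⊑ (at y) b e'
  ...   | refl | refl = inj₂ (x , y , refl , q')

  -- Conversion preserves denotations, so every refined type of `t` is a point of `ρ w`, and `sem-ρ`
  -- lists the embedded types found there.
  convertible-ρ : ∀ {w t s} → ρ w ≈βη t → STyped QTy [] t s →
          (w ≡ [] × ∃ λ a → s ≡ (a ⊸ˢ a)) ⊎ (∃ λ x → ∃ λ y → s ≡ (at x ⊸ˢ at y) × Q* w x y)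
  convertible-ρ {w} {t} {s} r d =
    sem-ρ w {λ _ _ → ⊥} s (proj₂ (≈-sound r (λ _ _ ())) (typed-sound d (λ _ _ ()) []))

-- Realizability of refined types

open import Data.List.Membership.DecPropositional NatP._≟_ using (_∈?_)

open Counting NatP._≟_ using () renaming (cnt to occ; ind to isOcc; ind-≢ to isOcc-≢; cnt-++ to occ-++; cnt-∉ to occ-∉; cnt-∈ to occ-∈)

module _ {m : ℕ} where

  ≈-sym : {t s : Tm m} → t ≈βη s → s ≈βη t
  ≈-sym = Eq.symmetric _⟶_

  ≈-appˡ : {t t' : Tm m} (s : Tm m) → t ≈βη t' → app t s ≈βη app t' s
  ≈-appˡ s = Eq.gmap (λ t → app t s) appˡ

  ≈-appʳ : {s s' : Tm m} (t : Tm m) → s ≈βη s' → app t s ≈βη app t s'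
  ≈-appʳ t = Eq.gmap (app t) appʳ

  ≈-lam : ∀ x {t t' : Tm m} → t ≈βη t' → lam x t ≈βη lam x t'
  ≈-lam x = Eq.gmap (lam x) ξ

  ≈-step : {t t' : Tm m} → t ⟶ t' → t ≈βη t'
  ≈-step r = fwd r ◅ ε

  ≈-ext : ∀ {x} {t s : Tm m} → x ∉ fv t → x ∉ fv s → app t (var x) ≈βη app s (var x) → t ≈βη s
  ≈-ext {x} x∉t x∉s r = bwd (η x∉t) ◅ (≈-lam x r ◅◅ ≈-step (η x∉s))

occ-filter-≡ : ∀ x xs → occ x (filter (λ y → ¬? (y NatP.≟ x)) xs) ≡ 0
occ-filter-≡ x xs = occ-∉ _ λ i → proj₂ (∈-filter⁻ (λ y → ¬? (y NatP.≟ x)) {xs = xs} i) refl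

occ-filter-≢ : ∀ {x y} xs → y ≢ x → occ y (filter (λ y → ¬? (y NatP.≟ x)) xs) ≡ occ y xs
occ-filter-≢ [] n = refl
occ-filter-≢ {x} {y} (z ∷ xs) n with z NatP.≟ x
... | yes refl rewrite dec-true (z NatP.≟ z) refl | isOcc-≢ n = occ-filter-≢ xs n
... | no e rewrite dec-false (z NatP.≟ x) e = cong (isOcc y z ℕ.+_) (occ-filter-≢ xs n)

Subst : ℕ → Set
Subst m = ℕ → Tm m

module _ {m : ℕ} where

  choose : ∀ {x y : ℕ} → Dec (x ≡ y) → Tm m → Tm m → Tm m
  choose (yes _) s t = s
  choose (no _)  s t = t

  _⟨_↦_⟩ : Subst m → ℕ → Tm m → Subst m
  (σ ⟨ x ↦ s ⟩) y = choose (x NatP.≟ y) s (σ y)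

  sub : Subst m → Tm m → Tm m
  sub σ (var x)   = σ x
  sub σ (con c)   = con c
  sub σ (app t s) = app (sub σ t) (sub σ s)
  sub σ (lam x t) = lam x (sub (σ ⟨ x ↦ var x ⟩) t)

  upd-eq : ∀ σ x s → (σ ⟨ x ↦ s ⟩) x ≡ s
  upd-eq σ x s with x NatP.≟ x
  ... | yes _ = refl
  ... | no n = ⊥-elim (n refl)

  upd-neq : ∀ σ {x y} s → x ≢ y → (σ ⟨ x ↦ s ⟩) y ≡ σ y
  upd-neq σ {x} {y} s n with x NatP.≟ y
  ... | yes e = ⊥-elim (n e)
  ... | no _ = refl

  sub-cong : ∀ t {σ τ : Subst m} → (∀ {y} → y ∈ fv t → σ y ≡ τ y) → sub σ t ≡ sub τ t
  sub-cong (var x) h = h (here refl)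
  sub-cong (con c) h = refl
  sub-cong (app t s) h = cong₂ app (sub-cong t (h ∘ ∈-++⁺ˡ)) (sub-cong s (h ∘ ∈-++⁺ʳ (fv t)))
  sub-cong (lam x t) {σ} {τ} h = cong (lam x) (sub-cong t k)
    where
    k : ∀ {y} → y ∈ fv t → (σ ⟨ x ↦ var x ⟩) y ≡ (τ ⟨ x ↦ var x ⟩) y
    k {y} i with x NatP.≟ y
    ... | yes _ = refl
    ... | no n = h (∈-filter⁺ (λ z → ¬? (z NatP.≟ x)) i (n ∘ sym))

  sub-var : ∀ t → sub var t ≡ t
  sub-var (var x) = refl
  sub-var (con c) = refl
  sub-var (app t s) = cong₂ app (sub-var t) (sub-var s)
  sub-var (lam x t) = cong (lam x) (trans (sub-cong t k) (sub-var t))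
    where
    k : ∀ {y} → y ∈ fv t → (var ⟨ x ↦ var x ⟩) y ≡ var y
    k {y} _ with x NatP.≟ y
    ... | yes refl = refl
    ... | no n = refl

  []-fresh : ∀ (t : Tm m) {x s} → x ∉ fv t → t [ s / x ] ≡ t
  []-fresh (var y) {x} h with x NatP.≟ y
  ... | yes e = ⊥-elim (h (here e))
  ... | no n rewrite dec-false (x NatP.≟ y) n = refl
  []-fresh (con c) h = refl
  []-fresh (app t s) h = cong₂ app ([]-fresh t (h ∘ ∈-++⁺ˡ)) ([]-fresh s (h ∘ ∈-++⁺ʳ (fv t)))
  []-fresh (lam y t) {x} h with x NatP.≟ y
  ... | yes e rewrite dec-true (x NatP.≟ y) e = refl
  ... | no n rewrite dec-false (x NatP.≟ y) n =
    cong (lam y) ([]-fresh t (λ i → h (∈-filter⁺ (λ z → ¬? (z NatP.≟ y)) i n)))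

  -- `x` is free in no other value of `σ`, so the later replacement reaches only the places of `x`
  -- itself. Both operations are naive and therefore capture alike.
  sub-[] : ∀ t {σ τ : Subst m} {x r} → σ x ≡ var x → τ x ≡ r →
           (∀ {z} → z ≢ x → σ z ≡ τ z × x ∉ fv (σ z)) → sub σ t [ r / x ] ≡ sub τ t
  sub-[] (var y) {σ} {τ} {x} {r} hx hr h with y NatP.≟ x
  ... | yes refl rewrite hx | hr | dec-true (x NatP.≟ x) refl = refl
  ... | no n = trans ([]-fresh (σ y) (proj₂ (h n))) (proj₁ (h n))
  sub-[] (con c) hx hr h = refl
  sub-[] (app t s) hx hr h = cong₂ app (sub-[] t hx hr h) (sub-[] s hx hr h)
  sub-[] (lam y t) {σ} {τ} {x} {r} hx hr h with x NatP.≟ y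
  ... | yes refl rewrite dec-true (x NatP.≟ x) refl = cong (lam x) (sub-cong t k)
    where
    k : ∀ {z} → z ∈ fv t → (σ ⟨ x ↦ var x ⟩) z ≡ (τ ⟨ x ↦ var x ⟩) z
    k {z} _ with x NatP.≟ z
    ... | yes _ = refl
    ... | no n = proj₁ (h (n ∘ sym))
  ... | no n rewrite dec-false (x NatP.≟ y) n =
    cong (lam y) (sub-[] t (trans (upd-neq σ _ (n ∘ sym)) hx) (trans (upd-neq τ _ (n ∘ sym)) hr) k)
    where
    k : ∀ {z} → z ≢ x → (σ ⟨ y ↦ var y ⟩) z ≡ (τ ⟨ y ↦ var y ⟩) z × x ∉ fv ((σ ⟨ y ↦ var y ⟩) z)
    k {z} z≢x with y NatP.≟ z
    ... | yes refl = refl , λ { (here refl) → z≢x refl }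
    ... | no _ = h z≢x

  STyped-fv : ∀ {L} {R : Fin m → STy L → Set} {Γ t a} → STyped R Γ t a → ∀ {y} → y ∈ fv t → y ∈ map proj₁ Γ
  STyped-fv ax i = i
  STyped-fv (app {Γ} {Δ} {t} d e _) i rewrite map-++ proj₁ Γ Δ with ∈-++⁻ (fv t) i
  ... | inj₁ j = ∈-++⁺ˡ (STyped-fv d j)
  ... | inj₂ j = ∈-++⁺ʳ (map proj₁ Γ) (STyped-fv e j)
  STyped-fv (lam {Γ} {Δ} {x} {t} {a} d) {y} i
    with ∈-filter⁻ (λ z → ¬? (z NatP.≟ x)) {xs = fv t} i
  ... | j , n with STyped-fv d j
  ... | k rewrite map-++ proj₁ Γ ((x , a) ∷ Δ) | map-++ proj₁ Γ Δ with ∈-++⁻ (map proj₁ Γ) k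
  ...   | inj₁ k' = ∈-++⁺ˡ k'
  ...   | inj₂ (here e) = ⊥-elim (n e)
  ...   | inj₂ (there k') = ∈-++⁺ʳ (map proj₁ Γ) k'

-- The free variables of realizers are counted: by linearity, a realizer of a ⊸ b has the
-- variables of b minus those of a.  This makes the variables used by reify fresh.
module Realizability {m : ℕ} {D : Set} (R : Fin m → STy D → Set) (X : ℕ → Set) (e : D → Tm m)
                     (e-fv : ∀ d {y} → y ∈ fv (e d) → X y) where

  -- The balance of a variable at a type; it lives in ℤ since the argument may count more
  -- occurrences than the result.
  V : STy D → ℕ → ℤ
  V (at d)    y = +ᶻ occ y (fv (e d))
  V (a ⊸ˢ b) y = V b y ℤ.- V a y

  -- Free variables of realizers lie in `X` by `good-fv` and their binders outside, so applying a
  -- realizer to another one causes no capture.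
  Avoids : Tm m → Set
  Avoids t = ∀ {y} → y ∈ binders t → ¬ X y

  record Good (a : STy D) (s : Tm m) : Set where
    constructor good
    field
      count  : ∀ y → +ᶻ occ y (fv s) ≡ V a y
      avoids : Avoids s
  open Good

  Conv : STy D → Tm m → Set
  Conv (at d)    s = s ≈βη e d
  Conv (a ⊸ˢ b) s = ∀ r → Good a r → Conv a r → Conv b (app s r)

  Conv-≈ : ∀ a {s s'} → s ≈βη s' → Conv a s' → Conv a s
  Conv-≈ (at d) r h = r ◅◅ h
  Conv-≈ (a ⊸ˢ b) r h q g c = Conv-≈ b (≈-appˡ q r) (h q g c)

  V-support : ∀ a y → V a y ≡ 0ℤ ⊎ X y
  V-support (at d) y with y ∈? fv (e d)
  ... | yes i = inj₂ (e-fv d i)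
  ... | no n = inj₁ (cong +ᶻ_ (occ-∉ (fv (e d)) n))
  V-support (a ⊸ˢ b) y with V-support a y | V-support b y
  ... | inj₂ x | _ = inj₂ x
  ... | inj₁ _ | inj₂ x = inj₂ x
  ... | inj₁ p | inj₁ q rewrite p | q = inj₁ refl

  good-fv : ∀ {a s} → Good a s → ∀ {y} → y ∈ fv s → X y
  good-fv {a} {s} g {y} i with V-support a y
  ... | inj₂ x = x
  ... | inj₁ z = ⊥-elim (occ-∈ (fv s) i (ℤP.+-injective (trans (count g y) z)))

  minus-plus : ∀ i j → (i ℤ.- j) ℤ.+ j ≡ i
  minus-plus i j = trans (ℤP.+-assoc i (ℤ.- j) j)
    (trans (cong (λ k → i ℤ.+ k) (ℤP.+-inverseˡ j)) (ℤP.+-identityʳ i))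

  plus-minus : ∀ i j → (i ℤ.+ j) ℤ.- j ≡ i
  plus-minus i j = trans (ℤP.+-assoc i j (ℤ.- j))
    (trans (cong (λ k → i ℤ.+ k) (ℤP.+-inverseʳ j)) (ℤP.+-identityʳ i))

  good-app : ∀ {a b s r} → Good (a ⊸ˢ b) s → Good a r → Good b (app s r)
  good-app {a} {b} {s} {r} g h .count y = begin
    +ᶻ occ y (fv s ++ fv r)            ≡⟨ cong +ᶻ_ (occ-++ y (fv s) (fv r)) ⟩
    +ᶻ (occ y (fv s) ℕ.+ occ y (fv r)) ≡⟨ cong₂ ℤ._+_ (count g y) (count h y) ⟩
    (V b y ℤ.- V a y) ℤ.+ V a y       ≡⟨ minus-plus (V b y) (V a y) ⟩
    V b y                             ∎
    where open ≡-Reasoning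
  good-app {s = s} g h .avoids i with ∈-++⁻ (binders s) i
  ... | inj₁ j = avoids g j
  ... | inj₂ j = avoids h j

  ΣV : SCx D → ℕ → ℤ
  ΣV [] y = 0ℤ
  ΣV ((_ , a) ∷ Γ) y = V a y ℤ.+ ΣV Γ y

  ΣV-++ : ∀ Γ Δ y → ΣV (Γ ++ Δ) y ≡ ΣV Γ y ℤ.+ ΣV Δ y
  ΣV-++ [] Δ y = sym (ℤP.+-identityˡ _)
  ΣV-++ ((_ , a) ∷ Γ) Δ y = trans (cong (λ k → V a y ℤ.+ k) (ΣV-++ Γ Δ y)) (sym (ℤP.+-assoc (V a y) _ _))

  ΣC : Subst m → SCx D → ℕ → ℕ
  ΣC σ [] y = 0
  ΣC σ ((x , _) ∷ Γ) y = occ y (fv (σ x)) ℕ.+ ΣC σ Γ y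

  ΣC-++ : ∀ σ Γ Δ y → ΣC σ (Γ ++ Δ) y ≡ ΣC σ Γ y ℕ.+ ΣC σ Δ y
  ΣC-++ σ [] Δ y = refl
  ΣC-++ σ ((x , a) ∷ Γ) Δ y = trans (cong (occ y (fv (σ x)) ℕ.+_) (ΣC-++ σ Γ Δ y)) (sym (NatP.+-assoc (occ y (fv (σ x))) _ _))

  middle : ∀ i j k → i ℤ.+ (j ℤ.+ k) ≡ (i ℤ.+ k) ℤ.+ j
  middle i j k = trans (cong (λ k → i ℤ.+ k) (ℤP.+-comm j k)) (sym (ℤP.+-assoc i k j))

  module _ (R-V : ∀ {c a} → R c a → ∀ y → V a y ≡ 0ℤ) where

    typed-V : ∀ {Γ t a} → STyped R Γ t a → ∀ y → ΣV Γ y ≡ V a y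
    typed-V (ax {x} {a}) y = ℤP.+-identityʳ (V a y)
    typed-V (cn r) y = sym (R-V r y)
    typed-V (app {Γ} {Δ} {a = a} {b} d d' _) y =
      trans (ΣV-++ Γ Δ y) (trans (cong₂ ℤ._+_ (typed-V d y) (typed-V d' y)) (minus-plus (V b y) (V a y)))
    typed-V (lam {Γ} {Δ} {x} {t} {a} {b} d) y = begin
      ΣV (Γ ++ Δ) y                               ≡⟨ ΣV-++ Γ Δ y ⟩
      ΣV Γ y ℤ.+ ΣV Δ y                           ≡⟨ sym (plus-minus _ (V a y)) ⟩
      (ΣV Γ y ℤ.+ ΣV Δ y ℤ.+ V a y) ℤ.- V a y     ≡⟨ cong (ℤ._- V a y) (sym (middle (ΣV Γ y) (V a y) (ΣV Δ y))) ⟩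
      (ΣV Γ y ℤ.+ (V a y ℤ.+ ΣV Δ y)) ℤ.- V a y   ≡⟨ cong (ℤ._- V a y) (sym (ΣV-++ Γ ((x , a) ∷ Δ) y)) ⟩
      ΣV (Γ ++ (x , a) ∷ Δ) y ℤ.- V a y           ≡⟨ cong (ℤ._- V a y) (typed-V d y) ⟩
      V b y ℤ.- V a y                             ∎
      where open ≡-Reasoning

    -- `sub` sends a variable bound on the way to itself, and such a variable is outside `X`; this
    -- is the second alternative.
    Fine : Subst m → ℕ → Set
    Fine σ z = (∀ {y} → y ∈ fv (σ z) → X y) ⊎ σ z ≡ var z

    ΣC-upd : ∀ σ x s Γ y → All (x ≢_) (map proj₁ Γ) → ΣC (σ ⟨ x ↦ s ⟩) Γ y ≡ ΣC σ Γ y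
    ΣC-upd σ x s [] y [] = refl
    ΣC-upd σ x s ((z , _) ∷ Γ) y (n ∷ ns) =
      cong₂ ℕ._+_ (cong (occ y ∘ fv) (upd-neq σ s n)) (ΣC-upd σ x s Γ y ns)

    fine-upd : ∀ {σ x} (Γ : SCx D) → All (x ≢_) (map proj₁ Γ) → All (Fine σ) (map proj₁ Γ) →
               All (Fine (σ ⟨ x ↦ var x ⟩)) (map proj₁ Γ)
    fine-upd [] [] [] = []
    fine-upd {σ} {x} ((z , _) ∷ Γ) (n ∷ ns) (f ∷ fs) = go f ∷ fine-upd Γ ns fs
      where
      go : Fine σ z → Fine (σ ⟨ x ↦ var x ⟩) z
      go rewrite upd-neq σ {x} {z} (var x) n = id

    ΣC-bound : ∀ {σ x} (Γ : SCx D) → ¬ X x → All (x ≢_) (map proj₁ Γ) → All (Fine σ) (map proj₁ Γ) → ΣC σ Γ x ≡ 0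
    ΣC-bound [] nX [] [] = refl
    ΣC-bound {σ} {x} ((z , _) ∷ Γ) nX (n ∷ ns) (f ∷ fs) =
      cong₂ ℕ._+_ (occ-∉ (fv (σ z)) (go f)) (ΣC-bound Γ nX ns fs)
      where
      go : Fine σ z → x ∉ fv (σ z)
      go (inj₁ h) i = nX (h i)
      go (inj₂ h) i rewrite h with i
      ... | here e = n e

    sub-count : ∀ {Γ t a} → STyped R Γ t a → Avoids t → ∀ σ → All (Fine σ) (map proj₁ Γ) →
                ∀ y → occ y (fv (sub σ t)) ≡ ΣC σ Γ y
    sub-count ax av σ f y = sym (NatP.+-identityʳ _)
    sub-count (cn r) av σ f y = refl
    sub-count (app {Γ} {Δ} {t} {s} d d' _) av σ f y rewrite map-++ proj₁ Γ Δ =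
      trans (occ-++ y (fv (sub σ t)) _)
        (trans (cong₂ ℕ._+_ (sub-count d (av ∘ ∈-++⁺ˡ) σ (AllP.++⁻ˡ _ f) y)
                            (sub-count d' (av ∘ ∈-++⁺ʳ (binders t)) σ (AllP.++⁻ʳ (map proj₁ Γ) f) y))
               (sym (ΣC-++ σ Γ Δ y)))
    sub-count (lam {Γ} {Δ} {x} {t} {a} d) av σ f y
      with STyped-lam-unique Γ (STyped-unique d)
    ... | _ , x≢ with y NatP.≟ x
    ...   | yes refl = trans (occ-filter-≡ x (fv (sub (σ ⟨ x ↦ var x ⟩) t)))
                             (sym (ΣC-bound (Γ ++ Δ) (av (here refl)) x≢ f))
    ...   | no n = begin
      occ y (filter (λ z → ¬? (z NatP.≟ x)) (fv (sub σ' t))) ≡⟨ occ-filter-≢ (fv (sub σ' t)) n ⟩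
      occ y (fv (sub σ' t))                                  ≡⟨ sub-count d (av ∘ there) σ' f' y ⟩
      ΣC σ' (Γ ++ (x , a) ∷ Δ) y                             ≡⟨ ΣC-++ σ' Γ ((x , a) ∷ Δ) y ⟩
      ΣC σ' Γ y ℕ.+ (occ y (fv (σ' x)) ℕ.+ ΣC σ' Δ y)        ≡⟨ cong (λ k → ΣC σ' Γ y ℕ.+ (k ℕ.+ ΣC σ' Δ y)) x0 ⟩
      ΣC σ' Γ y ℕ.+ ΣC σ' Δ y                                ≡⟨ sym (ΣC-++ σ' Γ Δ y) ⟩
      ΣC σ' (Γ ++ Δ) y                                       ≡⟨ ΣC-upd σ x (var x) (Γ ++ Δ) y x≢ ⟩
      ΣC σ (Γ ++ Δ) y                                        ∎
      where
      open ≡-Reasoning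
      σ' = σ ⟨ x ↦ var x ⟩
      x0 : occ y (fv (σ' x)) ≡ 0
      x0 rewrite upd-eq σ x (var x) = occ-∉ (x ∷ []) λ { (here e) → n e }
      f₁ : All (Fine σ') (map proj₁ Γ ++ map proj₁ Δ)
      f₁ = subst (All (Fine σ')) (map-++ proj₁ Γ Δ) (fine-upd (Γ ++ Δ) x≢ f)
      f' : All (Fine σ') (map proj₁ (Γ ++ (x , a) ∷ Δ))
      f' rewrite map-++ proj₁ Γ ((x , a) ∷ Δ) =
        AllP.++⁺ (AllP.++⁻ˡ _ f₁) (inj₂ (upd-eq σ x (var x)) ∷ AllP.++⁻ʳ (map proj₁ Γ) f₁)

    record OkSub (σ : Subst m) : Set where
      field
        fvX : ∀ z {y} → y ∈ fv (σ z) → X y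
        avX : ∀ z → Avoids (σ z)
    open OkSub

    sub-avoids : ∀ t {σ} → (∀ z → Avoids (σ z)) → Avoids t → Avoids (sub σ t)
    sub-avoids (var x) h av = h x
    sub-avoids (con c) h av = λ ()
    sub-avoids (app t s) {σ} h av i with ∈-++⁻ (binders (sub σ t)) i
    ... | inj₁ j = sub-avoids t h (av ∘ ∈-++⁺ˡ) j
    ... | inj₂ j = sub-avoids s h (av ∘ ∈-++⁺ʳ (binders t)) j
    sub-avoids (lam x t) h av (here refl) = av (here refl)
    sub-avoids (lam x t) {σ} h av (there i) = sub-avoids t h' (av ∘ there) i
      where
      h' : ∀ z → Avoids ((σ ⟨ x ↦ var x ⟩) z)
      h' z with x NatP.≟ z
      ... | yes _ = λ ()
      ... | no _ = h z

    _⊩_ : Tm m → STy D → Set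
    s ⊩ a = Good a s × Conv a s

    good-sub : ∀ {Γ t a} → STyped R Γ t a → Avoids t → ∀ σ → OkSub σ →
               All (λ b → σ (proj₁ b) ⊩ proj₂ b) Γ → Good a (sub σ t)
    good-sub {Γ} {t} {a} d av σ ok h .count y =
      trans (cong +ᶻ_ (sub-count d av σ (All.tabulate λ _ → inj₁ (fvX ok _)) y)) (trans (go Γ h) (typed-V d y))
      where
      go : ∀ Γ → All (λ b → σ (proj₁ b) ⊩ proj₂ b) Γ → +ᶻ ΣC σ Γ y ≡ ΣV Γ y
      go [] [] = refl
      go (_ ∷ Γ) (k ∷ ks) = cong₂ ℤ._+_ (count (proj₁ k) y) (go Γ ks)
    good-sub {t = t} d av σ ok h .avoids = sub-avoids t (avX ok) av

    module _ (R-Conv : ∀ {c a} → R c a → Conv a (con c)) where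

      -- The fundamental lemma of the logical relation. For an abstraction, `Avoids` licenses the
      -- β-step, `sub-[]` turns its contractum into an instance of the body, and `Conv-≈` carries
      -- the result back to the redex.
      realize : ∀ {Γ t a} → STyped R Γ t a → Avoids t → ∀ σ → OkSub σ →
                All (λ b → σ (proj₁ b) ⊩ proj₂ b) Γ → Conv a (sub σ t)
      realize ax av σ ok (h ∷ []) = proj₂ h
      realize (cn r) av σ ok h = R-Conv r
      realize (app {Γ} {t = t} d d' _) av σ ok h =
        realize d (av ∘ ∈-++⁺ˡ) σ ok (AllP.++⁻ˡ Γ h) _
          (good-sub d' (av ∘ ∈-++⁺ʳ (binders t)) σ ok (AllP.++⁻ʳ Γ h))
          (realize d' (av ∘ ∈-++⁺ʳ (binders t)) σ ok (AllP.++⁻ʳ Γ h))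
      realize (lam {Γ} {Δ} {x} {t} {a} {b} d) av σ ok h r g c =
        Conv-≈ b (≈-step (β λ i j → sub-avoids t avσ' (av ∘ there) i (good-fv g j)))
          (subst (Conv b) (sym (sub-[] t (upd-eq σ x (var x)) (upd-eq σ x r) agree))
            (realize d (av ∘ there) (σ ⟨ x ↦ r ⟩) ok'
              (AllP.++⁺ (skip Γ (AllP.++⁻ˡ _ x≢) (AllP.++⁻ˡ Γ h))
                 (subst (_⊩ a) (sym (upd-eq σ x r)) (g , c) ∷ skip Δ (AllP.++⁻ʳ (map proj₁ Γ) x≢) (AllP.++⁻ʳ Γ h)))))
        where
        x≢ : All (x ≢_) (map proj₁ Γ ++ map proj₁ Δ)
        x≢ = subst (All (x ≢_)) (map-++ proj₁ Γ Δ) (proj₂ (STyped-lam-unique Γ (STyped-unique d)))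
        avσ' : ∀ z → Avoids ((σ ⟨ x ↦ var x ⟩) z)
        avσ' z with x NatP.≟ z
        ... | yes _ = λ ()
        ... | no _ = avX ok z
        agree : ∀ {z} → z ≢ x → (σ ⟨ x ↦ var x ⟩) z ≡ (σ ⟨ x ↦ r ⟩) z × x ∉ fv ((σ ⟨ x ↦ var x ⟩) z)
        agree {z} n with x NatP.≟ z
        ... | yes refl = ⊥-elim (n refl)
        ... | no _ = refl , λ i → av (here refl) (fvX ok z i)
        ok' : OkSub (σ ⟨ x ↦ r ⟩)
        ok' .fvX z with x NatP.≟ z
        ... | yes _ = good-fv g
        ... | no _ = fvX ok z
        ok' .avX z with x NatP.≟ z
        ... | yes _ = avoids g
        ... | no _ = avX ok z
        skip : ∀ Ξ → All (x ≢_) (map proj₁ Ξ) → All (λ b → σ (proj₁ b) ⊩ proj₂ b) Ξ →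
               All (λ b → (σ ⟨ x ↦ r ⟩) (proj₁ b) ⊩ proj₂ b) Ξ
        skip [] [] [] = []
        skip ((z , b) ∷ Ξ) (n ∷ ns) (k ∷ ks) = subst (_⊩ b) (sym (upd-neq σ r n)) k ∷ skip Ξ ns ks

      realize-closed : ∀ {t a x₀} → X x₀ → STyped R [] t a → Avoids t → t ⊩ a
      realize-closed {t} {a} {x₀} Xx d av =
        subst (_⊩ a) id-t (good-sub d av σ ok [] , realize d av σ ok [])
        where
        -- `OkSub` wants the free variables of every value in `X`, which the identity substitution
        -- violates. A closed term is left unchanged by any substitution, so a constant one is
        -- taken.
        σ : Subst m
        σ _ = var x₀
        ok : OkSub σ
        ok .fvX z (here refl) = Xx
        ok .avX z ()
        id-t : sub σ t ≡ t
        id-t = trans (sub-cong t (λ i → ⊥-elim (∉[] (STyped-fv d i)))) (sub-var t)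
          where
          ∉[] : ∀ {y : ℕ} → y ∉ []
          ∉[] ()

fresh : List ℕ → ℕ
fresh xs = suc (sum xs)

≤-sum : ∀ {y} xs → y ∈ xs → y ≤ sum xs
≤-sum (x ∷ xs) (here refl) = NatP.m≤m+n x (sum xs)
≤-sum (x ∷ xs) (there i) = NatP.≤-trans (≤-sum xs i) (NatP.m≤n+m (sum xs) x)

∈<fresh : ∀ {y} xs → y ∈ xs → y < fresh xs
∈<fresh xs i = s≤s (≤-sum xs i)

wordAt : ∀ {m} → ℕ → List (Fin m) → Tm m
wordAt x = foldr (λ c t → app (con c) t) (var x)

fv-word : ∀ {m} x (w : List (Fin m)) → fv (wordAt x w) ≡ x ∷ []
fv-word x []      = refl
fv-word x (c ∷ w) = fv-word x w

binders-word : ∀ {m} x (w : List (Fin m)) → binders (wordAt x w) ≡ []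
binders-word x []      = refl
binders-word x (c ∷ w) = binders-word x w

word-[] : ∀ {m} x y (w : List (Fin m)) → wordAt x w [ var y / x ] ≡ wordAt y w
word-[] x y [] rewrite dec-true (x NatP.≟ x) refl = refl
word-[] x y (c ∷ w) = cong (app (con c)) (word-[] x y w)

word-α : ∀ {m} x (w : List (Fin m)) → x ≢ 0 → lam x (wordAt x w) ≈βη ρ w
word-α x w n = subst (λ t → lam x (wordAt x w) ≈βη lam 0 t) (word-[] x 0 w)
  (≈-step (α λ i → n (sym (0∈ i))))
  where
  0∈ : 0 ∈ fv (wordAt x w) ++ binders (wordAt x w) → 0 ≡ x
  0∈ i rewrite fv-word x w | binders-word x w with i
  ... | here e = e

closed-fv : ∀ {L m} {R : Fin m → STy L → Set} {t a y} → STyped R [] t a → y ∉ fv t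
closed-fv d i with STyped-fv d i
... | ()

-- The value is the word applied so far, so `at [] ⊸ˢ at w` is a type of `ρ w`.
Letter : ∀ {m} → Fin m → STy (List (Fin m)) → Set
Letter c a = ∃ λ v → a ≡ (at v ⊸ˢ at (c ∷ v))

-- A value `v` is realized by the word `v` on top of a variable `x₀` that `t` does not bind. Hence
-- `t` applied to `x₀` converts to `wordAt x₀ w`, and η and α do the rest.
typed⇒≈ρ : ∀ {m t} {w : List (Fin m)} → STyped Letter [] t (at [] ⊸ˢ at w) → ρ w ≈βη t
typed⇒≈ρ {m} {t} {w} d = ≈-sym
  (bwd (η (closed-fv d)) ◅ (≈-lam x₀ (proj₂ real (var x₀) (good (λ _ → refl) λ ()) ε) ◅◅ word-α x₀ w λ ()))
  where
  x₀ = fresh (binders t)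
  X : ℕ → Set
  X y = y ≡ x₀
  X-fv : ∀ v {y} → y ∈ fv (wordAt {m} x₀ v) → X y
  X-fv v i rewrite fv-word x₀ v with i
  ... | here e = e
  open Realizability Letter X (wordAt x₀) X-fv
  V0 : ∀ {c a} → Letter c a → ∀ y → V a y ≡ 0ℤ
  V0 (v , refl) y rewrite fv-word x₀ v = ℤP.+-inverseʳ (+ᶻ occ y (x₀ ∷ []))
  real : _⊩_ V0 t (at [] ⊸ˢ at w)
  real = realize-closed V0 (λ { {c} (v , refl) r g k → ≈-appʳ (con c) k }) refl d
           (λ i e → NatP.<-irrefl e (∈<fresh (binders t) i))

-- Generic types and the identity

tgt : STy ℕ → ℕ
tgt (at d)    = d
tgt (a ⊸ˢ b) = tgt b

nontgt : STy ℕ → List ℕ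
nontgt (at d)    = []
nontgt (a ⊸ˢ b) = (tgt a ∷ nontgt a) ++ nontgt b

-- Each occurrence of an atom is the target of the whole type or of exactly one argument subtype, so
-- the list contains all atoms. If they are distinct, an atom names its node in the type.
Generic : STy ℕ → Set
Generic a = Unique (tgt a ∷ nontgt a)

NoConst : ∀ {m} {L : Set} → Fin m → STy L → Set
NoConst c a = ⊥

Unique-++⁻ : ∀ {A : Set} (xs : List A) {ys} → Unique (xs ++ ys) → Unique xs × Unique ys × (∀ {z} → z ∈ xs → z ∉ ys)
Unique-++⁻ [] u = [] , u , λ ()
Unique-++⁻ (x ∷ xs) (p ∷ u) with Unique-++⁻ xs u
... | a , b , c = AllP.++⁻ˡ xs p ∷ a , b ,
      λ { (here refl) j → All.lookup (AllP.++⁻ʳ xs p) j refl ; (there i) → c i }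

module GenericPoint {m : ℕ} (base : ℕ) where

  colour : ℕ → ℕ
  colour d = base ℕ.+ d

  -- The term assigned to a colour: the variable of its node applied to the variables of its arguments.
  E : STy ℕ → Tm m → ℕ → Tm m
  E (at c)    s d = s
  E (a ⊸ˢ b) s d with d ∈? (tgt a ∷ nontgt a)
  ... | yes _ = E a (var (colour (tgt a))) d
  ... | no _  = E b (app s (var (colour (tgt a)))) d

  E-fv : ∀ a s d → (∀ {y} → y ∈ fv s → base ≤ y) → ∀ {y} → y ∈ fv (E a s d) → base ≤ y
  E-fv (at c) s d h = h
  E-fv (a ⊸ˢ b) s d h with d ∈? (tgt a ∷ nontgt a)
  ... | yes _ = E-fv a _ d λ { (here refl) → NatP.m≤m+n base _ }
  ... | no _ = E-fv b _ d k
    where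
    k : ∀ {y} → y ∈ fv s ++ colour (tgt a) ∷ [] → base ≤ y
    k i with ∈-++⁻ (fv s) i
    ... | inj₁ j = h j
    ... | inj₂ (here refl) = NatP.m≤m+n base _

  module _ (e : ℕ → Tm m) where

    -- `e` follows the η-long form of `s`: the head is applied to the variables of its argument
    -- nodes, and each of these variables is treated likewise at its own type.
    Spec : STy ℕ → Tm m → Set
    Spec (at d)    s = e d ≡ s
    Spec (a ⊸ˢ b) s = colour (tgt a) ∉ fv s × Spec b (app s (var (colour (tgt a)))) × Spec a (var (colour (tgt a)))

    -- Genericity makes the atoms of the argument and of the result disjoint, so the test in `E`
    -- sends every colour into the branch that contains it.
    E-spec : ∀ a s → Generic a → (∀ {d} → d ∈ tgt a ∷ nontgt a → e d ≡ E a s d) →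
             (∀ {d} → d ∈ nontgt a → colour d ∉ fv s) → Spec a s
    E-spec (at c) s g h f = h (here refl)
    E-spec (a ⊸ˢ b) s (p ∷ g) h f with Unique-++⁻ (tgt a ∷ nontgt a) g
    ... | ga , gb , dis =
      f (here refl)
      , E-spec b _ (AllP.++⁻ʳ (tgt a ∷ nontgt a) p ∷ gb)
          (λ {d} i → trans (h (sub-b i)) (Eb (λ j → disj j i)))
          fb
      , E-spec a _ ga (λ {d} i → trans (h (there (∈-++⁺ˡ i))) (Ea i))
          λ { i (here q) → All.lookup (headU ga) i (sym (NatP.+-cancelˡ-≡ base _ _ q)) }
      where
      headU : ∀ {x : ℕ} {xs} → Unique (x ∷ xs) → All (x ≢_) xs
      headU (q ∷ _) = q
      sub-b : ∀ {d} → d ∈ tgt b ∷ nontgt b → d ∈ tgt b ∷ (tgt a ∷ nontgt a) ++ nontgt b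
      sub-b (here q) = here q
      sub-b (there i) = there (∈-++⁺ʳ (tgt a ∷ nontgt a) i)
      disj : ∀ {d} → d ∈ tgt a ∷ nontgt a → d ∉ tgt b ∷ nontgt b
      disj j (here refl) = All.lookup (AllP.++⁻ˡ (tgt a ∷ nontgt a) p) j refl
      disj j (there i) = dis j i
      Ea : ∀ {d} → d ∈ tgt a ∷ nontgt a → E (a ⊸ˢ b) s d ≡ E a (var (colour (tgt a))) d
      Ea {d} i with d ∈? (tgt a ∷ nontgt a)
      ... | yes _ = refl
      ... | no n = ⊥-elim (n i)
      Eb : ∀ {d} → d ∉ tgt a ∷ nontgt a → E (a ⊸ˢ b) s d ≡ E b (app s (var (colour (tgt a)))) d
      Eb {d} n with d ∈? (tgt a ∷ nontgt a)
      ... | yes i = ⊥-elim (n i)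
      ... | no _ = refl
      fb : ∀ {d} → d ∈ nontgt b → colour d ∉ fv s ++ colour (tgt a) ∷ []
      fb i j with ∈-++⁻ (fv s) j
      ... | inj₁ k = f (∈-++⁺ʳ (tgt a ∷ nontgt a) i) k
      ... | inj₂ (here q) = disj (here (NatP.+-cancelˡ-≡ base _ _ q)) (there i)

    module _ (e-fv : ∀ d {y} → y ∈ fv (e d) → base ≤ y) where
      open Realizability {m} {ℕ} NoConst (base ≤_) e e-fv

      V-spec : ∀ a {s} → Spec a s → ∀ y → V a y ≡ +ᶻ occ y (fv s)
      V-spec (at d) refl y = refl
      V-spec (a ⊸ˢ b) {s} (_ , sb , sa) y = begin
        V b y ℤ.- V a y                                       ≡⟨ cong₂ ℤ._-_ (V-spec b sb y) (V-spec a sa y) ⟩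
        +ᶻ occ y (fv s ++ x ∷ []) ℤ.- +ᶻ occ y (x ∷ [])         ≡⟨ cong (λ k → +ᶻ k ℤ.- +ᶻ occ y (x ∷ [])) (occ-++ y (fv s) (x ∷ [])) ⟩
        (+ᶻ occ y (fv s) ℤ.+ +ᶻ occ y (x ∷ [])) ℤ.- +ᶻ occ y (x ∷ []) ≡⟨ plus-minus (+ᶻ occ y (fv s)) (+ᶻ occ y (x ∷ [])) ⟩
        +ᶻ occ y (fv s)                                        ∎
        where
        open ≡-Reasoning
        x = colour (tgt a)

      mutual
        -- As in normalization by evaluation, `reflect` makes `s` a realizer and `reify` converts
        -- any realizer to `s` by extensionality on the node variables. The balance shows that the
        -- node variable is fresh for the given realizer.
        reflect : ∀ a {s} → Spec a s → Conv a s
        reflect (at d) refl = ε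
        reflect (a ⊸ˢ b) {s} (_ , sb , sa) r g c =
          Conv-≈ b (≈-appʳ s (reify a sa g c)) (reflect b sb)

        reify : ∀ a {s r} → Spec a s → Good a r → Conv a r → r ≈βη s
        reify (at d) refl g c = c
        reify (a ⊸ˢ b) {s} {r} (x∉ , sb , sa) g c =
          ≈-ext x∉r x∉ (reify b sb (good-app g gx) (c _ gx (reflect a sa)))
          where
          gx : Good a (var (colour (tgt a)))
          gx = good (λ y → sym (V-spec a sa y)) λ ()
          x∉r : colour (tgt a) ∉ fv r
          x∉r i = occ-∈ (fv r) i (ℤP.+-injective (trans (Good.count g _)
                    (trans (V-spec (a ⊸ˢ b) (x∉ , sb , sa) _) (cong +ᶻ_ (occ-∉ (fv s) x∉)))))

-- The term sends the variable `x`, which realizes `a`, to a realizer of `a`; by `reify` this is `x`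
-- again.
generic⇒≈id : ∀ {m t a} → Generic a → STyped (NoConst {m}) [] t (a ⊸ˢ a) → ρ [] ≈βη t
generic⇒≈id {m} {t} {a} gen d = ≈-sym (bwd (η (closed-fv d)) ◅ (≈-lam x tx≈x ◅◅ word-α x [] λ ()))
  where
  base = fresh (binders t)
  open GenericPoint {m} base
  x = colour (tgt a)
  e = E a (var x)
  e-fv : ∀ d {y} → y ∈ fv (e d) → base ≤ y
  e-fv d = E-fv a (var x) d λ { (here refl) → NatP.m≤m+n base _ }
  open Realizability {m} {ℕ} NoConst (base ≤_) e e-fv
  headU : ∀ {y : ℕ} {ys} → Unique (y ∷ ys) → All (y ≢_) ys
  headU (q ∷ _) = q
  spec : Spec e a (var x)
  spec = E-spec e a (var x) gen (λ _ → refl)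
    λ { i (here q) → All.lookup (headU gen) i (sym (NatP.+-cancelˡ-≡ base _ _ q)) }
  V0 : ∀ {c} {a : STy ℕ} → NoConst {m} c a → ∀ y → V a y ≡ 0ℤ
  V0 ()
  real : _⊩_ (λ {c} {b} → V0 {c} {b}) t (a ⊸ˢ a)
  real = realize-closed (λ {c} {b} → V0 {c} {b}) (λ ()) (NatP.≤-refl {base}) d
           (λ i b≤ → NatP.<⇒≱ (∈<fresh (binders t) i) b≤)
  gx : Good a (var x)
  gx = good (λ y → sym (V-spec e e-fv a spec y)) λ ()
  tx≈x : app t (var x) ≈βη var x
  tx≈x = reify e e-fv a spec (good-app (proj₁ real) gx) (proj₂ real (var x) gx (reflect e e-fv a spec))

-- Conservativity of MLL over linear implication

data Fml (L : Set) : Set where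
  pos neg : L → Fml L
  _⊗_ _⅋_ : Fml L → Fml L → Fml L

infix 25 _ᵈ _⁺ᶠ _⁻ᶠ
_ᵈ : ∀ {L} → Fml L → Fml L
pos l ᵈ   = neg l
neg l ᵈ   = pos l
(a ⊗ b) ᵈ = a ᵈ ⅋ b ᵈ
(a ⅋ b) ᵈ = a ᵈ ⊗ b ᵈ

ᵈ-involutive : ∀ {L} (a : Fml L) → a ᵈ ᵈ ≡ a
ᵈ-involutive (pos l) = refl
ᵈ-involutive (neg l) = refl
ᵈ-involutive (a ⊗ b) = cong₂ _⊗_ (ᵈ-involutive a) (ᵈ-involutive b)
ᵈ-involutive (a ⅋ b) = cong₂ _⅋_ (ᵈ-involutive a) (ᵈ-involutive b)

mutual
  _⁺ᶠ : ∀ {L} → STy L → Fml L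
  at l ⁺ᶠ     = pos l
  (a ⊸ˢ b) ⁺ᶠ = a ⁻ᶠ ⅋ b ⁺ᶠ

  _⁻ᶠ : ∀ {L} → STy L → Fml L
  at l ⁻ᶠ     = neg l
  (a ⊸ˢ b) ⁻ᶠ = a ⁺ᶠ ⊗ b ⁻ᶠ

mutual
  ⁺ᶠ-dual : ∀ {L} (a : STy L) → a ⁺ᶠ ᵈ ≡ a ⁻ᶠ
  ⁺ᶠ-dual (at l) = refl
  ⁺ᶠ-dual (a ⊸ˢ b) = cong₂ _⊗_ (⁻ᶠ-dual a) (⁺ᶠ-dual b)

  ⁻ᶠ-dual : ∀ {L} (a : STy L) → a ⁻ᶠ ᵈ ≡ a ⁺ᶠ
  ⁻ᶠ-dual (at l) = refl
  ⁻ᶠ-dual (a ⊸ˢ b) = cong₂ _⅋_ (⁺ᶠ-dual a) (⁻ᶠ-dual b)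

data MLL {L : Set} (Ax : STy L → Set) : List (Fml L) → Set where
  axiom : ∀ {a} → Ax a → MLL Ax (a ⁺ᶠ ∷ [])
  ident : ∀ a → MLL Ax (a ᵈ ∷ a ∷ [])
  cut   : ∀ {Γ Δ} a → MLL Ax (Γ ++ a ∷ []) → MLL Ax (a ᵈ ∷ Δ) → MLL Ax (Γ ++ Δ)
  exch  : ∀ Γ {Δ} a b → MLL Ax (Γ ++ a ∷ b ∷ Δ) → MLL Ax (Γ ++ b ∷ a ∷ Δ)
  par   : ∀ Γ a b → MLL Ax (Γ ++ a ∷ b ∷ []) → MLL Ax (Γ ++ (a ⅋ b) ∷ [])
  ten   : ∀ Γ {Δ} a b → MLL Ax (Γ ++ a ∷ []) → MLL Ax (b ∷ Δ) → MLL Ax (Γ ++ (a ⊗ b) ∷ Δ)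

data IL {L : Set} (Ax : STy L → Set) : List (STy L) → STy L → Set where
  ax  : ∀ {a} → IL Ax (a ∷ []) a
  cn  : ∀ {a} → Ax a → IL Ax [] a
  app : ∀ {Γ Δ a b} → IL Ax Γ (a ⊸ˢ b) → IL Ax Δ a → IL Ax (Γ ++ Δ) b
  lam : ∀ {Γ a b} → IL Ax (a ∷ Γ) b → IL Ax Γ (a ⊸ˢ b)
  ex  : ∀ {Γ Δ a} → Γ ↭ Δ → IL Ax Γ a → IL Ax Δ a

-- A phase model of MLL whose monoid consists of lists of inputs and of outputs, and whose
-- pole contains the intuitionistically derivable sequents with exactly one output.
module Conservativity {L : Set} (Ax : STy L → Set) where

  Mon : Set
  Mon = List (STy L) × List (STy L)

  infixr 6 _∙_
  _∙_ : Mon → Mon → Mon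
  (Γ , Δ) ∙ (Γ' , Δ') = Γ ++ Γ' , Δ ++ Δ'

  𝟏 : Mon
  𝟏 = [] , []

  infix 4 _≋_
  _≋_ : Mon → Mon → Set
  (Γ , Δ) ≋ (Γ' , Δ') = Γ ↭ Γ' × Δ ↭ Δ'

  ≋-refl : ∀ {x} → x ≋ x
  ≋-refl = ↭-refl , ↭-refl

  ≋-sym : ∀ {x y} → x ≋ y → y ≋ x
  ≋-sym (p , q) = ↭-sym p , ↭-sym q

  ≋-trans : ∀ {x y z} → x ≋ y → y ≋ z → x ≋ z
  ≋-trans (p , q) (p' , q') = ↭-trans p p' , ↭-trans q q'

  ∙-cong : ∀ {x y x' y'} → x ≋ x' → y ≋ y' → x ∙ y ≋ x' ∙ y'
  ∙-cong (p , q) (p' , q') = PermP.++⁺ p p' , PermP.++⁺ q q'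

  ∙-comm : ∀ x y → x ∙ y ≋ y ∙ x
  ∙-comm (Γ , Δ) (Γ' , Δ') = PermP.++-comm Γ Γ' , PermP.++-comm Δ Δ'

  ∙-assoc : ∀ x y z → (x ∙ y) ∙ z ≋ x ∙ (y ∙ z)
  ∙-assoc (Γ , Δ) (Γ' , Δ') (Γ'' , Δ'') = ↭-reflexive (++-assoc Γ Γ' Γ'') , ↭-reflexive (++-assoc Δ Δ' Δ'')

  ∙-identityʳ : ∀ x → x ∙ 𝟏 ≋ x
  ∙-identityʳ (Γ , Δ) = ↭-reflexive (++-identityʳ Γ) , ↭-reflexive (++-identityʳ Δ)

  Pole : Mon → Set
  Pole (Γ , Δ) = ∃ λ a → Δ ↭ a ∷ [] × IL Ax Γ a

  pole-≋ : ∀ {x y} → x ≋ y → Pole x → Pole y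
  pole-≋ (p , q) (a , r , d) = a , ↭-trans (↭-sym q) r , ex p d

  infix 4 _⊥ᵖ_
  _⊥ᵖ_ : Mon → (Mon → Set) → Set
  x ⊥ᵖ T = ∀ {y} → T y → Pole (x ∙ y)

  Proves : L → Mon → Set
  Proves l (Γ , Δ) = Δ ≡ [] × IL Ax Γ (at l)

  -- Test a is a set of opponents of a; its orthogonal is the fact denoted by a.
  Test : Fml L → Mon → Set
  Test (pos l) x = x ⊥ᵖ Proves l
  Test (neg l) x = Proves l x
  Test (a ⊗ b) x = ∀ {y z} → y ⊥ᵖ Test a → z ⊥ᵖ Test b → Pole (x ∙ (y ∙ z))
  Test (a ⅋ b) x = ∃ λ y → ∃ λ z → x ≡ y ∙ z × Test a y × Test b z

  xyz-yxz : ∀ x y z → x ∙ (y ∙ z) ≋ y ∙ (x ∙ z)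
  xyz-yxz x y z = ≋-trans (≋-sym (∙-assoc x y z)) (≋-trans (∙-cong (∙-comm x y) ≋-refl) (∙-assoc y x z))

  ident-sound : ∀ a {x y} → Test a x → Test (a ᵈ) y → Pole (x ∙ y)
  ident-sound (pos l) t u = t u
  ident-sound (neg l) {x} {y} t u = pole-≋ (∙-comm y x) (u t)
  ident-sound (a ⊗ b) {x} t (y , z , refl , u , v) =
    t (λ {x'} t' → pole-≋ (∙-comm x' y) (ident-sound a t' u))
      (λ {x'} t' → pole-≋ (∙-comm x' z) (ident-sound b t' v))
  ident-sound (a ⅋ b) {_} {x} (y , z , refl , u , v) t =
    pole-≋ (∙-comm x (y ∙ z)) (t (λ t' → ident-sound a u t') (λ t' → ident-sound b v t'))

  mutual
    -- For dual formulas one of the two facts always consists of tests of the other formula: by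
    -- definition for literals, by `cut-⅋` and `cut-⅋'` for connectives. This is why tests are never
    -- closed under biorthogonality.
    cut-sound : ∀ a {x y} → x ⊥ᵖ Test a → y ⊥ᵖ Test (a ᵈ) → Pole (x ∙ y)
    cut-sound (pos l) {x} {y} h k = h k
    cut-sound (neg l) {x} {y} h k = pole-≋ (∙-comm y x) (k h)
    cut-sound (a ⊗ b) {x} {y} h k = h (cut-⅋ a b k)
    cut-sound (a ⅋ b) {x} {y} h k = pole-≋ (∙-comm y x) (k (λ p q → cut-⅋' a b h p q))

    cut-⅋ : ∀ a b {y} → y ⊥ᵖ Test (a ᵈ ⅋ b ᵈ) → Test (a ⊗ b) y
    cut-⅋ a b {y} k {p} {q} hp hq =
      pole-≋ (xyz-yxz p y q) (cut-sound a hp λ {u} tu →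
        pole-≋ (≋-trans (xyz-yxz q y u) (≋-trans (∙-cong (≋-refl {y}) (∙-comm q u))
                 (≋-trans (xyz-yxz y u q) (∙-comm u (y ∙ q)))))
          (cut-sound b hq λ {v} tv → pole-≋ (≋-sym (∙-assoc y u v)) (k (u , v , refl , tu , tv))))

    cut-⅋' : ∀ a b {y} → y ⊥ᵖ Test (a ⅋ b) → Test (a ᵈ ⊗ b ᵈ) y
    cut-⅋' a b {y} k {p} {q} hp hq =
      pole-≋ (xyz-yxz p y q) (pole-≋ (∙-comm (y ∙ q) p) (cut-sound a (λ {u} tu →
        pole-≋ (≋-trans (∙-assoc y u q) (≋-trans (∙-cong (≋-refl {y}) (∙-comm u q)) (≋-sym (∙-assoc y q u))))
          (cut-sound b (λ {v} tv → pole-≋ (≋-sym (∙-assoc y u v)) (k (u , v , refl , tu , tv))) hq)) hp))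

  Tests : List (Fml L) → Mon → Set
  Tests []      x = x ≡ 𝟏
  Tests (a ∷ Θ) x = ∃ λ y → ∃ λ z → x ≡ y ∙ z × Test a y × Tests Θ z

  Tests-++⁻ : ∀ Θ {Ξ x} → Tests (Θ ++ Ξ) x → ∃ λ y → ∃ λ z → x ≋ y ∙ z × Tests Θ y × Tests Ξ z
  Tests-++⁻ [] t = 𝟏 , _ , ≋-refl , refl , t
  Tests-++⁻ (a ∷ Θ) (u , v , refl , t , ts) with Tests-++⁻ Θ ts
  ... | y , z , e , ts₁ , ts₂ =
    u ∙ y , z , ≋-trans (∙-cong (≋-refl {u}) e) (≋-sym (∙-assoc u y z)) , (u , y , refl , t , ts₁) , ts₂

  Tests-++⁺ : ∀ Θ {Ξ y z} → Tests Θ y → Tests Ξ z → ∃ λ x → x ≋ y ∙ z × Tests (Θ ++ Ξ) x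
  Tests-++⁺ [] refl t = _ , ≋-refl , t
  Tests-++⁺ (a ∷ Θ) {z = z} (u , v , refl , t , ts) t' with Tests-++⁺ Θ ts t'
  ... | x , e , ts' = u ∙ x , ≋-trans (∙-cong (≋-refl {u}) e) (≋-sym (∙-assoc u v z)) , (u , x , refl , t , ts')

  Valid : List (Fml L) → Set
  Valid Θ = ∀ {x} → Tests Θ x → Pole x

  valid-++ : ∀ Θ {Ξ y z} → Valid (Θ ++ Ξ) → Tests Θ y → Tests Ξ z → Pole (y ∙ z)
  valid-++ Θ v t t' with Tests-++⁺ Θ t t'
  ... | x , e , ts = pole-≋ e (v ts)

  one : ∀ {a x} → Test a x → Tests (a ∷ []) (x ∙ 𝟏)
  one t = _ , 𝟏 , refl , t , refl

  valid-last : ∀ Θ {a y} → Valid (Θ ++ a ∷ []) → Tests Θ y → y ⊥ᵖ Test a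
  valid-last Θ {y = y} v t {z} t' =
    pole-≋ (∙-cong (≋-refl {y}) (∙-identityʳ z)) (valid-++ Θ v t (one t'))

  valid-head : ∀ {Θ a y} → Valid (a ∷ Θ) → Tests Θ y → y ⊥ᵖ Test a
  valid-head {y = y} v t {z} t' = pole-≋ (∙-comm z y) (v (z , y , refl , t' , t))

  mutual
    axiom-sound : ∀ a {Γ x} → IL Ax Γ a → Test (a ⁺ᶠ) x → Pole (x ∙ (Γ , []))
    axiom-sound (at l) d t = t (refl , d)
    axiom-sound (a ⊸ˢ b) {Γ} d (y , z , refl , t , u) with hypothesis a t
    ... | Δ , refl , e = pole-≋ (PermP.++⁺ˡ Δz (PermP.++-comm Γ Δ) ↭∘ rearr , ↭-reflexive (++-identityʳ Oz) ↭∘ ↭-reflexive (sym (++-identityʳ Oz)))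
                          (axiom-sound b (app d e) u)
      where
      Δz = proj₁ z
      Oz = proj₂ z
      _↭∘_ : ∀ {A B C : List (STy L)} → A ↭ B → B ↭ C → A ↭ C
      _↭∘_ = ↭-trans
      rearr : Δz ++ (Δ ++ Γ) ↭ (Δ ++ Δz) ++ Γ
      rearr = ↭-trans (↭-reflexive (sym (++-assoc Δz Δ Γ))) (PermP.++⁺ʳ Γ (PermP.++-comm Δz Δ))

    -- At an arrow the test is tried on the input `a` and the output `b`. The pole admits a single
    -- output, so the test has none of its own, and its inputs together with `a` derive `b`.
    hypothesis : ∀ a {x} → Test (a ⁻ᶠ) x → ∃ λ Γ → x ≡ (Γ , []) × IL Ax Γ a
    hypothesis (at l) {Γ , _} (refl , d) = Γ , refl , d
    hypothesis (a ⊸ˢ b) {Γ , Δ} t with t {a ∷ [] , []} {[] , b ∷ []}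
        (λ {y} u → pole-≋ (∙-comm y (a ∷ [] , [])) (axiom-sound a ax u))
        (λ {y} u → out y (hypothesis b u))
      where
      out : ∀ y → (∃ λ Γ → y ≡ (Γ , []) × IL Ax Γ b) → Pole (([] , b ∷ []) ∙ y)
      out _ (_ , refl , d) = b , ↭-refl , d
    ... | c , p , d with split Δ p
      where
      split : ∀ Δ → Δ ++ b ∷ [] ↭ c ∷ [] → Δ ≡ [] × b ≡ c
      split [] p with PermP.↭-singleton-inv p
      ... | refl = refl , refl
      split (x ∷ []) p with PermP.↭-singleton-inv p
      ... | ()
      split (x ∷ y ∷ Δ) p with PermP.↭-singleton-inv p
      ... | ()
    ... | refl , refl = Γ , refl , lam (ex (PermP.++-comm Γ (a ∷ [])) d)

  sound : ∀ {Θ} → MLL Ax Θ → Valid Θ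
  sound (axiom {a} r) (y , _ , refl , t , refl) = axiom-sound a (cn r) t
  sound (ident a) (x , _ , refl , t , (y , _ , refl , u , refl)) =
    pole-≋ (≋-trans (∙-comm y x) (∙-cong (≋-refl {x}) (≋-sym (∙-identityʳ y)))) (ident-sound a u t)
  sound (cut {Γ} {Δ} a d e) ts with Tests-++⁻ Γ ts
  ... | y , z , p , t , u = pole-≋ (≋-sym p) (cut-sound a (valid-last Γ (sound d) t) (valid-head (sound e) u))
  sound (exch Γ {Δ} a b d) ts with Tests-++⁻ Γ ts
  ... | y , _ , p , t , (v , _ , refl , tb , (u , z , refl , ta , ts')) =
    pole-≋ (≋-sym (≋-trans p (∙-cong (≋-refl {y}) (xyz-yxz v u z))))
      (valid-++ Γ (sound d) t (u , _ , refl , ta , (v , z , refl , tb , ts')))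
  sound (par Γ a b d) ts with Tests-++⁻ Γ ts
  ... | y , _ , p , t , (_ , _ , refl , (u , v , refl , ta , tb) , refl) =
    pole-≋ (≋-sym (≋-trans p (∙-cong (≋-refl {y}) (∙-assoc u v 𝟏))))
      (valid-++ Γ (sound d) t (u , _ , refl , ta , one tb))
  sound (ten Γ {Δ} a b d e) ts with Tests-++⁻ Γ ts
  ... | y , _ , p , t , (x , z , refl , tab , u) =
    pole-≋ (≋-sym (≋-trans p (xyz-yxz y x z))) (tab (valid-last Γ (sound d) t) (valid-head (sound e) u))

  -- The element with the single output `l` is a test of `pos l`, and validity at this element is
  -- derivability.
  conservative : ∀ {l} → MLL Ax (pos l ∷ []) → IL Ax [] (at l)
  conservative {l} d with sound d (([] , at l ∷ []) , 𝟏 , refl , (λ { {Γ , _} (refl , e) → at l , ↭-refl , e }) , refl)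
  ... | a , p , e with PermP.↭-singleton-inv (↭-sym p)
  ...   | refl = e

-- Named terms from intuitionistic derivations

module Naming {L : Set} {m : ℕ} (R : Fin m → STy L → Set) where

  Ax : STy L → Set
  Ax a = ∃ λ c → R c a

  map-↭ : ∀ {Γ Δ : List (STy L)} (N : SCx L) → map proj₂ N ≡ Δ → Γ ↭ Δ → ∃ λ M → map proj₂ M ≡ Γ × M ↭ N
  map-↭ N refl p with PermP.↭-map-inv proj₂ (↭-sym p)
  ... | M , e , q = M , sym e , ↭-sym q

  Unique-↭ : ∀ {M N : SCx L} → M ↭ N → Unique (map proj₁ M) → Unique (map proj₁ N)
  Unique-↭ p = PermSet.Unique-resp-↭ (setoid ℕ) (Perm.↭⇒↭ₛ (PermP.map⁺ proj₁ p))

  -- `k` bounds all names in use and is therefore fresh for the next abstraction. `STyped` has no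
  -- exchange rule, so the context is reached up to permutation only, which is harmless for closed
  -- terms.
  name : ∀ {Γ a} → IL Ax Γ a → ∀ N → map proj₂ N ≡ Γ → Unique (map proj₁ N) → ∀ k → All (_< k) (map proj₁ N) →
         ∃ λ t → ∃ λ M → M ↭ N × STyped R M t a
  name ax ((x , a) ∷ []) refl u k b = var x , _ , ↭-refl , ax
  name (cn (c , r)) [] refl u k b = con c , [] , ↭-refl , cn r
  name (app {Γ} d e) N eq u k b with map-++⁻ proj₂ Γ N eq
  ... | N₁ , N₂ , refl , e₁ , e₂ rewrite map-++ proj₁ N₁ N₂ with uniq N₁ u
    where
    uniq : ∀ N₁ → Unique (map proj₁ N₁ ++ map proj₁ N₂) → Unique (map proj₁ N₁) × Unique (map proj₁ N₂)
    uniq [] u = [] , u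
    uniq (x ∷ N₁) (p ∷ u) with uniq N₁ u
    ... | u₁ , u₂ = AllP.++⁻ˡ _ p ∷ u₁ , u₂
  ... | u₁ , u₂ with name d N₁ e₁ u₁ k (AllP.++⁻ˡ _ b) | name e N₂ e₂ u₂ k (AllP.++⁻ʳ (map proj₁ N₁) b)
  ... | t , M₁ , p , dt | s , M₂ , q , ds =
    app t s , M₁ ++ M₂ , PermP.++⁺ p q ,
    app dt ds (Unique-↭ (↭-sym (PermP.++⁺ p q)) (subst Unique (sym (map-++ proj₁ N₁ N₂)) u))
  name (lam {Γ} {a} d) N eq u k b
    with name d ((k , a) ∷ N) (cong (a ∷_) eq) (All.map (λ { l refl → NatP.<-irrefl refl l }) b ∷ u)
              (suc k) (NatP.n<1+n k ∷ All.map (λ l → NatP.<-trans l (NatP.n<1+n k)) b)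
  ... | t , M , p , dt with ∈-∃++ (PermP.∈-resp-↭ (↭-sym p) (here refl))
  ... | M₁ , M₂ , refl = lam k t , M₁ ++ M₂ , PermP.drop-mid M₁ [] p , lam dt
  name (ex p d) N eq u k b with map-↭ N eq p
  ... | M , e , q with name d M e (Unique-↭ (↭-sym q) u) k (PermP.All-resp-↭ (PermP.map⁺ proj₁ (↭-sym q)) b)
  ... | t , M' , q' , dt = t , M' , ↭-trans q' q , dt

  name-closed : ∀ {a} → IL Ax [] a → ∃ λ t → STyped R [] t a
  name-closed d with name d [] refl [] 0 []
  ... | t , M , p , dt with PermP.↭-empty-inv p
  ... | refl = t , dt

-- Vertices of sequents

data SplitV {n} (m : ℕ) : Fin (m + n) → Set where
  isˡ : ∀ i → SplitV m (i ↑ˡ n)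
  isʳ : ∀ j → SplitV m (m ↑ʳ j)

splitV : ∀ m {n} (v : Fin (m + n)) → SplitV m v
splitV zero v = isʳ v
splitV (suc m) zero = isˡ zero
splitV (suc m) (suc v) with splitV m v
... | isˡ i = isˡ (suc i)
... | isʳ j = isʳ j

cast-cast⁻ : ∀ {m n} (e : m ≡ n) (v : Fin n) → cast e (cast (sym e) v) ≡ v
cast-cast⁻ e v = FinP.toℕ-injective (trans (FinP.toℕ-cast e _) (FinP.toℕ-cast (sym e) v))

cast⁻-cast : ∀ {m n} (e : m ≡ n) (v : Fin m) → cast (sym e) (cast e v) ≡ v
cast⁻-cast e v = FinP.toℕ-injective (trans (FinP.toℕ-cast (sym e) _) (FinP.toℕ-cast e v))

cast-injective : ∀ {m n} (e : m ≡ n) {u v : Fin m} → cast e u ≡ cast e v → u ≡ v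
cast-injective e {u} {v} q = FinP.toℕ-injective (trans (sym (FinP.toℕ-cast e u)) (trans (cong toℕ q) (FinP.toℕ-cast e v)))

-- Dualisation reverses vertices, and the sizes of a formula and of its dual are equal only
-- propositionally; comparing positions by their sum avoids casts.
Mirror : ∀ {m n} → Fin m → Fin n → Set
Mirror {m} i j = suc (toℕ i + toℕ j) ≡ m

opposite-mirror : ∀ {n} (i : Fin n) → Mirror i (opposite i)
opposite-mirror {n} i rewrite FinP.opposite-prop i = NatP.m+[n∸m]≡n (FinP.toℕ<n i)

mirror⇒opposite : ∀ {n} {i j : Fin n} → Mirror i j → opposite i ≡ j
mirror⇒opposite {i = i} {j} e = FinP.toℕ-injective
  (NatP.+-cancelˡ-≡ (suc (toℕ i)) _ _ (trans (opposite-mirror i) (sym e)))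

module Positions (T : Set) (n : ℕ) (litBd : Fin n → Bd) where
  open LL T n litBd public

  -- The boundary of `Γ ++ Δ` has the blocks of `Δ` before those of `Γ`, hence the shift by `sz Δ`.
  inL : ∀ Γ Δ → Fin (sz Γ) → Fin (sz (Γ ++ Δ))
  inL Γ Δ i = cast (sym (sz++ Γ Δ)) (sz Δ ↑ʳ i)

  inR : ∀ Γ Δ → Fin (sz Δ) → Fin (sz (Γ ++ Δ))
  inR Γ Δ j = cast (sym (sz++ Γ Δ)) (j ↑ˡ sz Γ)

  data SplitC (Γ Δ : List (Fm n)) : Fin (sz (Γ ++ Δ)) → Set where
    isL : ∀ i → SplitC Γ Δ (inL Γ Δ i)
    isR : ∀ j → SplitC Γ Δ (inR Γ Δ j)

  splitC : ∀ Γ Δ v → SplitC Γ Δ v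
  splitC Γ Δ v = subst (SplitC Γ Δ) (cast⁻-cast (sz++ Γ Δ) v) (go (splitV (sz Δ) (cast (sz++ Γ Δ) v)))
    where
    go : ∀ {u} → SplitV (sz Δ) u → SplitC Γ Δ (cast (sym (sz++ Γ Δ)) u)
    go (isˡ j) = isR j
    go (isʳ i) = isL i

  toℕ-inL : ∀ Γ Δ i → toℕ (inL Γ Δ i) ≡ sz Δ + toℕ i
  toℕ-inL Γ Δ i = trans (FinP.toℕ-cast _ (sz Δ ↑ʳ i)) (FinP.toℕ-↑ʳ (sz Δ) i)

  toℕ-inR : ∀ Γ Δ j → toℕ (inR Γ Δ j) ≡ toℕ j
  toℕ-inR Γ Δ j = trans (FinP.toℕ-cast _ (j ↑ˡ sz Γ)) (FinP.toℕ-↑ˡ j (sz Γ))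

  splitAt-inL : ∀ Γ Δ i → splitAt (sz Δ) (cast (sz++ Γ Δ) (inL Γ Δ i)) ≡ inj₂ i
  splitAt-inL Γ Δ i rewrite cast-cast⁻ (sz++ Γ Δ) (sz Δ ↑ʳ i) = FinP.splitAt-↑ʳ (sz Δ) (sz Γ) i

  splitAt-inR : ∀ Γ Δ j → splitAt (sz Δ) (cast (sz++ Γ Δ) (inR Γ Δ j)) ≡ inj₁ j
  splitAt-inR Γ Δ j rewrite cast-cast⁻ (sz++ Γ Δ) (j ↑ˡ sz Γ) = FinP.splitAt-↑ˡ (sz Δ) j (sz Γ)

  inL-head : ∀ A Γ Δ i → inL (A ∷ Γ) Δ (sz Γ ↑ʳ i) ≡ sz (Γ ++ Δ) ↑ʳ i
  inL-head A Γ Δ i = FinP.toℕ-injective (begin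
    toℕ (inL (A ∷ Γ) Δ (sz Γ ↑ʳ i)) ≡⟨ toℕ-inL (A ∷ Γ) Δ _ ⟩
    sz Δ + toℕ (sz Γ ↑ʳ i)          ≡⟨ cong (sz Δ +_) (FinP.toℕ-↑ʳ (sz Γ) i) ⟩
    sz Δ + (sz Γ + toℕ i)           ≡⟨ sym (NatP.+-assoc (sz Δ) (sz Γ) (toℕ i)) ⟩
    sz Δ + sz Γ + toℕ i             ≡⟨ cong (_+ toℕ i) (sym (sz++ Γ Δ)) ⟩
    sz (Γ ++ Δ) + toℕ i             ≡⟨ sym (FinP.toℕ-↑ʳ (sz (Γ ++ Δ)) i) ⟩
    toℕ (sz (Γ ++ Δ) ↑ʳ i)          ∎)
    where open ≡-Reasoning

  inL-tail : ∀ A Γ Δ j → inL (A ∷ Γ) Δ (j ↑ˡ ∣ A ∣) ≡ inL Γ Δ j ↑ˡ ∣ A ∣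
  inL-tail A Γ Δ j = FinP.toℕ-injective (trans (toℕ-inL (A ∷ Γ) Δ _)
    (trans (cong (sz Δ +_) (FinP.toℕ-↑ˡ j ∣ A ∣)) (sym (trans (FinP.toℕ-↑ˡ (inL Γ Δ j) ∣ A ∣) (toℕ-inL Γ Δ j)))))

  inR-tail : ∀ A Γ Δ j → inR (A ∷ Γ) Δ j ≡ inR Γ Δ j ↑ˡ ∣ A ∣
  inR-tail A Γ Δ j = FinP.toℕ-injective (trans (toℕ-inR (A ∷ Γ) Δ j)
    (sym (trans (FinP.toℕ-↑ˡ (inR Γ Δ j) ∣ A ∣) (toℕ-inR Γ Δ j))))

  inL-injective : ∀ Γ Δ {i j} → inL Γ Δ i ≡ inL Γ Δ j → i ≡ j
  inL-injective Γ Δ {i} {j} e = FinP.↑ʳ-injective (sz Δ) i j (cast-injective (sym (sz++ Γ Δ)) e)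

  inR-injective : ∀ Γ Δ {i j} → inR Γ Δ i ≡ inR Γ Δ j → i ≡ j
  inR-injective Γ Δ {i} {j} e = FinP.↑ˡ-injective (sz Γ) i j (cast-injective (sym (sz++ Γ Δ)) e)

  inL≢inR : ∀ Γ Δ {i j} → inL Γ Δ i ≢ inR Γ Δ j
  inL≢inR Γ Δ {i} {j} e with trans (sym (splitAt-inL Γ Δ i)) (trans (cong (splitAt (sz Δ) ∘ cast (sz++ Γ Δ)) e) (splitAt-inR Γ Δ j))
  ... | ()

  -- the blocks of A ⅋ B: first ⟦ B ⟧, then ⟦ A ⟧
  inPA : ∀ A B → Fin ∣ A ∣ → Fin ∣ A ⅋ B ∣
  inPA A B i = cast (NatP.+-comm ∣ B ∣ ∣ A ∣) (∣ B ∣ ↑ʳ i)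

  inPB : ∀ A B → Fin ∣ B ∣ → Fin ∣ A ⅋ B ∣
  inPB A B j = cast (NatP.+-comm ∣ B ∣ ∣ A ∣) (j ↑ˡ ∣ A ∣)

  data SplitP (A B : Fm n) : Fin ∣ A ⅋ B ∣ → Set where
    isA : ∀ i → SplitP A B (inPA A B i)
    isB : ∀ j → SplitP A B (inPB A B j)

  splitP : ∀ A B v → SplitP A B v
  splitP A B v = subst (SplitP A B) eq (go (splitV ∣ B ∣ (cast (NatP.+-comm ∣ A ∣ ∣ B ∣) v)))
    where
    eq : cast (NatP.+-comm ∣ B ∣ ∣ A ∣) (cast (NatP.+-comm ∣ A ∣ ∣ B ∣) v) ≡ v
    eq = FinP.toℕ-injective (trans (FinP.toℕ-cast (NatP.+-comm ∣ B ∣ ∣ A ∣) _) (FinP.toℕ-cast (NatP.+-comm ∣ A ∣ ∣ B ∣) v))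
    go : ∀ {u} → SplitV ∣ B ∣ u → SplitP A B (cast (NatP.+-comm ∣ B ∣ ∣ A ∣) u)
    go (isˡ j) = isB j
    go (isʳ i) = isA i

  toℕ-inPA : ∀ A B i → toℕ (inPA A B i) ≡ ∣ B ∣ + toℕ i
  toℕ-inPA A B i = trans (FinP.toℕ-cast _ (∣ B ∣ ↑ʳ i)) (FinP.toℕ-↑ʳ ∣ B ∣ i)

  toℕ-inPB : ∀ A B j → toℕ (inPB A B j) ≡ toℕ j
  toℕ-inPB A B j = trans (FinP.toℕ-cast _ (j ↑ˡ ∣ A ∣)) (FinP.toℕ-↑ˡ j ∣ A ∣)

  opposite-inPA : ∀ A B i → opposite (inPA A B i) ≡ opposite i ↑ˡ ∣ B ∣
  opposite-inPA A B i = mirror⇒opposite (begin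
    suc (toℕ (inPA A B i) + toℕ (opposite i ↑ˡ ∣ B ∣)) ≡⟨ cong₂ (λ a b → suc (a + b)) (toℕ-inPA A B i) (FinP.toℕ-↑ˡ (opposite i) ∣ B ∣) ⟩
    suc (∣ B ∣ + toℕ i + toℕ (opposite i))             ≡⟨ cong suc (NatP.+-assoc ∣ B ∣ _ _) ⟩
    suc (∣ B ∣ + (toℕ i + toℕ (opposite i)))           ≡⟨ sym (NatP.+-suc ∣ B ∣ _) ⟩
    ∣ B ∣ + suc (toℕ i + toℕ (opposite i))             ≡⟨ cong (∣ B ∣ +_) (opposite-mirror i) ⟩
    ∣ B ∣ + ∣ A ∣                                      ≡⟨ NatP.+-comm ∣ B ∣ ∣ A ∣ ⟩
    ∣ A ∣ + ∣ B ∣                                      ∎)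
    where open ≡-Reasoning

  opposite-inPB : ∀ A B j → opposite (inPB A B j) ≡ ∣ A ∣ ↑ʳ opposite j
  opposite-inPB A B j = mirror⇒opposite (begin
    suc (toℕ (inPB A B j) + toℕ (∣ A ∣ ↑ʳ opposite j)) ≡⟨ cong₂ (λ a b → suc (a + b)) (toℕ-inPB A B j) (FinP.toℕ-↑ʳ ∣ A ∣ (opposite j)) ⟩
    suc (toℕ j + (∣ A ∣ + toℕ (opposite j)))           ≡⟨ cong suc (swap₃ (toℕ j) ∣ A ∣ _) ⟩
    suc (∣ A ∣ + (toℕ j + toℕ (opposite j)))           ≡⟨ sym (NatP.+-suc ∣ A ∣ _) ⟩
    ∣ A ∣ + suc (toℕ j + toℕ (opposite j))             ≡⟨ cong (∣ A ∣ +_) (opposite-mirror j) ⟩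
    ∣ A ∣ + ∣ B ∣                                      ∎)
    where
    open ≡-Reasoning
    swap₃ : ∀ a b c → a + (b + c) ≡ b + (a + c)
    swap₃ a b c = trans (sym (NatP.+-assoc a b c)) (trans (cong (_+ c) (NatP.+-comm a b)) (NatP.+-assoc b a c))

  left-⊗ˡ : ∀ X Y i → left (X ⊗B Y) (i ↑ˡ size Y) ≡ left X i
  left-⊗ˡ X Y i rewrite FinP.splitAt-↑ˡ (size X) i (size Y) = refl

  left-⊗ʳ : ∀ X Y j → left (X ⊗B Y) (size X ↑ʳ j) ≡ left Y j
  left-⊗ʳ X Y j rewrite FinP.splitAt-↑ʳ (size X) (size Y) j = refl

  left-PA : ∀ A B i → left ⟦ A ⅋ B ⟧ (inPA A B i) ≡ left ⟦ A ⟧ i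
  left-PA A B i rewrite opposite-inPA A B i | FinP.splitAt-↑ˡ (∣ A ∣) (opposite i) (∣ B ∣) | FinP.opposite-involutive i =
    BoolP.not-involutive _

  left-PB : ∀ A B j → left ⟦ A ⅋ B ⟧ (inPB A B j) ≡ left ⟦ B ⟧ j
  left-PB A B j rewrite opposite-inPB A B j | FinP.splitAt-↑ʳ (∣ A ∣) (∣ B ∣) (opposite j) | FinP.opposite-involutive j =
    BoolP.not-involutive _

  left-inL : ∀ Γ Δ i → left ⟦ Γ ++ Δ ⟧ᶜ (inL Γ Δ i) ≡ left ⟦ Γ ⟧ᶜ i
  left-inL (A ∷ Γ) Δ v with splitV (sz Γ) v
  ... | isʳ i rewrite inL-head A Γ Δ i = trans (left-⊗ʳ ⟦ Γ ++ Δ ⟧ᶜ ⟦ A ⟧ i) (sym (left-⊗ʳ ⟦ Γ ⟧ᶜ ⟦ A ⟧ i))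
  ... | isˡ j rewrite inL-tail A Γ Δ j =
    trans (left-⊗ˡ ⟦ Γ ++ Δ ⟧ᶜ ⟦ A ⟧ (inL Γ Δ j)) (trans (left-inL Γ Δ j) (sym (left-⊗ˡ ⟦ Γ ⟧ᶜ ⟦ A ⟧ j)))

  left-inR : ∀ Γ Δ j → left ⟦ Γ ++ Δ ⟧ᶜ (inR Γ Δ j) ≡ left ⟦ Δ ⟧ᶜ j
  left-inR [] Δ j = cong (left ⟦ Δ ⟧ᶜ) (FinP.toℕ-injective (toℕ-inR [] Δ j))
  left-inR (A ∷ Γ) Δ j rewrite inR-tail A Γ Δ j =
    trans (left-⊗ˡ ⟦ Γ ++ Δ ⟧ᶜ ⟦ A ⟧ (inR Γ Δ j)) (left-inR Γ Δ j)

  -- Dualisation reverses the order of the vertices.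
  mirror-⊗ˡ : ∀ A B {i : Fin ∣ A ∣} {j : Fin ∣ A ⁻ ∣} → Mirror i j → Mirror (i ↑ˡ ∣ B ∣) (inPA (A ⁻) (B ⁻) j)
  mirror-⊗ˡ A B {i} {j} e = begin
    suc (toℕ (i ↑ˡ ∣ B ∣) + toℕ (inPA (A ⁻) (B ⁻) j)) ≡⟨ cong₂ (λ a b → suc (a + b)) (FinP.toℕ-↑ˡ i ∣ B ∣) (toℕ-inPA (A ⁻) (B ⁻) j) ⟩
    suc (toℕ i + (∣ B ⁻ ∣ + toℕ j))                   ≡⟨ cong (λ b → suc (toℕ i + b)) (NatP.+-comm ∣ B ⁻ ∣ (toℕ j)) ⟩
    suc (toℕ i + (toℕ j + ∣ B ⁻ ∣))                   ≡⟨ cong suc (sym (NatP.+-assoc (toℕ i) (toℕ j) _)) ⟩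
    suc (toℕ i + toℕ j) + ∣ B ⁻ ∣                     ≡⟨ cong₂ _+_ e (sizeNeg B) ⟩
    ∣ A ∣ + ∣ B ∣                                     ∎
    where open ≡-Reasoning

  mirror-⊗ʳ : ∀ A B {i : Fin ∣ B ∣} {j : Fin ∣ B ⁻ ∣} → Mirror i j → Mirror (∣ A ∣ ↑ʳ i) (inPB (A ⁻) (B ⁻) j)
  mirror-⊗ʳ A B {i} {j} e = begin
    suc (toℕ (∣ A ∣ ↑ʳ i) + toℕ (inPB (A ⁻) (B ⁻) j)) ≡⟨ cong₂ (λ a b → suc (a + b)) (FinP.toℕ-↑ʳ ∣ A ∣ i) (toℕ-inPB (A ⁻) (B ⁻) j) ⟩
    suc (∣ A ∣ + toℕ i + toℕ j)                       ≡⟨ cong suc (NatP.+-assoc ∣ A ∣ _ _) ⟩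
    suc (∣ A ∣ + (toℕ i + toℕ j))                     ≡⟨ sym (NatP.+-suc ∣ A ∣ _) ⟩
    ∣ A ∣ + suc (toℕ i + toℕ j)                       ≡⟨ cong (∣ A ∣ +_) e ⟩
    ∣ A ∣ + ∣ B ∣                                     ∎
    where open ≡-Reasoning

  mirror-⅋ˡ : ∀ A B {i : Fin ∣ A ∣} {j : Fin ∣ A ⁻ ∣} → Mirror i j → Mirror (inPA A B i) (j ↑ˡ ∣ B ⁻ ∣)
  mirror-⅋ˡ A B {i} {j} e = begin
    suc (toℕ (inPA A B i) + toℕ (j ↑ˡ ∣ B ⁻ ∣)) ≡⟨ cong₂ (λ a b → suc (a + b)) (toℕ-inPA A B i) (FinP.toℕ-↑ˡ j ∣ B ⁻ ∣) ⟩
    suc (∣ B ∣ + toℕ i + toℕ j)                 ≡⟨ cong suc (NatP.+-assoc ∣ B ∣ _ _) ⟩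
    suc (∣ B ∣ + (toℕ i + toℕ j))               ≡⟨ sym (NatP.+-suc ∣ B ∣ _) ⟩
    ∣ B ∣ + suc (toℕ i + toℕ j)                 ≡⟨ cong (∣ B ∣ +_) e ⟩
    ∣ B ∣ + ∣ A ∣                               ≡⟨ NatP.+-comm ∣ B ∣ ∣ A ∣ ⟩
    ∣ A ∣ + ∣ B ∣                               ∎
    where open ≡-Reasoning

  mirror-⅋ʳ : ∀ A B {i : Fin ∣ B ∣} {j : Fin ∣ B ⁻ ∣} → Mirror i j → Mirror (inPB A B i) (∣ A ⁻ ∣ ↑ʳ j)
  mirror-⅋ʳ A B {i} {j} e = begin
    suc (toℕ (inPB A B i) + toℕ (∣ A ⁻ ∣ ↑ʳ j)) ≡⟨ cong₂ (λ a b → suc (a + b)) (toℕ-inPB A B i) (FinP.toℕ-↑ʳ ∣ A ⁻ ∣ j) ⟩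
    suc (toℕ i + (∣ A ⁻ ∣ + toℕ j))             ≡⟨ cong (λ b → suc (toℕ i + b)) (NatP.+-comm ∣ A ⁻ ∣ (toℕ j)) ⟩
    suc (toℕ i + (toℕ j + ∣ A ⁻ ∣))             ≡⟨ cong suc (sym (NatP.+-assoc (toℕ i) (toℕ j) _)) ⟩
    suc (toℕ i + toℕ j) + ∣ A ⁻ ∣               ≡⟨ cong₂ _+_ e (sizeNeg A) ⟩
    ∣ B ∣ + ∣ A ∣                               ≡⟨ NatP.+-comm ∣ B ∣ ∣ A ∣ ⟩
    ∣ A ∣ + ∣ B ∣                               ∎
    where open ≡-Reasoning

  dual : ∀ A → Fin ∣ A ∣ → Fin ∣ A ⁻ ∣
  dual A i = cast (sym (sizeNeg A)) (opposite i)

  dual-mirror : ∀ A i → Mirror i (dual A i)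
  dual-mirror A i = trans (cong (λ k → suc (toℕ i + k)) (FinP.toℕ-cast (sym (sizeNeg A)) (opposite i))) (opposite-mirror i)

  mirror⇒dual : ∀ A {i j} → Mirror i j → dual A i ≡ j
  mirror⇒dual A {i} {j} e = FinP.toℕ-injective
    (NatP.+-cancelˡ-≡ (suc (toℕ i)) _ _ (trans (dual-mirror A i) (sym e)))

  left-dual : ∀ A i → left ⟦ A ⁻ ⟧ (dual A i) ≡ not (left ⟦ A ⟧ i)
  left-dual (pos P) i rewrite mirror⇒opposite {i = dual (pos P) i} {i} (trans (cong suc (NatP.+-comm (toℕ (dual (pos P) i)) (toℕ i))) (dual-mirror (pos P) i)) = refl
  left-dual (neg P) i = trans (cong (left (litBd P)) (sym (mirror⇒opposite (dual-mirror (neg P) i)))) (sym (BoolP.not-involutive _))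
  left-dual (A ⊗ B) v with splitV ∣ A ∣ v
  ... | isˡ i = trans (cong (left ⟦ (A ⁻) ⅋ (B ⁻) ⟧) (mirror⇒dual (A ⊗ B) (mirror-⊗ˡ A B (dual-mirror A i))))
    (trans (left-PA (A ⁻) (B ⁻) (dual A i)) (trans (left-dual A i) (cong not (sym (left-⊗ˡ ⟦ A ⟧ ⟦ B ⟧ i)))))
  ... | isʳ j = trans (cong (left ⟦ (A ⁻) ⅋ (B ⁻) ⟧) (mirror⇒dual (A ⊗ B) (mirror-⊗ʳ A B (dual-mirror B j))))
    (trans (left-PB (A ⁻) (B ⁻) (dual B j)) (trans (left-dual B j) (cong not (sym (left-⊗ʳ ⟦ A ⟧ ⟦ B ⟧ j)))))
  left-dual (A ⅋ B) v with splitP A B v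
  ... | isA i = trans (cong (left ⟦ (A ⁻) ⊗ (B ⁻) ⟧) (mirror⇒dual (A ⅋ B) (mirror-⅋ˡ A B (dual-mirror A i))))
    (trans (left-⊗ˡ ⟦ A ⁻ ⟧ ⟦ B ⁻ ⟧ (dual A i)) (trans (left-dual A i) (cong not (sym (left-PA A B i)))))
  ... | isB j = trans (cong (left ⟦ (A ⁻) ⊗ (B ⁻) ⟧) (mirror⇒dual (A ⅋ B) (mirror-⅋ʳ A B (dual-mirror B j))))
    (trans (left-⊗ʳ ⟦ A ⁻ ⟧ ⟦ B ⁻ ⟧ (dual B j)) (trans (left-dual B j) (cong not (sym (left-PB A B j)))))

-- Gluing

-- The end of an edge: its source (true) or its target (false).
end : ∀ {T V} → Bool → Edge T V → V
end true  e = proj₁ e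
end false e = proj₂ (proj₂ e)

ends : ∀ {T V} → Bool → List (Edge T V) → List V
ends b = map (end b)

-- Labels act on D as relations: an edge (i , w , j) imposes W w (x i) (x j) on x : V → D.
record Action (T : Set) : Set₁ where
  field
    D       : Set
    W       : List T → D → D → Set
    default : D
    W-nil   : ∀ {x y} → W [] x y → x ≡ y
    W-split : ∀ w {w' x y} → W (w ++ w') x y → ∃ λ z → W w x z × W w' z y

module Sat {T : Set} (𝓐 : Action T) where
  open Action 𝓐

  satE : ∀ {V : Set} → (V → D) → Edge T V → Set
  satE x (i , w , j) = W w (x i) (x j)

  sat : ∀ {V : Set} → (V → D) → List (Edge T V) → Set
  sat x = All (satE x)

module Gluing (T : Set) (n : ℕ) (litBd : Fin n → Bd) (Lex : List (LL.Entry T n litBd)) where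
  open LL T n litBd
  open Derivations Lex

  extract-just : ∀ {E : Set} (p : E → Bool) es {e rest} → extract p es ≡ just (e , rest) →
                 p e ≡ true × es ↭ e ∷ rest
  extract-just p (e ∷ es) eq with p e in pe
  extract-just p (e ∷ es) refl | true = pe , ↭-refl
  extract-just p (e ∷ es) eq | false with extract p es in eq'
  extract-just p (e ∷ es) refl | false | just (e' , rest) with extract-just p es eq'
  ... | q , r = q , ↭-trans (prep e r) (swap e e' ↭-refl)

  extract-nothing : ∀ {E : Set} (p : E → Bool) es → extract p es ≡ nothing → All (λ e → p e ≡ false) es
  extract-nothing p [] eq = []
  extract-nothing p (e ∷ es) eq with p e in pe
  ... | false with extract p es in eq'
  ...   | nothing = pe ∷ extract-nothing p es eq'

  module _ {a b : ℕ} where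

    V : Set
    V = Fin a ⊎ Fin b

    Edges : Set
    Edges = List (Edge T V)

    _≟V_ : DecidableEquality V
    _≟V_ = SumP.≡-dec FinP._≟_ FinP._≟_

    open Counting _≟V_

    isNode-true : ∀ {k : Fin b} {v : V} → isNode k v ≡ true → v ≡ inj₂ k
    isNode-true {k} {inj₂ k'} e with k FinP.≟ k'
    ... | yes refl = refl

    isNode-false : ∀ {k : Fin b} {v : V} → isNode k v ≡ false → inj₂ k ≢ v
    isNode-false {k} e refl with k FinP.≟ k
    isNode-false {k} () refl | yes _
    isNode-false {k} e refl | no n = n refl

    -- The proper outcomes of `contract`. Its fallback branches cannot be reached when `k` is the
    -- source of one edge and the target of one edge.
    data Contraction (k : Fin b) (es : List (Edge T V)) (cs : List (List T)) : RawMW T V → Set where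
      loop : ∀ w rest → es ↭ (inj₂ k , w , inj₂ k) ∷ rest → Contraction k es cs (rest , w ∷ cs)
      path : ∀ i w w' j rest → i ≢ inj₂ k → es ↭ (i , w , inj₂ k) ∷ (inj₂ k , w' , j) ∷ rest →
             Contraction k es cs ((i , w ++ w' , j) ∷ rest , cs)

    absent : ∀ b' k (es : Edges) → All (λ e → isNode k (end b' e) ≡ false) es → cnt (inj₂ k) (ends b' es) ≡ 0
    absent b' k [] [] = refl
    absent b' k (e ∷ es) (h ∷ hs) rewrite ind-≢ (isNode-false {k} {end b' e} h) = absent b' k es hs

    contraction : ∀ k es cs → (∀ b' → cnt (inj₂ k) (ends b' es) ≡ 1) → Contraction k es cs (contract k (es , cs))
    contraction k es cs h with extract (λ e → isNode k (proj₂ (proj₂ e))) es in eq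
    ... | nothing with trans (sym (h false)) (absent false k es (extract-nothing _ es eq))
    ...   | ()
    contraction k es cs h | just ((i , w , j) , rest) with extract-just _ es eq
    ... | nj , p with isNode-true {k} {j} nj
    ... | refl with isNode k i in ni
    ...   | true with isNode-true {k} {i} ni
    ...     | refl = loop w rest p
    contraction k es cs h | just ((i , w , j) , rest) | nj , p | refl | false
      with extract (λ e → isNode k (proj₁ e)) rest in eq'
    ... | nothing with trans (sym (h true)) (trans (cnt-↭ (PermP.map⁺ (end true) p))
                       (cong₂ _+_ (ind-≢ (isNode-false {k} {i} ni)) (absent true k rest (extract-nothing _ rest eq'))))
    ...   | ()
    contraction k es cs h | just ((i , w , j) , rest) | nj , p | refl | false | just ((i' , w' , j') , rest')
      with extract-just _ rest eq'
    ... | ni' , p' with isNode-true {k} {i'} ni'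
    ... | refl = path i w w' j' rest' (isNode-false {k} {i} ni ∘ sym) (↭-trans p (prep _ p'))

    cntE : Bool → V → RawMW T V → ℕ
    cntE b' v M = cnt v (ends b' (proj₁ M))

    -- The invariant that keeps `contraction` applicable along `foldr contract`.
    record Contracted (s : Bool → Fin a → ℕ) (ks : List (Fin b)) (M : RawMW T V) : Set where
      field
        outer# : ∀ b' v → cntE b' (inj₁ v) M ≡ s b' v
        inner1 : ∀ b' {k} → k ∉ ks → cntE b' (inj₂ k) M ≡ 1
        inner0 : ∀ b' {k} → k ∈ ks → cntE b' (inj₂ k) M ≡ 0
    open Contracted public

    contraction-≢ : ∀ {k M M'} → Contraction k (proj₁ M) (proj₂ M) M' → ∀ b' {v} → v ≢ inj₂ k → cntE b' v M' ≡ cntE b' v M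
    contraction-≢ (loop w rest p) true n =
      sym (trans (cnt-↭ (PermP.map⁺ (end true) p)) (cong (_+ cnt _ (ends true rest)) (ind-≢ n)))
    contraction-≢ (loop w rest p) false n =
      sym (trans (cnt-↭ (PermP.map⁺ (end false) p)) (cong (_+ cnt _ (ends false rest)) (ind-≢ n)))
    contraction-≢ (path i w w' j rest _ p) true {v} n =
      sym (trans (cnt-↭ (PermP.map⁺ (end true) p)) (cong (λ m → ind v i + (m + cnt v (ends true rest))) (ind-≢ n)))
    contraction-≢ (path i w w' j rest _ p) false n =
      sym (trans (cnt-↭ (PermP.map⁺ (end false) p)) (cong (_+ (ind _ j + cnt _ (ends false rest))) (ind-≢ n)))

    suc+≡1 : ∀ {m} → suc m ≡ 1 → m ≡ 0
    suc+≡1 refl = refl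

    record PathFresh (k : Fin b) (j : V) (rest : List (Edge T V)) : Set where
      field
        j≢   : j ≢ inj₂ k
        src0 : cnt (inj₂ k) (ends true rest) ≡ 0
        tgt0 : cnt (inj₂ k) (ends false rest) ≡ 0
    open PathFresh

    -- The two edges of the path use up the only source and the only target at `k`.
    path-fresh : ∀ {k} {es : Edges} {i w w' j rest} → (∀ b' → cnt (inj₂ k) (ends b' es) ≡ 1) → i ≢ inj₂ k →
                 es ↭ (i , w , inj₂ k) ∷ (inj₂ k , w' , j) ∷ rest → PathFresh k j rest
    path-fresh {k} {j = j} {rest} h n p = record { j≢ = jn ; src0 = s0 ; tgt0 = NatP.m+n≡0⇒n≡0 (ind (inj₂ k) j) t0 }
      where
      s0 : cnt (inj₂ k) (ends true rest) ≡ 0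
      s0 with trans (sym (h true)) (cnt-↭ (PermP.map⁺ (end true) p))
      ... | e rewrite ind-≢ {inj₂ k} (n ∘ sym) | ind-refl (inj₂ k) = suc+≡1 (sym e)
      t0 : ind (inj₂ k) j + cnt (inj₂ k) (ends false rest) ≡ 0
      t0 with trans (sym (h false)) (cnt-↭ (PermP.map⁺ (end false) p))
      ... | e rewrite ind-refl (inj₂ k) = suc+≡1 (sym e)
      jn : j ≢ inj₂ k
      jn refl with trans (sym (ind-refl (inj₂ k))) (NatP.m+n≡0⇒m≡0 (ind (inj₂ k) j) t0)
      ... | ()

    loop-fresh : ∀ {k} {es : Edges} {w rest} → (∀ b' → cnt (inj₂ k) (ends b' es) ≡ 1) →
                 es ↭ (inj₂ k , w , inj₂ k) ∷ rest → ∀ b' → cnt (inj₂ k) (ends b' rest) ≡ 0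
    loop-fresh {k} h p true with trans (sym (h true)) (cnt-↭ (PermP.map⁺ (end true) p))
    ... | e rewrite ind-refl (inj₂ k) = suc+≡1 (sym e)
    loop-fresh {k} h p false with trans (sym (h false)) (cnt-↭ (PermP.map⁺ (end false) p))
    ... | e rewrite ind-refl (inj₂ k) = suc+≡1 (sym e)

    contraction-≡ : ∀ {k M M'} → (∀ b' → cntE b' (inj₂ k) M ≡ 1) → Contraction k (proj₁ M) (proj₂ M) M' →
                    ∀ b' → cntE b' (inj₂ k) M' ≡ 0
    contraction-≡ h (loop w rest p) b' = loop-fresh h p b'
    contraction-≡ {k} h (path i w w' j rest n p) true rewrite ind-≢ {inj₂ k} (n ∘ sym) = src0 (path-fresh h n p)
    contraction-≡ {k} h (path i w w' j rest n p) false rewrite ind-≢ {inj₂ k} (j≢ (path-fresh h n p) ∘ sym) =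
      tgt0 (path-fresh h n p)

    contracted-step : ∀ {s ks M k} → Contracted s ks M → k ∉ ks → Contracted s (k ∷ ks) (contract k M)
    contracted-step {s} {ks} {M} {k} c k∉ = record
      { outer# = λ b' v → trans (contraction-≢ cv b' λ ()) (outer# c b' v)
      ; inner1 = λ b' n → trans (contraction-≢ cv b' λ { refl → n (here refl) }) (inner1 c b' (n ∘ there))
      ; inner0 = i0 }
      where
      cv = contraction k (proj₁ M) (proj₂ M) (λ b' → inner1 c b' k∉)
      i0 : ∀ b' {k'} → k' ∈ k ∷ ks → cntE b' (inj₂ k') (contract k M) ≡ 0
      i0 b' (here refl) = contraction-≡ {M = M} (λ b' → inner1 c b' k∉) cv b'
      i0 b' {k'} (there i) = trans (contraction-≢ cv b' λ { refl → k∉ i }) (inner0 c b' i)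

    contracted : ∀ {s M} ks → Unique ks → Contracted s [] M → Contracted s ks (foldr contract M ks)
    contracted [] u c = c
    contracted (k ∷ ks) (p ∷ u) c =
      contracted-step (contracted ks u c) λ i → All.lookup p i refl

    All-absent : ∀ {P : Edge T V → Set} {k} (es : Edges) → (∀ b' → cnt (inj₂ k) (ends b' es) ≡ 0) →
                 (∀ {e} → (∀ b' → inj₂ k ≢ end b' e) → P e) → All P es
    All-absent es h f = All.tabulate λ {e} i → f λ b' q →
      cnt-∈ (ends b' es) (subst (_∈ ends b' es) (sym q) (∈-map⁺ (end b') i)) (h b')

    tail-absent : ∀ e (es : Edges) → (∀ b' k → cnt (inj₂ k) (ends b' (e ∷ es)) ≡ 0) → ∀ b' k → cnt (inj₂ k) (ends b' es) ≡ 0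
    tail-absent e es h b' k = NatP.m+n≡0⇒n≡0 (ind (inj₂ k) (end b' e)) (h b' k)

    module _ (𝓐 : Action T) where
      open Action 𝓐
      open Sat 𝓐

      upd : (V → D) → V → D → V → D
      upd x v z u with v ≟V u
      ... | yes _ = z
      ... | no _  = x u

      upd-≡ : ∀ x v z → upd x v z v ≡ z
      upd-≡ x v z with v ≟V v
      ... | yes _ = refl
      ... | no n = ⊥-elim (n refl)

      upd-≢ : ∀ x {v u} z → v ≢ u → upd x v z u ≡ x u
      upd-≢ x {v} {u} z n with v ≟V u
      ... | yes e = ⊥-elim (n e)
      ... | no _ = refl

      sat-rest : ∀ {k} x z (es : Edges) → (∀ b' → cnt (inj₂ k) (ends b' es) ≡ 0) → sat x es → sat (upd x (inj₂ k) z) es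
      sat-rest {k} x z es h s = All.zipWith (λ { {i , w , j} (q , f) → f q })
        (s , All-absent es h λ {e} n q → subst₂W (sym (upd-≢ x z (n true))) (sym (upd-≢ x z (n false))) q)
        where
        subst₂W : ∀ {w p p' q q'} → p ≡ p' → q ≡ q' → W w p q → W w p' q'
        subst₂W refl refl h = h

      -- A closed cycle labelled `w` can be reopened at `z` only if `w` relates `z` to itself.
      -- Either there is no cycle, or all labels are reflexive, as they are for `boolAction`.
      Solvable : RawMW T V → Set
      Solvable M = proj₂ M ≡ [] ⊎ (∀ w z → W w z z)

      loop-back : ∀ {k} {es : Edges} {w rest} x z → (∀ b' → cnt (inj₂ k) (ends b' es) ≡ 1) →
                  es ↭ (inj₂ k , w , inj₂ k) ∷ rest → W w z z → sat x rest → sat (upd x (inj₂ k) z) es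
      loop-back {k} x z h p q s = PermP.All-resp-↭ (↭-sym p)
        (q' ∷ sat-rest x z _ (loop-fresh h p) s)
        where
        q' : satE (upd x (inj₂ k) z) (inj₂ k , _ , inj₂ k)
        q' rewrite upd-≡ x (inj₂ k) z = q

      path-back : ∀ {k} {es : Edges} {i w w' j rest} x → (∀ b' → cnt (inj₂ k) (ends b' es) ≡ 1) → i ≢ inj₂ k →
                  es ↭ (i , w , inj₂ k) ∷ (inj₂ k , w' , j) ∷ rest → sat x ((i , w ++ w' , j) ∷ rest) →
                  ∃ λ z → sat (upd x (inj₂ k) z) es
      path-back {k} {es} {i} {w} {w'} {j} {rest} x h n p (q ∷ s) with W-split w q
      ... | z , q₁ , q₂ = z , PermP.All-resp-↭ (↭-sym p) (e₁ ∷ e₂ ∷ sat-rest x z rest fr s)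
        where
        pf = path-fresh h n p
        fr : ∀ b' → cnt (inj₂ k) (ends b' rest) ≡ 0
        fr true = src0 pf
        fr false = tgt0 pf
        e₁ : satE (upd x (inj₂ k) z) (i , w , inj₂ k)
        e₁ rewrite upd-≡ x (inj₂ k) z | upd-≢ x {inj₂ k} {i} z (n ∘ sym) = q₁
        e₂ : satE (upd x (inj₂ k) z) (inj₂ k , w' , j)
        e₂ rewrite upd-≡ x (inj₂ k) z | upd-≢ x {inj₂ k} {j} z (j≢ pf ∘ sym) = q₂

      record Extends (x x' : V → D) (ks : List (Fin b)) : Set where
        field
          outer≡ : ∀ v → x' (inj₁ v) ≡ x (inj₁ v)
          inner≡ : ∀ {k} → k ∉ ks → x' (inj₂ k) ≡ x (inj₂ k)
      open Extends public

      -- Contractions are undone from the last one backwards. Each of them fixes the value at its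
      -- own node alone, so outer values survive.
      back : ∀ {s M} ks → Unique ks → Contracted s [] M → Solvable (foldr contract M ks) →
             ∀ x → sat x (proj₁ (foldr contract M ks)) → ∃ λ x' → sat x' (proj₁ M) × Extends x x' ks
      back [] u c so x h = x , h , record { outer≡ = λ _ → refl ; inner≡ = λ _ → refl }
      back {s} {M} (k ∷ ks) (p ∷ u) c so x h = go (contraction k (proj₁ M') (proj₂ M') (λ b' → inner1 c' b' k∉)) so h
        where
        M' = foldr contract M ks
        c' = contracted ks u c
        k∉ : k ∉ ks
        k∉ i = All.lookup p i refl
        extend : ∀ z → (sat (upd x (inj₂ k) z) (proj₁ M')) → Solvable M' →
                 ∃ λ x' → sat x' (proj₁ M) × Extends x x' (k ∷ ks)
        extend z h' so' with back ks u c so' (upd x (inj₂ k) z) h'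
        ... | x' , h'' , e = x' , h'' , record
          { outer≡ = λ v → trans (outer≡ e v) (upd-≢ x {inj₂ k} z λ ())
          ; inner≡ = λ n → trans (inner≡ e (n ∘ there)) (upd-≢ x {inj₂ k} z λ { refl → n (here refl) }) }
        go : ∀ {M''} → Contraction k (proj₁ M') (proj₂ M') M'' → Solvable M'' → sat x (proj₁ M'') →
             ∃ λ x' → sat x' (proj₁ M) × Extends x x' (k ∷ ks)
        go (loop w rest q) (inj₂ l) h = extend default (loop-back x default (λ b' → inner1 c' b' k∉) q (l w default) h) (inj₂ l)
        go (path i w w' j rest n q) so h with path-back x (λ b' → inner1 c' b' k∉) n q h
        ... | z , h' = extend z h' so

      -- If contraction creates a closed cycle, its value is not determined by the outer vertices.
      cycle-ambiguous : ∀ {s M} ks → Unique ks → Contracted s [] M → (∀ w x y → x ≡ y → W w x y) → proj₂ M ≡ [] →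
        (other : D) → other ≢ default → proj₂ (foldr contract M ks) ≢ [] →
        ∃ λ x → ∃ λ x' → ∃ λ k → sat x (proj₁ M) × sat x' (proj₁ M) ×
          (∀ v → x (inj₁ v) ≡ x' (inj₁ v)) × x (inj₂ k) ≢ x' (inj₂ k)
      cycle-ambiguous [] u c wl cs o o≢ nc = ⊥-elim (nc cs)
      cycle-ambiguous {s} {M} (k ∷ ks) (p ∷ u) c wl cs o o≢ nc =
        go (contraction k (proj₁ M') (proj₂ M') (λ b' → inner1 c' b' k∉)) nc
        where
        M' = foldr contract M ks
        c' = contracted ks u c
        k∉ : k ∉ ks
        k∉ i = All.lookup p i refl
        const-sat : ∀ es → sat (λ _ → default) es
        const-sat es = All.tabulate λ {e} _ → wl (proj₁ (proj₂ e)) default default refl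
        go : ∀ {M''} → Contraction k (proj₁ M') (proj₂ M') M'' → proj₂ M'' ≢ [] →
          ∃ λ x → ∃ λ x' → ∃ λ k → sat x (proj₁ M) × sat x' (proj₁ M) ×
          (∀ v → x (inj₁ v) ≡ x' (inj₁ v)) × x (inj₂ k) ≢ x' (inj₂ k)
        go (path i w w' j rest n q) nc = cycle-ambiguous ks u c wl cs o o≢ nc
        -- Just before its contraction the node `k` carries a loop and may take the default or the
        -- other value; both choices extend back to all of `M`.
        go (loop w rest q) nc
          with back ks u c (inj₂ λ w z → wl w z z refl) (λ _ → default) (const-sat _)
             | back ks u c (inj₂ λ w z → wl w z z refl) (upd (λ _ → default) (inj₂ k) o)
                 (loop-back (λ _ → default) o (λ b' → inner1 c' b' k∉) q (wl w o o refl) (const-sat rest))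
        ... | x , h , e | x' , h' , e' = x , x' , k , h , h'
            , (λ v → trans (outer≡ e v) (sym (trans (outer≡ e' v) (upd-≢ (λ _ → default) {inj₂ k} {inj₁ v} o λ ()))))
            , λ q → o≢ (trans (sym (trans (inner≡ e' k∉) (upd-≡ (λ _ → default) (inj₂ k) o))) (trans (sym q) (inner≡ e k∉)))

      outer-sat : ∀ (es : Edges) → (∀ b' k → cnt (inj₂ k) (ends b' es) ≡ 0) → ∀ (x : V → D) →
                  sat (x ∘ inj₁) (mapMaybe outer es) → sat x es
      outer-sat [] h x [] = []
      outer-sat ((inj₁ i , w , inj₁ j) ∷ es) h x (q ∷ qs) = q ∷ outer-sat es (tail-absent (inj₁ i , w , inj₁ j) es h) x qs
      outer-sat ((inj₂ i , w , j) ∷ es) h x qs with trans (sym (h true i)) (cong (_+ cnt (inj₂ i) (ends true es)) (ind-refl (inj₂ i)))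
      ... | ()
      outer-sat ((inj₁ i , w , inj₂ j) ∷ es) h x qs with trans (sym (h false j)) (cong (_+ cnt (inj₂ j) (ends false es)) (ind-refl (inj₂ j)))
      ... | ()

    ind-inj₁ : ∀ (u v : Fin a) → Counting.ind FinP._≟_ u v ≡ ind (inj₁ u) (inj₁ v)
    ind-inj₁ u v = go (u FinP.≟ v)
      where
      go : Dec (u ≡ v) → Counting.ind FinP._≟_ u v ≡ ind (inj₁ u) (inj₁ v)
      go (yes refl) = trans (Counting.ind-refl FinP._≟_ u) (sym (ind-refl (inj₁ u)))
      go (no n) = trans (Counting.ind-≢ FinP._≟_ n) (sym (ind-≢ λ { refl → n refl }))

    outer-count : ∀ (es : Edges) → (∀ b' k → cnt (inj₂ k) (ends b' es) ≡ 0) → ∀ b' v →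
                  Counting.cnt FinP._≟_ v (ends b' (mapMaybe outer es)) ≡ cnt (inj₁ v) (ends b' es)
    outer-count [] h b' v = refl
    outer-count ((inj₁ i , w , inj₁ j) ∷ es) h true v = cong₂ _+_ (ind-inj₁ v i) (outer-count es (tail-absent (inj₁ i , w , inj₁ j) es h) true v)
    outer-count ((inj₁ i , w , inj₁ j) ∷ es) h false v = cong₂ _+_ (ind-inj₁ v j) (outer-count es (tail-absent (inj₁ i , w , inj₁ j) es h) false v)
    outer-count ((inj₂ i , w , j) ∷ es) h b' v with trans (sym (h true i)) (cong (_+ cnt (inj₂ i) (ends true es)) (ind-refl (inj₂ i)))
    ... | ()
    outer-count ((inj₁ i , w , inj₂ j) ∷ es) h b' v with trans (sym (h false j)) (cong (_+ cnt (inj₂ j) (ends false es)) (ind-refl (inj₂ j)))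
    ... | ()

b2n : Bool → ℕ
b2n true  = 1
b2n false = 0

-- whether a vertex with orientation l is expected at the b-end of an edge
own : Bool → Bool → Bool
own true  l = l
own false l = not l

end-map : ∀ {T U V : Set} (f : U → V) b (es : List (Edge T U)) →
          ends b (map (λ e → f (proj₁ e) , proj₁ (proj₂ e) , f (proj₂ (proj₂ e))) es) ≡ map f (ends b es)
end-map f b [] = refl
end-map f true (e ∷ es) = cong (f (proj₁ e) ∷_) (end-map f true es)
end-map f false (e ∷ es) = cong (f (proj₂ (proj₂ e)) ∷_) (end-map f false es)

module RuleMaps (T : Set) (n : ℕ) (litBd : Fin n → Bd) where
  open Positions T n litBd public

  -- This map and the following ones repeat the maps local to `interp` and agree with them by
  -- computation, so that lemmas can speak of them.
  exF : ∀ Γ Δ A B → Fin (sz (Γ ++ A ∷ B ∷ Δ)) → Fin (sz (Γ ++ B ∷ A ∷ Δ))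
  exF Γ Δ A B x = cast (sym (sz++ Γ (B ∷ A ∷ Δ))) (sw (cast (sz++ Γ (A ∷ B ∷ Δ)) x))
    where
    d' = sz Δ
    a = ∣ A ∣
    b = ∣ B ∣
    g = sz Γ
    sw : Fin (((d' + b) + a) + g) → Fin (((d' + a) + b) + g)
    sw x = [ (λ y → [ (λ y' → [ (λ u → ((u ↑ˡ a) ↑ˡ b) ↑ˡ g)
                                      , (λ v → ((d' + a) ↑ʳ v) ↑ˡ g) ]′ (splitAt d' y'))
                        , (λ z → ((d' ↑ʳ z) ↑ˡ b) ↑ˡ g) ]′ (splitAt (d' + b) y))
             , (λ y → ((d' + a) + b) ↑ʳ y) ]′ (splitAt ((d' + b) + a) x)

  parEq : ∀ Γ A B → sz (Γ ++ A ∷ B ∷ []) ≡ sz (Γ ++ (A ⅋ B) ∷ [])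
  parEq Γ A B = trans (sz++ Γ (A ∷ B ∷ []))
                  (trans (cong (_+ sz Γ) (NatP.+-comm ∣ B ∣ ∣ A ∣ ))
                         (sym (sz++ Γ ((A ⅋ B) ∷ []))))

  ten₁ : ∀ Γ Δ A B → Fin (sz (Γ ++ A ∷ [])) → Fin (sz (Γ ++ (A ⊗ B) ∷ Δ))
  ten₁ Γ Δ A B x = cast (sym (sz++ Γ ((A ⊗ B) ∷ Δ))) ([ (λ i → (sz Δ ↑ʳ (i ↑ˡ ∣ B ∣)) ↑ˡ sz Γ)
                   , (λ j → (sz Δ + (∣ A ∣ + ∣ B ∣)) ↑ʳ j) ]′
                   (splitAt ∣ A ∣ (cast (sz++ Γ (A ∷ [])) x)))

  ten₂ : ∀ Γ Δ A B → Fin (sz (B ∷ Δ)) → Fin (sz (Γ ++ (A ⊗ B) ∷ Δ))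
  ten₂ Γ Δ A B y = cast (sym (sz++ Γ ((A ⊗ B) ∷ Δ))) ([ (λ k → (k ↑ˡ (∣ A ∣ + ∣ B ∣)) ↑ˡ sz Γ)
                   , (λ c → (sz Δ ↑ʳ (∣ A ∣ ↑ʳ c)) ↑ˡ sz Γ) ]′
                   (splitAt (sz Δ) y))

  cut₁ : ∀ Γ Δ A → Fin (sz (Γ ++ A ∷ [])) → Fin (sz Δ + sz Γ) ⊎ Fin ∣ A ∣
  cut₁ Γ Δ A x = [ inj₂ , (λ j → inj₁ (sz Δ ↑ʳ j)) ]′ (splitAt ∣ A ∣ (cast (sz++ Γ (A ∷ [])) x))

  cut₂ : ∀ Γ Δ A → Fin (sz ((A ⁻) ∷ Δ)) → Fin (sz Δ + sz Γ) ⊎ Fin ∣ A ∣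
  cut₂ Γ Δ A y = [ (λ k → inj₁ (k ↑ˡ sz Γ)) , (λ a → inj₂ (opposite (cast (sizeNeg A) a))) ]′
               (splitAt (sz Δ) y)

  idEdge : ∀ A → Fin ∣ A ∣ → Edge T (Fin (∣ A ∣ + ∣ A ⁻ ∣))
  idEdge A i = if left ⟦ A ⟧ i then (i ↑ˡ ∣ A ⁻ ∣ , [] , ∣ A ∣ ↑ʳ dual A i)
               else (∣ A ∣ ↑ʳ dual A i , [] , i ↑ˡ ∣ A ⁻ ∣)

  module _ (Γ Δ : List (Fm n)) (A B : Fm n) where
    exF-L : ∀ i → exF Γ Δ A B (inL Γ (A ∷ B ∷ Δ) i) ≡ inL Γ (B ∷ A ∷ Δ) i
    exF-L i rewrite splitAt-inL Γ (A ∷ B ∷ Δ) i = refl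

    posA : Fin ∣ A ∣ → Fin (sz (Γ ++ A ∷ B ∷ Δ))
    posA i = inR Γ (A ∷ B ∷ Δ) ((sz Δ + ∣ B ∣) ↑ʳ i)

    posB : Fin ∣ B ∣ → Fin (sz (Γ ++ A ∷ B ∷ Δ))
    posB j = inR Γ (A ∷ B ∷ Δ) ((sz Δ ↑ʳ j) ↑ˡ ∣ A ∣)

    posR : Fin (sz Δ) → Fin (sz (Γ ++ A ∷ B ∷ Δ))
    posR u = inR Γ (A ∷ B ∷ Δ) ((u ↑ˡ ∣ B ∣) ↑ˡ ∣ A ∣)

    data Split4 : Fin (sz (Γ ++ A ∷ B ∷ Δ)) → Set where
      is-L : ∀ i → Split4 (inL Γ (A ∷ B ∷ Δ) i)
      is-A : ∀ i → Split4 (posA i)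
      is-B : ∀ j → Split4 (posB j)
      is-R : ∀ u → Split4 (posR u)

    split4 : ∀ v → Split4 v
    split4 v with splitC Γ (A ∷ B ∷ Δ) v
    ... | isL i = is-L i
    ... | isR j with splitV (sz Δ + ∣ B ∣) j
    ...   | isʳ i = is-A i
    ...   | isˡ k with splitV (sz Δ) k
    ...     | isʳ j' = is-B j'
    ...     | isˡ u = is-R u

  module _ (Γ Δ : List (Fm n)) (A B : Fm n) where
    exF-A : ∀ i → exF Γ Δ A B (posA Γ Δ A B i) ≡ posB Γ Δ B A i
    exF-A i rewrite splitAt-inR Γ (A ∷ B ∷ Δ) ((sz Δ + ∣ B ∣) ↑ʳ i) | FinP.splitAt-↑ʳ (sz Δ + ∣ B ∣) (∣ A ∣) i = refl

    exF-B : ∀ j → exF Γ Δ A B (posB Γ Δ A B j) ≡ posA Γ Δ B A j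
    exF-B j rewrite splitAt-inR Γ (A ∷ B ∷ Δ) ((sz Δ ↑ʳ j) ↑ˡ ∣ A ∣)
                  | FinP.splitAt-↑ˡ (sz Δ + ∣ B ∣) (sz Δ ↑ʳ j) (∣ A ∣) | FinP.splitAt-↑ʳ (sz Δ) (∣ B ∣) j = refl

    exF-R : ∀ u → exF Γ Δ A B (posR Γ Δ A B u) ≡ posR Γ Δ B A u
    exF-R u rewrite splitAt-inR Γ (A ∷ B ∷ Δ) ((u ↑ˡ ∣ B ∣) ↑ˡ ∣ A ∣)
                  | FinP.splitAt-↑ˡ (sz Δ + ∣ B ∣) (u ↑ˡ ∣ B ∣) (∣ A ∣) | FinP.splitAt-↑ˡ (sz Δ) u (∣ B ∣) = refl

  exF-involutive : ∀ Γ Δ A B v → exF Γ Δ B A (exF Γ Δ A B v) ≡ v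
  exF-involutive Γ Δ A B v with split4 Γ Δ A B v
  ... | is-L i = trans (cong (exF Γ Δ B A) (exF-L Γ Δ A B i)) (exF-L Γ Δ B A i)
  ... | is-A i = trans (cong (exF Γ Δ B A) (exF-A Γ Δ A B i)) (exF-B Γ Δ B A i)
  ... | is-B j = trans (cong (exF Γ Δ B A) (exF-B Γ Δ A B j)) (exF-A Γ Δ B A j)
  ... | is-R u = trans (cong (exF Γ Δ B A) (exF-R Γ Δ A B u)) (exF-R Γ Δ B A u)

  left-posA : ∀ Γ Δ A B i → left ⟦ Γ ++ A ∷ B ∷ Δ ⟧ᶜ (posA Γ Δ A B i) ≡ left ⟦ A ⟧ i
  left-posA Γ Δ A B i = trans (left-inR Γ (A ∷ B ∷ Δ) _) (left-⊗ʳ ⟦ B ∷ Δ ⟧ᶜ ⟦ A ⟧ i)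

  left-posB : ∀ Γ Δ A B j → left ⟦ Γ ++ A ∷ B ∷ Δ ⟧ᶜ (posB Γ Δ A B j) ≡ left ⟦ B ⟧ j
  left-posB Γ Δ A B j = trans (left-inR Γ (A ∷ B ∷ Δ) _)
    (trans (left-⊗ˡ ⟦ B ∷ Δ ⟧ᶜ ⟦ A ⟧ (sz Δ ↑ʳ j)) (left-⊗ʳ ⟦ Δ ⟧ᶜ ⟦ B ⟧ j))

  left-posR : ∀ Γ Δ A B u → left ⟦ Γ ++ A ∷ B ∷ Δ ⟧ᶜ (posR Γ Δ A B u) ≡ left ⟦ Δ ⟧ᶜ u
  left-posR Γ Δ A B u = trans (left-inR Γ (A ∷ B ∷ Δ) _)
    (trans (left-⊗ˡ ⟦ B ∷ Δ ⟧ᶜ ⟦ A ⟧ (u ↑ˡ ∣ B ∣)) (left-⊗ˡ ⟦ Δ ⟧ᶜ ⟦ B ⟧ u))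

  exF-left : ∀ Γ Δ A B v → left ⟦ Γ ++ B ∷ A ∷ Δ ⟧ᶜ (exF Γ Δ A B v) ≡ left ⟦ Γ ++ A ∷ B ∷ Δ ⟧ᶜ v
  exF-left Γ Δ A B v with split4 Γ Δ A B v
  ... | is-L i = trans (cong (left ⟦ Γ ++ B ∷ A ∷ Δ ⟧ᶜ) (exF-L Γ Δ A B i)) (trans (left-inL Γ (B ∷ A ∷ Δ) i) (sym (left-inL Γ (A ∷ B ∷ Δ) i)))
  ... | is-A i = trans (cong (left ⟦ Γ ++ B ∷ A ∷ Δ ⟧ᶜ) (exF-A Γ Δ A B i)) (trans (left-posB Γ Δ B A i) (sym (left-posA Γ Δ A B i)))
  ... | is-B j = trans (cong (left ⟦ Γ ++ B ∷ A ∷ Δ ⟧ᶜ) (exF-B Γ Δ A B j)) (trans (left-posA Γ Δ B A j) (sym (left-posB Γ Δ A B j)))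
  ... | is-R u = trans (cong (left ⟦ Γ ++ B ∷ A ∷ Δ ⟧ᶜ) (exF-R Γ Δ A B u)) (trans (left-posR Γ Δ B A u) (sym (left-posR Γ Δ A B u)))

  module _ (Γ : List (Fm n)) (A B : Fm n) where
    parF : Fin (sz (Γ ++ A ∷ B ∷ [])) → Fin (sz (Γ ++ (A ⅋ B) ∷ []))
    parF = cast (parEq Γ A B)

    parF-L : ∀ i → parF (inL Γ (A ∷ B ∷ []) i) ≡ inL Γ ((A ⅋ B) ∷ []) i
    parF-L i = FinP.toℕ-injective (trans (FinP.toℕ-cast (parEq Γ A B) (inL Γ (A ∷ B ∷ []) i)) (trans (toℕ-inL Γ (A ∷ B ∷ []) i)
      (trans (cong (_+ toℕ i) (NatP.+-comm ∣ B ∣ ∣ A ∣)) (sym (toℕ-inL Γ ((A ⅋ B) ∷ []) i)))))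

    parF-A : ∀ i → parF (posA Γ [] A B i) ≡ inR Γ ((A ⅋ B) ∷ []) (inPA A B i)
    parF-A i = FinP.toℕ-injective (trans (FinP.toℕ-cast (parEq Γ A B) (posA Γ [] A B i)) (trans (toℕ-inR Γ (A ∷ B ∷ []) _)
      (trans (FinP.toℕ-↑ʳ ∣ B ∣ i) (sym (trans (toℕ-inR Γ ((A ⅋ B) ∷ []) _) (toℕ-inPA A B i))))))

    parF-B : ∀ j → parF (posB Γ [] A B j) ≡ inR Γ ((A ⅋ B) ∷ []) (inPB A B j)
    parF-B j = FinP.toℕ-injective (trans (FinP.toℕ-cast (parEq Γ A B) (posB Γ [] A B j)) (trans (toℕ-inR Γ (A ∷ B ∷ []) _)
      (trans (FinP.toℕ-↑ˡ j ∣ A ∣) (sym (trans (toℕ-inR Γ ((A ⅋ B) ∷ []) _) (toℕ-inPB A B j))))))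

    parF-left : ∀ v → left ⟦ Γ ++ (A ⅋ B) ∷ [] ⟧ᶜ (parF v) ≡ left ⟦ Γ ++ A ∷ B ∷ [] ⟧ᶜ v
    parF-left v with split4 Γ [] A B v
    ... | is-L i = trans (cong (left ⟦ Γ ++ (A ⅋ B) ∷ [] ⟧ᶜ) (parF-L i)) (trans (left-inL Γ ((A ⅋ B) ∷ []) i) (sym (left-inL Γ (A ∷ B ∷ []) i)))
    ... | is-A i = trans (cong (left ⟦ Γ ++ (A ⅋ B) ∷ [] ⟧ᶜ) (parF-A i)) (trans (left-inR Γ ((A ⅋ B) ∷ []) _) (trans (left-PA A B i) (sym (left-posA Γ [] A B i))))
    ... | is-B j = trans (cong (left ⟦ Γ ++ (A ⅋ B) ∷ [] ⟧ᶜ) (parF-B j)) (trans (left-inR Γ ((A ⅋ B) ∷ []) _) (trans (left-PB A B j) (sym (left-posB Γ [] A B j))))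

  module _ (Γ Δ : List (Fm n)) (A B : Fm n) where
    ten-A : Fin ∣ A ∣ → Fin (sz (Γ ++ (A ⊗ B) ∷ Δ))
    ten-A i = inR Γ ((A ⊗ B) ∷ Δ) (sz Δ ↑ʳ (i ↑ˡ ∣ B ∣))

    ten-B : Fin ∣ B ∣ → Fin (sz (Γ ++ (A ⊗ B) ∷ Δ))
    ten-B j = inR Γ ((A ⊗ B) ∷ Δ) (sz Δ ↑ʳ (∣ A ∣ ↑ʳ j))

    ten-R : Fin (sz Δ) → Fin (sz (Γ ++ (A ⊗ B) ∷ Δ))
    ten-R u = inR Γ ((A ⊗ B) ∷ Δ) (u ↑ˡ (∣ A ∣ + ∣ B ∣))

    ten₁-L : ∀ i → ten₁ Γ Δ A B (inL Γ (A ∷ []) i) ≡ inL Γ ((A ⊗ B) ∷ Δ) i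
    ten₁-L i rewrite splitAt-inL Γ (A ∷ []) i = refl

    ten₁-A : ∀ i → ten₁ Γ Δ A B (inR Γ (A ∷ []) i) ≡ ten-A i
    ten₁-A i rewrite splitAt-inR Γ (A ∷ []) i = refl

    ten₂-B : ∀ j → ten₂ Γ Δ A B (sz Δ ↑ʳ j) ≡ ten-B j
    ten₂-B j rewrite FinP.splitAt-↑ʳ (sz Δ) (∣ B ∣) j = refl

    ten₂-R : ∀ u → ten₂ Γ Δ A B (u ↑ˡ ∣ B ∣) ≡ ten-R u
    ten₂-R u rewrite FinP.splitAt-↑ˡ (sz Δ) u (∣ B ∣) = refl

    data SplitT : Fin (sz (Γ ++ (A ⊗ B) ∷ Δ)) → Set where
      t-L : ∀ i → SplitT (inL Γ ((A ⊗ B) ∷ Δ) i)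
      t-A : ∀ i → SplitT (ten-A i)
      t-B : ∀ j → SplitT (ten-B j)
      t-R : ∀ u → SplitT (ten-R u)

    splitT : ∀ v → SplitT v
    splitT v with splitC Γ ((A ⊗ B) ∷ Δ) v
    ... | isL i = t-L i
    ... | isR j with splitV (sz Δ) j
    ...   | isˡ u = t-R u
    ...   | isʳ c with splitV ∣ A ∣ c
    ...     | isˡ i = t-A i
    ...     | isʳ j' = t-B j'

  module _ (Γ Δ : List (Fm n)) (A : Fm n) where
    cut₁-L : ∀ i → cut₁ Γ Δ A (inL Γ (A ∷ []) i) ≡ inj₁ (sz Δ ↑ʳ i)
    cut₁-L i rewrite splitAt-inL Γ (A ∷ []) i = refl

    cut₁-A : ∀ i → cut₁ Γ Δ A (inR Γ (A ∷ []) i) ≡ inj₂ i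
    cut₁-A i rewrite splitAt-inR Γ (A ∷ []) i = refl

    cut₂-R : ∀ u → cut₂ Γ Δ A (u ↑ˡ ∣ A ⁻ ∣) ≡ inj₁ (u ↑ˡ sz Γ)
    cut₂-R u rewrite FinP.splitAt-↑ˡ (sz Δ) u (∣ A ⁻ ∣) = refl

    opposite-cast-dual : ∀ i → opposite (cast (sizeNeg A) (dual A i)) ≡ i
    opposite-cast-dual i = trans (cong opposite (cast-cast⁻ (sizeNeg A) (opposite i))) (FinP.opposite-involutive i)

    dual-opposite-cast : ∀ j → dual A (opposite (cast (sizeNeg A) j)) ≡ j
    dual-opposite-cast j = trans (cong (cast (sym (sizeNeg A))) (FinP.opposite-involutive (cast (sizeNeg A) j))) (cast⁻-cast (sizeNeg A) j)

    cut₂-A : ∀ i → cut₂ Γ Δ A (sz Δ ↑ʳ dual A i) ≡ inj₂ i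
    cut₂-A i rewrite FinP.splitAt-↑ʳ (sz Δ) (∣ A ⁻ ∣) (dual A i) = cong inj₂ (opposite-cast-dual i)

  data SplitD (Δ : List (Fm n)) (A : Fm n) : Fin (sz ((A ⁻) ∷ Δ)) → Set where
    d-R : ∀ u → SplitD Δ A (u ↑ˡ ∣ A ⁻ ∣)
    d-A : ∀ i → SplitD Δ A (sz Δ ↑ʳ dual A i)

  splitD : ∀ Δ A v → SplitD Δ A v
  splitD Δ A v with splitV (sz Δ) v
  ... | isˡ u = d-R u
  ... | isʳ j = subst (SplitD Δ A ∘ (sz Δ ↑ʳ_)) (dual-opposite-cast [] Δ A j) (d-A (opposite (cast (sizeNeg A) j)))

-- Orientation and perfection in one counting formula, which the rules preserve by addition;
-- `matching-oriented` and `matching-perfect` lead back.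
Matching : ∀ {T} (X : Bd) → List (Edge T (Fin (size X))) → Set
Matching X es = ∀ b v → Counting.cnt FinP._≟_ v (ends b es) ≡ b2n (own b (left X v))

b2n-own-not : ∀ b l → b2n (own b l) + b2n (own b (not l)) ≡ 1
b2n-own-not true true = refl
b2n-own-not true false = refl
b2n-own-not false true = refl
b2n-own-not false false = refl

module DerivationMatching (T : Set) (n : ℕ) (litBd : Fin n → Bd) (Lex : List (LL.Entry T n litBd)) where
  open RuleMaps T n litBd public
  open Derivations Lex public
  open Gluing T n litBd Lex public

  module F {m} = Counting (FinP._≟_ {m})

  ren-matching : ∀ {X Y} (f : Fin (size X) → Fin (size Y)) (g : Fin (size Y) → Fin (size X)) →
    (∀ {u v} → f u ≡ f v → u ≡ v) → (∀ v → f (g v) ≡ v) → (∀ u → left Y (f u) ≡ left X u) →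
    ∀ {M : RawMW T (Fin (size X))} → Matching X (proj₁ M) → Matching Y (proj₁ (ren f M))
  ren-matching {X} {Y} f g inj fg fl {es , _} h b v = begin
    F.cnt v (ends b (proj₁ (ren f (es , [])))) ≡⟨ cong (F.cnt v) (end-map f b es) ⟩
    F.cnt v (map f (ends b es))                ≡⟨ cong (λ u → F.cnt u (map f (ends b es))) (sym (fg v)) ⟩
    F.cnt (f (g v)) (map f (ends b es))        ≡⟨ cnt-map FinP._≟_ FinP._≟_ f inj (g v) (ends b es) ⟩
    F.cnt (g v) (ends b es)                    ≡⟨ h b (g v) ⟩
    b2n (own b (left X (g v)))                 ≡⟨ cong (λ l → b2n (own b l)) (sym (trans (cong (left Y) (sym (fg v))) (fl (g v)))) ⟩
    b2n (own b (left Y v))                     ∎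
    where open ≡-Reasoning

  module _ {U₁ U₂ V : Set} (_≟₁_ : DecidableEquality U₁) (_≟₂_ : DecidableEquality U₂) (_≟_ : DecidableEquality V)
           (f₁ : U₁ → V) (f₂ : U₂ → V) where
    union-cnt : ∀ b v (M₁ : RawMW T U₁) (M₂ : RawMW T U₂) →
      Counting.cnt _≟_ v (ends b (proj₁ (union (ren f₁ M₁) (ren f₂ M₂)))) ≡
      Counting.cnt _≟_ v (map f₁ (ends b (proj₁ M₁))) + Counting.cnt _≟_ v (map f₂ (ends b (proj₁ M₂)))
    union-cnt b v (es₁ , cs₁) (es₂ , cs₂) = begin
      cnt v (ends b (r₁ ++ r₂))          ≡⟨ cong (cnt v) (map-++ (end b) r₁ r₂) ⟩
      cnt v (ends b r₁ ++ ends b r₂)     ≡⟨ cnt-++ v (ends b r₁) (ends b r₂) ⟩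
      cnt v (ends b r₁) + cnt v (ends b r₂) ≡⟨ cong₂ (λ x y → cnt v x + cnt v y) (end-map f₁ b es₁) (end-map f₂ b es₂) ⟩
      cnt v (map f₁ (ends b es₁)) + cnt v (map f₂ (ends b es₂)) ∎
      where
      open ≡-Reasoning
      open Counting _≟_
      r₁ = proj₁ (ren f₁ (es₁ , cs₁))
      r₂ = proj₁ (ren f₂ (es₂ , cs₂))

  id-matching : ∀ A → Matching ⟦ (A ⁻) ∷ A ∷ [] ⟧ᶜ (map (idEdge A) (allFin ∣ A ∣))
  id-matching A b v = trans (cong (F.cnt v) (trans (sym (map-∘ (allFin ∣ A ∣))) (map-tabulate id (end b ∘ idEdge A)))) (go (splitV ∣ A ∣ v))
    where
    X = ⟦ (A ⁻) ∷ A ∷ [] ⟧ᶜ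
    vertex : Bool → Fin ∣ A ∣ → Fin (size X)
    vertex true i = i ↑ˡ ∣ A ⁻ ∣
    vertex false i = ∣ A ∣ ↑ʳ dual A i
    end-id : ∀ b i → end b (idEdge A i) ≡ vertex (own b (left ⟦ A ⟧ i)) i
    end-id true i with left ⟦ A ⟧ i
    ... | true = refl
    ... | false = refl
    end-id false i with left ⟦ A ⟧ i
    ... | true = refl
    ... | false = refl
    ↑ˡ≢↑ʳ : ∀ {i j} → i ↑ˡ ∣ A ⁻ ∣ ≢ ∣ A ∣ ↑ʳ j
    ↑ˡ≢↑ʳ {i} {j} e with trans (sym (FinP.splitAt-↑ˡ (∣ A ∣) i (∣ A ⁻ ∣))) (trans (cong (splitAt ∣ A ∣) e) (FinP.splitAt-↑ʳ (∣ A ∣) (∣ A ⁻ ∣) j))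
    ... | ()
    dual-injective : ∀ {i j} → dual A i ≡ dual A j → i ≡ j
    dual-injective {i} {j} e = trans (sym (opposite-cast-dual [] [] A i))
      (trans (cong (opposite ∘ cast (sizeNeg A)) e) (opposite-cast-dual [] [] A j))
    vertex-inj : ∀ l l' i j → vertex l j ≡ vertex l' i → j ≡ i
    vertex-inj true true i j e = FinP.↑ˡ-injective ∣ A ⁻ ∣ j i e
    vertex-inj true false i j e = ⊥-elim (↑ˡ≢↑ʳ e)
    vertex-inj false true i j e = ⊥-elim (↑ˡ≢↑ʳ (sym e))
    vertex-inj false false i j e = dual-injective (FinP.↑ʳ-injective ∣ A ∣ _ _ e)
    ind-vertex : ∀ l l' i → F.ind (vertex l i) (vertex l' i) ≡ b2n (own l l')
    ind-vertex true true i = F.ind-refl (vertex true i)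
    ind-vertex true false i = F.ind-≢ ↑ˡ≢↑ʳ
    ind-vertex false true i = F.ind-≢ (↑ˡ≢↑ʳ ∘ sym)
    ind-vertex false false i = F.ind-refl (vertex false i)
    count : ∀ l i → F.cnt (vertex l i) (tabulate (end b ∘ idEdge A)) ≡ b2n (own l (own b (left ⟦ A ⟧ i)))
    count l i = trans (F.cnt-tabulate (end b ∘ idEdge A) i (λ j e → vertex-inj (own b (left ⟦ A ⟧ j)) l i j (trans (sym (end-id b j)) e)))
      (trans (cong (F.ind (vertex l i)) (end-id b i)) (ind-vertex l _ i))
    own-not : ∀ b l → not (own b l) ≡ own b (not l)
    own-not true l = refl
    own-not false l = refl
    go : ∀ {v} → SplitV ∣ A ∣ v → F.cnt v (tabulate (end b ∘ idEdge A)) ≡ b2n (own b (left X v))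
    go (isˡ i) = trans (count true i) (cong (b2n ∘ own b) (sym (left-⊗ˡ ⟦ A ∷ [] ⟧ᶜ ⟦ A ⁻ ⟧ i)))
    go (isʳ j) = subst (λ j → F.cnt (∣ A ∣ ↑ʳ j) (tabulate (end b ∘ idEdge A)) ≡ b2n (own b (left X (∣ A ∣ ↑ʳ j))))
      (dual-opposite-cast [] [] A j)
      (trans (count false i) (cong b2n (trans (own-not b _) (cong (own b) (sym (trans (left-⊗ʳ ⟦ A ∷ [] ⟧ᶜ ⟦ A ⁻ ⟧ (dual A i)) (left-dual A i)))))))
      where i = opposite (cast (sizeNeg A) j)

  module CutGlue {Γ Δ : List (Fm n)} (A : Fm n) (M₁ : RawMW T (Fin (sz (Γ ++ A ∷ [])))) (M₂ : RawMW T (Fin (sz ((A ⁻) ∷ Δ)))) where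
    V' : Set
    V' = Fin (sz Δ + sz Γ) ⊎ Fin ∣ A ∣

    joined : RawMW T V'
    joined = union (ren (cut₁ Γ Δ A) M₁) (ren (cut₂ Γ Δ A) M₂)

    glued : RawMW T V'
    glued = foldr contract joined (allFin ∣ A ∣)

    result : RawMW T (Fin (sz (Γ ++ Δ)))
    result = ren (cast (sym (sz++ Γ Δ))) (mapMaybe outer (proj₁ glued) , proj₂ glued)

    open Counting (_≟V_ {sz Δ + sz Γ} {∣ A ∣})

    cut₁-injective : ∀ {u v} → cut₁ Γ Δ A u ≡ cut₁ Γ Δ A v → u ≡ v
    cut₁-injective {u} {v} e with splitC Γ (A ∷ []) u | splitC Γ (A ∷ []) v
    ... | isL i | isL j = cong (inL Γ (A ∷ [])) (FinP.↑ʳ-injective (sz Δ) i j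
                            (SumP.inj₁-injective (trans (sym (cut₁-L Γ Δ A i)) (trans e (cut₁-L Γ Δ A j)))))
    ... | isR i | isR j = cong (inR Γ (A ∷ [])) (SumP.inj₂-injective (trans (sym (cut₁-A Γ Δ A i)) (trans e (cut₁-A Γ Δ A j))))
    ... | isL i | isR j with trans (sym (cut₁-L Γ Δ A i)) (trans e (cut₁-A Γ Δ A j))
    ...   | ()
    cut₁-injective {u} {v} e | isR i | isL j with trans (sym (cut₁-A Γ Δ A i)) (trans e (cut₁-L Γ Δ A j))
    ...   | ()

    cut₂-injective : ∀ {u v} → cut₂ Γ Δ A u ≡ cut₂ Γ Δ A v → u ≡ v
    cut₂-injective {u} {v} e with splitD Δ A u | splitD Δ A v
    ... | d-R i | d-R j = cong (_↑ˡ ∣ A ⁻ ∣) (FinP.↑ˡ-injective (sz Γ) i j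
                            (SumP.inj₁-injective (trans (sym (cut₂-R Γ Δ A i)) (trans e (cut₂-R Γ Δ A j)))))
    ... | d-A i | d-A j = cong (λ k → sz Δ ↑ʳ dual A k) (SumP.inj₂-injective (trans (sym (cut₂-A Γ Δ A i)) (trans e (cut₂-A Γ Δ A j))))
    ... | d-R i | d-A j with trans (sym (cut₂-R Γ Δ A i)) (trans e (cut₂-A Γ Δ A j))
    ...   | ()
    cut₂-injective {u} {v} e | d-A i | d-R j with trans (sym (cut₂-A Γ Δ A i)) (trans e (cut₂-R Γ Δ A j))
    ...   | ()

    ↑ˡ≢↑ʳ : ∀ {i : Fin (sz Δ)} {j : Fin (sz Γ)} → i ↑ˡ sz Γ ≢ sz Δ ↑ʳ j
    ↑ˡ≢↑ʳ {i} {j} e with trans (sym (FinP.splitAt-↑ˡ (sz Δ) i (sz Γ))) (trans (cong (splitAt (sz Δ)) e) (FinP.splitAt-↑ʳ (sz Δ) (sz Γ) j))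
    ... | ()

    joined-cnt : ∀ b v → cntE b v joined ≡ cnt v (map (cut₁ Γ Δ A) (ends b (proj₁ M₁))) + cnt v (map (cut₂ Γ Δ A) (ends b (proj₁ M₂)))
    joined-cnt b v = union-cnt FinP._≟_ FinP._≟_ _≟V_ (cut₁ Γ Δ A) (cut₂ Γ Δ A) b v M₁ M₂

    cnt₁ : ∀ b {v} u → cut₁ Γ Δ A u ≡ v → cnt v (map (cut₁ Γ Δ A) (ends b (proj₁ M₁))) ≡ F.cnt u (ends b (proj₁ M₁))
    cnt₁ b u refl = cnt-map FinP._≟_ _≟V_ (cut₁ Γ Δ A) cut₁-injective u (ends b (proj₁ M₁))

    cnt₂ : ∀ b {v} u → cut₂ Γ Δ A u ≡ v → cnt v (map (cut₂ Γ Δ A) (ends b (proj₁ M₂))) ≡ F.cnt u (ends b (proj₁ M₂))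
    cnt₂ b u refl = cnt-map FinP._≟_ _≟V_ (cut₂ Γ Δ A) cut₂-injective u (ends b (proj₁ M₂))

    not-cut₁ : ∀ {i : Fin (sz Δ)} u → cut₁ Γ Δ A u ≢ inj₁ (i ↑ˡ sz Γ)
    not-cut₁ u e with splitC Γ (A ∷ []) u
    ... | isL j = ↑ˡ≢↑ʳ (sym (SumP.inj₁-injective (trans (sym (cut₁-L Γ Δ A j)) e)))
    ... | isR j with trans (sym (cut₁-A Γ Δ A j)) e
    ...   | ()

    not-cut₂ : ∀ {i : Fin (sz Γ)} u → cut₂ Γ Δ A u ≢ inj₁ (sz Δ ↑ʳ i)
    not-cut₂ u e with splitD Δ A u
    ... | d-R j = ↑ˡ≢↑ʳ (SumP.inj₁-injective (trans (sym (cut₂-R Γ Δ A j)) e))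
    ... | d-A j with trans (sym (cut₂-A Γ Δ A j)) e
    ...   | ()

    module _ (h₁ : Matching ⟦ Γ ++ A ∷ [] ⟧ᶜ (proj₁ M₁)) (h₂ : Matching ⟦ (A ⁻) ∷ Δ ⟧ᶜ (proj₁ M₂)) where

      -- By `left-dual` the two copies of a cut vertex have opposite orientations, so one is a
      -- source and the other a target.
      joined-contracted : Contracted (λ b v → cntE b (inj₁ v) joined) [] joined
      joined-contracted = record { outer# = λ _ _ → refl ; inner1 = λ b {k} _ → one b k ; inner0 = λ _ () }
        where
        one : ∀ b k → cntE b (inj₂ k) joined ≡ 1
        one b k = begin
          cntE b (inj₂ k) joined                                        ≡⟨ joined-cnt b (inj₂ k) ⟩
          cnt (inj₂ k) (map (cut₁ Γ Δ A) (ends b (proj₁ M₁))) + cnt (inj₂ k) (map (cut₂ Γ Δ A) (ends b (proj₁ M₂)))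
                                                                       ≡⟨ cong₂ _+_ (trans (cnt₁ b _ (cut₁-A Γ Δ A k)) (h₁ b _)) (trans (cnt₂ b _ (cut₂-A Γ Δ A k)) (h₂ b _)) ⟩
          b2n (own b (left ⟦ Γ ++ A ∷ [] ⟧ᶜ (inR Γ (A ∷ []) k))) + b2n (own b (left ⟦ (A ⁻) ∷ Δ ⟧ᶜ (sz Δ ↑ʳ dual A k)))
                                                                       ≡⟨ cong₂ (λ x y → b2n (own b x) + b2n (own b y)) (left-inR Γ (A ∷ []) k) (trans (left-⊗ʳ ⟦ Δ ⟧ᶜ ⟦ A ⁻ ⟧ (dual A k)) (left-dual A k)) ⟩
          b2n (own b (left ⟦ A ⟧ k)) + b2n (own b (not (left ⟦ A ⟧ k))) ≡⟨ b2n-own-not b (left ⟦ A ⟧ k) ⟩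
          1                                                            ∎
          where open ≡-Reasoning

      glued-contracted : Contracted (λ b v → cntE b (inj₁ v) joined) (allFin ∣ A ∣) glued
      glued-contracted = contracted (allFin ∣ A ∣) (allFin⁺ ∣ A ∣) joined-contracted

      inner-absent : ∀ b k → cntE b (inj₂ k) glued ≡ 0
      inner-absent b k = inner0 glued-contracted b (∈-allFin k)

      cut-matching : Matching ⟦ Γ ++ Δ ⟧ᶜ (proj₁ result)
      cut-matching b v = go (splitC Γ Δ v)
        where
        out : ∀ u → F.cnt (cast (sym (sz++ Γ Δ)) u) (ends b (proj₁ result)) ≡ cntE b (inj₁ u) joined
        out u = trans (cong (F.cnt _) (end-map (cast (sym (sz++ Γ Δ))) b (mapMaybe outer (proj₁ glued))))
          (trans (cnt-map FinP._≟_ FinP._≟_ (cast (sym (sz++ Γ Δ))) (cast-injective (sym (sz++ Γ Δ))) u (ends b (mapMaybe outer (proj₁ glued))))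
            (trans (outer-count (proj₁ glued) inner-absent b u) (outer# glued-contracted b u)))
        go : ∀ {v} → SplitC Γ Δ v → F.cnt v (ends b (proj₁ result)) ≡ b2n (own b (left ⟦ Γ ++ Δ ⟧ᶜ v))
        go (isL i) = begin
          F.cnt (inL Γ Δ i) (ends b (proj₁ result)) ≡⟨ out (sz Δ ↑ʳ i) ⟩
          cntE b (inj₁ (sz Δ ↑ʳ i)) joined           ≡⟨ joined-cnt b _ ⟩
          cnt (inj₁ (sz Δ ↑ʳ i)) (map (cut₁ Γ Δ A) (ends b (proj₁ M₁))) + cnt (inj₁ (sz Δ ↑ʳ i)) (map (cut₂ Γ Δ A) (ends b (proj₁ M₂)))
                                                    ≡⟨ cong₂ _+_ (trans (cnt₁ b _ (cut₁-L Γ Δ A i)) (h₁ b _)) (cnt-map-∉ _≟V_ (cut₂ Γ Δ A) not-cut₂ (ends b (proj₁ M₂))) ⟩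
          b2n (own b (left ⟦ Γ ++ A ∷ [] ⟧ᶜ (inL Γ (A ∷ []) i))) + 0
                                                    ≡⟨ NatP.+-identityʳ _ ⟩
          b2n (own b (left ⟦ Γ ++ A ∷ [] ⟧ᶜ (inL Γ (A ∷ []) i)))
                                                    ≡⟨ cong (b2n ∘ own b) (trans (left-inL Γ (A ∷ []) i) (sym (left-inL Γ Δ i))) ⟩
          b2n (own b (left ⟦ Γ ++ Δ ⟧ᶜ (inL Γ Δ i))) ∎
          where open ≡-Reasoning
        go (isR j) = begin
          F.cnt (inR Γ Δ j) (ends b (proj₁ result)) ≡⟨ out (j ↑ˡ sz Γ) ⟩
          cntE b (inj₁ (j ↑ˡ sz Γ)) joined           ≡⟨ joined-cnt b _ ⟩
          cnt (inj₁ (j ↑ˡ sz Γ)) (map (cut₁ Γ Δ A) (ends b (proj₁ M₁))) + cnt (inj₁ (j ↑ˡ sz Γ)) (map (cut₂ Γ Δ A) (ends b (proj₁ M₂)))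
                                                    ≡⟨ cong₂ _+_ (cnt-map-∉ _≟V_ (cut₁ Γ Δ A) not-cut₁ (ends b (proj₁ M₁))) (trans (cnt₂ b _ (cut₂-R Γ Δ A j)) (h₂ b _)) ⟩
          b2n (own b (left ⟦ (A ⁻) ∷ Δ ⟧ᶜ (j ↑ˡ ∣ A ⁻ ∣)))
                                                    ≡⟨ cong (b2n ∘ own b) (trans (left-⊗ˡ ⟦ Δ ⟧ᶜ ⟦ A ⁻ ⟧ j) (sym (left-inR Γ Δ j))) ⟩
          b2n (own b (left ⟦ Γ ++ Δ ⟧ᶜ (inR Γ Δ j))) ∎
          where open ≡-Reasoning

  module _ (Γ Δ : List (Fm n)) (A B : Fm n) (M₁ : RawMW T (Fin (sz (Γ ++ A ∷ [])))) (M₂ : RawMW T (Fin (sz (B ∷ Δ)))) where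

    private
      inR-≢ : ∀ {c d : Fin (sz ((A ⊗ B) ∷ Δ))} → c ≢ d → inR Γ ((A ⊗ B) ∷ Δ) c ≢ inR Γ ((A ⊗ B) ∷ Δ) d
      inR-≢ n e = n (inR-injective Γ ((A ⊗ B) ∷ Δ) e)

      ↑≢ : ∀ {p q} {i : Fin p} {j : Fin q} → i ↑ˡ q ≢ p ↑ʳ j
      ↑≢ {p} {q} {i} {j} e with trans (sym (FinP.splitAt-↑ˡ p i q)) (trans (cong (splitAt p) e) (FinP.splitAt-↑ʳ p q j))
      ... | ()

      A≢B : ∀ {i j} → ten-A Γ Δ A B i ≢ ten-B Γ Δ A B j
      A≢B = inR-≢ λ e → ↑≢ (FinP.↑ʳ-injective (sz Δ) _ _ e)

      R≢A : ∀ {u i} → ten-R Γ Δ A B u ≢ ten-A Γ Δ A B i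
      R≢A = inR-≢ ↑≢

      R≢B : ∀ {u i} → ten-R Γ Δ A B u ≢ ten-B Γ Δ A B i
      R≢B = inR-≢ ↑≢

      t₁ = ten₁ Γ Δ A B
      t₂ = ten₂ Γ Δ A B

      t₁-injective : ∀ {u v} → t₁ u ≡ t₁ v → u ≡ v
      t₁-injective {u} {v} e with splitC Γ (A ∷ []) u | splitC Γ (A ∷ []) v
      ... | isL i | isL j = cong (inL Γ (A ∷ [])) (inL-injective Γ ((A ⊗ B) ∷ Δ) (trans (sym (ten₁-L Γ Δ A B i)) (trans e (ten₁-L Γ Δ A B j))))
      ... | isR i | isR j = cong (inR Γ (A ∷ [])) (FinP.↑ˡ-injective ∣ B ∣ i j (FinP.↑ʳ-injective (sz Δ) _ _
                              (inR-injective Γ ((A ⊗ B) ∷ Δ) (trans (sym (ten₁-A Γ Δ A B i)) (trans e (ten₁-A Γ Δ A B j))))))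
      ... | isL i | isR j = ⊥-elim (inL≢inR Γ ((A ⊗ B) ∷ Δ) (trans (sym (ten₁-L Γ Δ A B i)) (trans e (ten₁-A Γ Δ A B j))))
      ... | isR i | isL j = ⊥-elim (inL≢inR Γ ((A ⊗ B) ∷ Δ) (trans (sym (ten₁-L Γ Δ A B j)) (trans (sym e) (ten₁-A Γ Δ A B i))))

      t₂-injective : ∀ {u v} → t₂ u ≡ t₂ v → u ≡ v
      t₂-injective {u} {v} e with splitV (sz Δ) u | splitV (sz Δ) v
      ... | isʳ i | isʳ j = cong (sz Δ ↑ʳ_) (FinP.↑ʳ-injective ∣ A ∣ _ _ (FinP.↑ʳ-injective (sz Δ) _ _
                              (inR-injective Γ ((A ⊗ B) ∷ Δ) (trans (sym (ten₂-B Γ Δ A B i)) (trans e (ten₂-B Γ Δ A B j))))))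
      ... | isˡ i | isˡ j = cong (_↑ˡ ∣ B ∣) (FinP.↑ˡ-injective (∣ A ∣ + ∣ B ∣) i j
                              (inR-injective Γ ((A ⊗ B) ∷ Δ) (trans (sym (ten₂-R Γ Δ A B i)) (trans e (ten₂-R Γ Δ A B j)))))
      ... | isʳ i | isˡ j = ⊥-elim (R≢B (trans (sym (ten₂-R Γ Δ A B j)) (trans (sym e) (ten₂-B Γ Δ A B i))))
      ... | isˡ i | isʳ j = ⊥-elim (R≢B (trans (sym (ten₂-R Γ Δ A B i)) (trans e (ten₂-B Γ Δ A B j))))

      t₁≢t₂ : ∀ u v → t₁ u ≢ t₂ v
      t₁≢t₂ u v e with splitC Γ (A ∷ []) u | splitV (sz Δ) v
      ... | isL i | isʳ j = inL≢inR Γ ((A ⊗ B) ∷ Δ) (trans (sym (ten₁-L Γ Δ A B i)) (trans e (ten₂-B Γ Δ A B j)))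
      ... | isL i | isˡ j = inL≢inR Γ ((A ⊗ B) ∷ Δ) (trans (sym (ten₁-L Γ Δ A B i)) (trans e (ten₂-R Γ Δ A B j)))
      ... | isR i | isʳ j = A≢B (trans (sym (ten₁-A Γ Δ A B i)) (trans e (ten₂-B Γ Δ A B j)))
      ... | isR i | isˡ j = R≢A (trans (sym (ten₂-R Γ Δ A B j)) (trans (sym e) (ten₁-A Γ Δ A B i)))

    ten-matching : Matching ⟦ Γ ++ A ∷ [] ⟧ᶜ (proj₁ M₁) → Matching ⟦ B ∷ Δ ⟧ᶜ (proj₁ M₂) →
                   Matching ⟦ Γ ++ (A ⊗ B) ∷ Δ ⟧ᶜ (proj₁ (union (ren t₁ M₁) (ren t₂ M₂)))
    ten-matching h₁ h₂ b v = trans (union-cnt FinP._≟_ FinP._≟_ FinP._≟_ t₁ t₂ b v M₁ M₂) (go (splitT Γ Δ A B v))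
      where
      X = ⟦ Γ ++ (A ⊗ B) ∷ Δ ⟧ᶜ
      Goal : Fin (size X) → Set
      Goal v = F.cnt v (map t₁ (ends b (proj₁ M₁))) + F.cnt v (map t₂ (ends b (proj₁ M₂))) ≡ b2n (own b (left X v))
      via₁ : ∀ u → left X (t₁ u) ≡ left ⟦ Γ ++ A ∷ [] ⟧ᶜ u → Goal (t₁ u)
      via₁ u l = trans (cong₂ _+_ (trans (cnt-map FinP._≟_ FinP._≟_ t₁ t₁-injective u (ends b (proj₁ M₁))) (h₁ b u))
                                 (cnt-map-∉ FinP._≟_ t₂ (λ w e → t₁≢t₂ u w (sym e)) (ends b (proj₁ M₂))))
                 (trans (NatP.+-identityʳ _) (cong (b2n ∘ own b) (sym l)))
      via₂ : ∀ u → left X (t₂ u) ≡ left ⟦ B ∷ Δ ⟧ᶜ u → Goal (t₂ u)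
      via₂ u l = trans (cong₂ _+_ (cnt-map-∉ FinP._≟_ t₁ (λ w e → t₁≢t₂ w u e) (ends b (proj₁ M₁)))
                                 (trans (cnt-map FinP._≟_ FinP._≟_ t₂ t₂-injective u (ends b (proj₁ M₂))) (h₂ b u)))
                 (cong (b2n ∘ own b) (sym l))
      go : ∀ {v} → SplitT Γ Δ A B v → Goal v
      go (t-L i) = subst Goal (ten₁-L Γ Δ A B i) (via₁ _ (trans (cong (left X) (ten₁-L Γ Δ A B i))
                     (trans (left-inL Γ ((A ⊗ B) ∷ Δ) i) (sym (left-inL Γ (A ∷ []) i)))))
      go (t-A i) = subst Goal (ten₁-A Γ Δ A B i) (via₁ _ (trans (cong (left X) (ten₁-A Γ Δ A B i))
                     (trans (left-inR Γ ((A ⊗ B) ∷ Δ) _) (trans (left-⊗ʳ ⟦ Δ ⟧ᶜ ⟦ A ⊗ B ⟧ _) (trans (left-⊗ˡ ⟦ A ⟧ ⟦ B ⟧ i) (sym (left-inR Γ (A ∷ []) i)))))))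
      go (t-B j) = subst Goal (ten₂-B Γ Δ A B j) (via₂ _ (trans (cong (left X) (ten₂-B Γ Δ A B j))
                     (trans (left-inR Γ ((A ⊗ B) ∷ Δ) _) (trans (left-⊗ʳ ⟦ Δ ⟧ᶜ ⟦ A ⊗ B ⟧ _) (trans (left-⊗ʳ ⟦ A ⟧ ⟦ B ⟧ j) (sym (left-⊗ʳ ⟦ Δ ⟧ᶜ ⟦ B ⟧ j)))))))
      go (t-R u) = subst Goal (ten₂-R Γ Δ A B u) (via₂ _ (trans (cong (left X) (ten₂-R Γ Δ A B u))
                     (trans (left-inR Γ ((A ⊗ B) ∷ Δ) _) (trans (left-⊗ˡ ⟦ Δ ⟧ᶜ ⟦ A ⊗ B ⟧ u) (sym (left-⊗ˡ ⟦ Δ ⟧ᶜ ⟦ B ⟧ u))))))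

  module _ (lex-matching : ∀ e → e ∈ Lex → Matching ⟦ Entry.seq e ⟧ᶜ (edges (Entry.mw e))) where

    interp-matching : ∀ {Γ} (d : Deriv Γ) → Matching ⟦ Γ ⟧ᶜ (proj₁ (interp d))
    interp-matching (lex e i) = lex-matching e i
    interp-matching (idR A) = id-matching A
    interp-matching (cut {Γ} {Δ} A d₁ d₂) = CutGlue.cut-matching {Γ} {Δ} A (interp d₁) (interp d₂) (interp-matching d₁) (interp-matching d₂)
    interp-matching (exR Γ {Δ} A B d) =
      ren-matching (exF Γ Δ A B) (exF Γ Δ B A)
        (λ {u} {v} e → trans (sym (exF-involutive Γ Δ A B u)) (trans (cong (exF Γ Δ B A) e) (exF-involutive Γ Δ A B v)))
        (exF-involutive Γ Δ B A) (exF-left Γ Δ A B) {interp d} (interp-matching d)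
    interp-matching (parR Γ A B d) =
      ren-matching (parF Γ A B) (cast (sym (parEq Γ A B))) (cast-injective (parEq Γ A B)) (cast-cast⁻ (parEq Γ A B))
        (parF-left Γ A B) {interp d} (interp-matching d)
    interp-matching (tenR Γ {Δ} A B d₁ d₂) = ten-matching Γ Δ A B (interp d₁) (interp d₂) (interp-matching d₁) (interp-matching d₂)

-- Derivations as relations

module Reading (T : Set) (n : ℕ) (litBd : Fin n → Bd) (D : Set) where
  open RuleMaps T n litBd

  RL : Set
  RL = Σ (Fin n) λ P → Vec D (size (litBd P))

  -- A negative literal reads its values backwards because its boundary is reversed. Equal values at
  -- mirrored vertices then give formulas that are dual on the nose, see `rf-dual`.
  rf : ∀ A → (Fin ∣ A ∣ → D) → Fml RL
  rf (pos P) x = pos (P , Vec.tabulate x)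
  rf (neg P) x = neg (P , Vec.tabulate (x ∘ opposite))
  rf (A ⊗ B) x = rf A (x ∘ (_↑ˡ ∣ B ∣)) ⊗ rf B (x ∘ (∣ A ∣ ↑ʳ_))
  rf (A ⅋ B) x = rf A (x ∘ inPA A B) ⅋ rf B (x ∘ inPB A B)

  rf-cong : ∀ A {x y : Fin ∣ A ∣ → D} → (∀ i → x i ≡ y i) → rf A x ≡ rf A y
  rf-cong (pos P) h = cong (λ v → pos (P , v)) (VecP.tabulate-cong h)
  rf-cong (neg P) h = cong (λ v → neg (P , v)) (VecP.tabulate-cong (h ∘ opposite))
  rf-cong (A ⊗ B) h = cong₂ _⊗_ (rf-cong A (h ∘ (_↑ˡ ∣ B ∣))) (rf-cong B (h ∘ (∣ A ∣ ↑ʳ_)))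
  rf-cong (A ⅋ B) h = cong₂ _⅋_ (rf-cong A (h ∘ inPA A B)) (rf-cong B (h ∘ inPB A B))

  rf-dual : ∀ A {x : Fin ∣ A ∣ → D} {y : Fin ∣ A ⁻ ∣ → D} → (∀ i j → Mirror i j → x i ≡ y j) → rf (A ⁻) y ≡ rf A x ᵈ
  rf-dual (pos P) h = cong (λ v → neg (P , v)) (VecP.tabulate-cong λ i → sym (h i (opposite i) (opposite-mirror i)))
  rf-dual (neg P) h = cong (λ v → pos (P , v)) (VecP.tabulate-cong λ i →
    sym (h (opposite i) i (trans (cong suc (NatP.+-comm (toℕ (opposite i)) (toℕ i))) (opposite-mirror i))))
  rf-dual (A ⊗ B) h = cong₂ _⅋_ (rf-dual A λ i j e → h _ _ (mirror-⊗ˡ A B e)) (rf-dual B λ i j e → h _ _ (mirror-⊗ʳ A B e))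
  rf-dual (A ⅋ B) h = cong₂ _⊗_ (rf-dual A λ i j e → h _ _ (mirror-⅋ˡ A B e)) (rf-dual B λ i j e → h _ _ (mirror-⅋ʳ A B e))

  er : Fml RL → Fm n
  er (pos l) = pos (proj₁ l)
  er (neg l) = neg (proj₁ l)
  er (a ⊗ b) = er a ⊗ er b
  er (a ⅋ b) = er a ⅋ er b

  er-rf : ∀ A x → er (rf A x) ≡ A
  er-rf (pos P) x = refl
  er-rf (neg P) x = refl
  er-rf (A ⊗ B) x = cong₂ _⊗_ (er-rf A _) (er-rf B _)
  er-rf (A ⅋ B) x = cong₂ _⅋_ (er-rf A _) (er-rf B _)

  rfc : ∀ Γ → (Fin (sz Γ) → D) → List (Fml RL)
  rfc []      x = []
  rfc (A ∷ Γ) x = rf A (x ∘ (sz Γ ↑ʳ_)) ∷ rfc Γ (x ∘ (_↑ˡ ∣ A ∣))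

  rfc-cong : ∀ Γ {x y : Fin (sz Γ) → D} → (∀ i → x i ≡ y i) → rfc Γ x ≡ rfc Γ y
  rfc-cong [] h = refl
  rfc-cong (A ∷ Γ) h = cong₂ _∷_ (rf-cong A (h ∘ (sz Γ ↑ʳ_))) (rfc-cong Γ (h ∘ (_↑ˡ ∣ A ∣)))

  rfc-++ : ∀ Γ Δ x → rfc (Γ ++ Δ) x ≡ rfc Γ (x ∘ inL Γ Δ) ++ rfc Δ (x ∘ inR Γ Δ)
  rfc-++ [] Δ x = rfc-cong Δ λ i → cong x (sym (FinP.toℕ-injective (toℕ-inR [] Δ i)))
  rfc-++ (A ∷ Γ) Δ x = cong₂ _∷_
    (rf-cong A λ i → cong x (sym (inL-head A Γ Δ i)))
    (trans (rfc-++ Γ Δ (x ∘ (_↑ˡ ∣ A ∣)))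
      (cong₂ _++_ (rfc-cong Γ λ i → cong x (sym (inL-tail A Γ Δ i))) (rfc-cong Δ λ i → cong x (sym (inR-tail A Γ Δ i)))))

  rfc-length : ∀ Γ x → length (rfc Γ x) ≡ length Γ
  rfc-length [] x = refl
  rfc-length (A ∷ Γ) x = cong suc (rfc-length Γ _)

module Relational (T : Set) (n : ℕ) (litBd : Fin n → Bd) (Lex : List (LL.Entry T n litBd)) (𝓐 : Action T) where
  open DerivationMatching T n litBd Lex public
  open Action 𝓐
  open Sat 𝓐 public
  open Reading T n litBd D public

  -- The solutions of interp d, read as refined sequents; the values at the vertices of a cut
  -- are quantified existentially.
  Rel : ∀ {Γ} → Deriv Γ → List (Fml RL) → Set
  Rel (lex e _) Θ = ∃ λ x → Θ ≡ rfc (Entry.seq e) x × sat x (edges (Entry.mw e))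
  Rel (idR A) Θ = ∃ λ a → er a ≡ A × Θ ≡ a ᵈ ∷ a ∷ []
  Rel (cut A d₁ d₂) Θ = ∃ λ Θ₁ → ∃ λ Θ₂ → ∃ λ a → Θ ≡ Θ₁ ++ Θ₂ × Rel d₁ (Θ₁ ++ a ∷ []) × Rel d₂ (a ᵈ ∷ Θ₂)
  Rel (exR Γ A B d) Θ = ∃ λ Θ₁ → ∃ λ a → ∃ λ b → ∃ λ Θ₂ →
    Θ ≡ Θ₁ ++ b ∷ a ∷ Θ₂ × length Θ₁ ≡ length Γ × Rel d (Θ₁ ++ a ∷ b ∷ Θ₂)
  Rel (parR Γ A B d) Θ = ∃ λ Θ₁ → ∃ λ a → ∃ λ b → Θ ≡ Θ₁ ++ (a ⅋ b) ∷ [] × Rel d (Θ₁ ++ a ∷ b ∷ [])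
  Rel (tenR Γ A B d₁ d₂) Θ = ∃ λ Θ₁ → ∃ λ a → ∃ λ b → ∃ λ Θ₂ →
    Θ ≡ Θ₁ ++ (a ⊗ b) ∷ Θ₂ × Rel d₁ (Θ₁ ++ a ∷ []) × Rel d₂ (b ∷ Θ₂)

  length-last : ∀ {A B : Set} (xs : List A) (ys : List B) {x y} → length (xs ++ x ∷ []) ≡ length (ys ++ y ∷ []) → length xs ≡ length ys
  length-last xs ys e = NatP.+-cancelʳ-≡ 1 (length xs) (length ys) (trans (sym (length-++ xs)) (trans e (length-++ ys)))

  length-cons : ∀ {A B : Set} (xs xs' : List A) (ys ys' : List B) → length xs ≡ length ys → length xs' ≡ length ys' →
                length (xs ++ xs') ≡ length (ys ++ ys')
  length-cons xs xs' ys ys' e e' = trans (length-++ xs) (trans (cong₂ _+_ e e') (sym (length-++ ys)))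

  Rel-length : ∀ {Γ} (d : Deriv Γ) {Θ} → Rel d Θ → length Θ ≡ length Γ
  Rel-length (lex e i) (x , refl , _) = rfc-length (Entry.seq e) x
  Rel-length (idR A) (a , _ , refl) = refl
  Rel-length (cut {Γ} {Δ} A d₁ d₂) (Θ₁ , Θ₂ , a , refl , r₁ , r₂) =
    length-cons Θ₁ Θ₂ Γ Δ (length-last Θ₁ Γ (Rel-length d₁ r₁)) (NatP.suc-injective (Rel-length d₂ r₂))
  Rel-length (exR Γ {Δ} A B d) (Θ₁ , a , b , Θ₂ , refl , _ , r) =
    trans (length-++ Θ₁) (trans (sym (length-++ Θ₁)) (trans (Rel-length d r) (trans (length-++ Γ) (sym (length-++ Γ)))))
  Rel-length (parR Γ A B d) (Θ₁ , a , b , refl , r) =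
    length-cons Θ₁ _ Γ _ (NatP.+-cancelʳ-≡ 2 (length Θ₁) (length Γ) (trans (sym (length-++ Θ₁)) (trans (Rel-length d r) (length-++ Γ)))) refl
  Rel-length (tenR Γ {Δ} A B d₁ d₂) (Θ₁ , a , b , Θ₂ , refl , r₁ , r₂) =
    length-cons Θ₁ _ Γ _ (length-last Θ₁ Γ (Rel-length d₁ r₁)) (Rel-length d₂ r₂)

  sat-ren : ∀ {U V : Set} (f : U → V) {x : V → D} (M : RawMW T U) → sat x (proj₁ (ren f M)) → sat (x ∘ f) (proj₁ M)
  sat-ren f M h = AllP.map⁻ h

  id-rel : ∀ A x → sat x (map (idEdge A) (allFin ∣ A ∣)) → rfc ((A ⁻) ∷ A ∷ []) x ≡ rf A (x ∘ (_↑ˡ ∣ A ⁻ ∣)) ᵈ ∷ rf A (x ∘ (_↑ˡ ∣ A ⁻ ∣)) ∷ []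
  id-rel A x h = cong (_∷ rf A (x ∘ (_↑ˡ ∣ A ⁻ ∣)) ∷ [])
    (rf-dual A λ i j e → trans (eq i) (cong (x ∘ (∣ A ∣ ↑ʳ_)) (mirror⇒dual A e)))
    where
    eq : ∀ i → x (i ↑ˡ ∣ A ⁻ ∣) ≡ x (∣ A ∣ ↑ʳ dual A i)
    eq i with All.lookup (AllP.map⁻ h) (∈-allFin i)
    ... | q with left ⟦ A ⟧ i
    ...   | true = W-nil q
    ...   | false = sym (W-nil q)

  module _ (lex-matching : ∀ e → e ∈ Lex → Matching ⟦ Entry.seq e ⟧ᶜ (edges (Entry.mw e))) where

    cut-split : ∀ {Γ Δ} A (M₁ : RawMW T (Fin (sz (Γ ++ A ∷ [])))) (M₂ : RawMW T (Fin (sz ((A ⁻) ∷ Δ)))) →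
      ∀ (x : Fin (sz Δ + sz Γ) ⊎ Fin ∣ A ∣ → D) → sat x (proj₁ (CutGlue.joined {Γ} {Δ} A M₁ M₂)) →
      let a = rf A (x ∘ inj₂) ; Θ₁ = rfc Γ (x ∘ inj₁ ∘ (sz Δ ↑ʳ_)) ; Θ₂ = rfc Δ (x ∘ inj₁ ∘ (_↑ˡ sz Γ)) in
      (sat (x ∘ cut₁ Γ Δ A) (proj₁ M₁) × rfc (Γ ++ A ∷ []) (x ∘ cut₁ Γ Δ A) ≡ Θ₁ ++ a ∷ []) ×
      (sat (x ∘ cut₂ Γ Δ A) (proj₁ M₂) × rfc ((A ⁻) ∷ Δ) (x ∘ cut₂ Γ Δ A) ≡ a ᵈ ∷ Θ₂)
    cut-split {Γ} {Δ} A M₁ M₂ x h =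
      (sat-ren (cut₁ Γ Δ A) M₁ (AllP.++⁻ˡ _ h)
      , trans (rfc-++ Γ (A ∷ []) _)
          (cong₂ _++_ (rfc-cong Γ λ i → cong x (cut₁-L Γ Δ A i)) (cong (_∷ []) (rf-cong A λ i → cong x (cut₁-A Γ Δ A i)))))
      , (sat-ren (cut₂ Γ Δ A) M₂ (AllP.++⁻ʳ (proj₁ (ren (cut₁ Γ Δ A) M₁)) h)
      , cong₂ _∷_ (rf-dual A λ i j e → cong x (sym (trans (cong (cut₂ Γ Δ A ∘ (sz Δ ↑ʳ_)) (sym (mirror⇒dual A e))) (cut₂-A Γ Δ A i))))
          (rfc-cong Δ λ u → cong x (cut₂-R Γ Δ A u)))

    cut-back : ∀ {Γ Δ} A (M₁ : RawMW T (Fin (sz (Γ ++ A ∷ [])))) (M₂ : RawMW T (Fin (sz ((A ⁻) ∷ Δ)))) →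
      Matching ⟦ Γ ++ A ∷ [] ⟧ᶜ (proj₁ M₁) → Matching ⟦ (A ⁻) ∷ Δ ⟧ᶜ (proj₁ M₂) →
      proj₂ (CutGlue.glued {Γ} {Δ} A M₁ M₂) ≡ [] → ∀ x → sat x (proj₁ (CutGlue.result {Γ} {Δ} A M₁ M₂)) →
      ∃ λ x' → sat x' (proj₁ (CutGlue.joined {Γ} {Δ} A M₁ M₂)) × (∀ v → x' (inj₁ v) ≡ x (cast (sym (sz++ Γ Δ)) v))
    cut-back {Γ} {Δ} A M₁ M₂ h₁ h₂ nc x h =
      let (x' , s , e) = back 𝓐 (allFin ∣ A ∣) (allFin⁺ ∣ A ∣) (joined-contracted h₁ h₂) (inj₁ nc) x₀
                           (outer-sat 𝓐 (proj₁ glued) (inner-absent h₁ h₂) x₀ (sat-ren (cast (sym (sz++ Γ Δ))) (mapMaybe outer (proj₁ glued) , []) h)) in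
      x' , s , outer≡ e
      where
      open CutGlue {Γ} {Δ} A M₁ M₂
      x₀ : Fin (sz Δ + sz Γ) ⊎ Fin ∣ A ∣ → D
      x₀ (inj₁ v) = x (cast (sym (sz++ Γ Δ)) v)
      -- After gluing no edge touches a cut vertex; `back` supplies the actual values.
      x₀ (inj₂ _) = default

    contract-cycles : ∀ {a b} (k : Fin b) (M : RawMW T (Fin a ⊎ Fin b)) →
                      (∀ b' → cntE b' (inj₂ k) M ≡ 1) → proj₂ (contract k M) ≡ [] → proj₂ M ≡ []
    contract-cycles k M h e with contract k M | contraction k (proj₁ M) (proj₂ M) h
    contract-cycles k M h () | _ | loop w rest p
    contract-cycles k M h e | _ | path i w w' j rest n p = e

    -- Contraction never removes a cycle, so the premises of an acyclic cut are acyclic.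
    fold-cycles : ∀ {a b s} {M : RawMW T (Fin a ⊎ Fin b)} ks → Unique ks →
                  Contracted s [] M → proj₂ (foldr contract M ks) ≡ [] → proj₂ M ≡ []
    fold-cycles [] u c e = e
    fold-cycles {M = M} (k ∷ ks) (p ∷ u) c e = fold-cycles ks u c
      (contract-cycles k (foldr contract M ks) (λ b' → inner1 (contracted ks u c) b' λ i → All.lookup p i refl) e)

    -- At a cut, `cut-back` finds values for the cut vertices, and `cut-split` reads them in the two
    -- premises as one formula and its dual.
    sat⇒Rel : ∀ {Γ} (d : Deriv Γ) → proj₂ (interp d) ≡ [] → ∀ x → sat x (proj₁ (interp d)) → Rel d (rfc Γ x)
    sat⇒Rel (lex e i) nc x h = x , refl , h
    sat⇒Rel (idR A) nc x h = rf A (x ∘ (_↑ˡ ∣ A ⁻ ∣)) , er-rf A _ , id-rel A x h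
    sat⇒Rel (cut {Γ} {Δ} A d₁ d₂) nc x h
      with fold-cycles (allFin ∣ A ∣) (allFin⁺ ∣ A ∣) (CutGlue.joined-contracted {Γ} {Δ} A (interp d₁) (interp d₂) m₁ m₂) nc
         | cut-back {Γ} {Δ} A (interp d₁) (interp d₂) m₁ m₂ nc x h
      where
      m₁ = interp-matching lex-matching d₁
      m₂ = interp-matching lex-matching d₂
    ... | nc' | x' , s , e with cut-split {Γ} {Δ} A (interp d₁) (interp d₂) x' s
    ... | (s₁ , e₁) , (s₂ , e₂) =
      _ , _ , rf A (x' ∘ inj₂)
      , trans (rfc-++ Γ Δ x) (cong₂ _++_ (rfc-cong Γ λ i → sym (e _)) (rfc-cong Δ λ i → sym (e _)))
      , subst (Rel d₁) e₁ (sat⇒Rel d₁ (++-conicalˡ _ _ nc') _ s₁)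
      , subst (Rel d₂) e₂ (sat⇒Rel d₂ (++-conicalʳ (proj₂ (interp d₁)) _ nc') _ s₂)
    sat⇒Rel (exR Γ {Δ} A B d) nc x h =
      rfc Γ (x ∘ inL Γ (B ∷ A ∷ Δ)) , rf A (x ∘ posB Γ Δ B A) , rf B (x ∘ posA Γ Δ B A) , rfc Δ (x ∘ posR Γ Δ B A)
      , rfc-++ Γ (B ∷ A ∷ Δ) x
      , rfc-length Γ _
      , subst (Rel d) (trans (rfc-++ Γ (A ∷ B ∷ Δ) _)
          (cong₂ _++_ (rfc-cong Γ λ i → cong x (exF-L Γ Δ A B i))
            (cong₂ _∷_ (rf-cong A λ i → cong x (exF-A Γ Δ A B i))
              (cong₂ _∷_ (rf-cong B λ i → cong x (exF-B Γ Δ A B i)) (rfc-cong Δ λ i → cong x (exF-R Γ Δ A B i))))))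
          (sat⇒Rel d nc (x ∘ exF Γ Δ A B) (sat-ren (exF Γ Δ A B) (interp d) h))
    sat⇒Rel (parR Γ A B d) nc x h =
      rfc Γ (x ∘ inL Γ ((A ⅋ B) ∷ [])) , rf A (x ∘ inR Γ ((A ⅋ B) ∷ []) ∘ inPA A B) , rf B (x ∘ inR Γ ((A ⅋ B) ∷ []) ∘ inPB A B)
      , rfc-++ Γ ((A ⅋ B) ∷ []) x
      , subst (Rel d) (trans (rfc-++ Γ (A ∷ B ∷ []) _)
          (cong₂ _++_ (rfc-cong Γ λ i → cong x (parF-L Γ A B i))
            (cong₂ (λ a b → a ∷ b ∷ []) (rf-cong A λ i → cong x (parF-A Γ A B i)) (rf-cong B λ i → cong x (parF-B Γ A B i)))))
          (sat⇒Rel d nc (x ∘ parF Γ A B) (sat-ren (parF Γ A B) (interp d) h))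
    sat⇒Rel (tenR Γ {Δ} A B d₁ d₂) nc x h =
      rfc Γ (x ∘ inL Γ ((A ⊗ B) ∷ Δ)) , rf A (x ∘ ten-A Γ Δ A B) , rf B (x ∘ ten-B Γ Δ A B) , rfc Δ (x ∘ ten-R Γ Δ A B)
      , rfc-++ Γ ((A ⊗ B) ∷ Δ) x
      , subst (Rel d₁) (trans (rfc-++ Γ (A ∷ []) _)
          (cong₂ _++_ (rfc-cong Γ λ i → cong x (ten₁-L Γ Δ A B i)) (cong (_∷ []) (rf-cong A λ i → cong x (ten₁-A Γ Δ A B i)))))
          (sat⇒Rel d₁ (++-conicalˡ _ _ nc) (x ∘ ten₁ Γ Δ A B) (sat-ren (ten₁ Γ Δ A B) (interp d₁) (AllP.++⁻ˡ _ h)))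
      , subst (Rel d₂) (cong₂ _∷_ (rf-cong B λ i → cong x (ten₂-B Γ Δ A B i)) (rfc-cong Δ λ i → cong x (ten₂-R Γ Δ A B i)))
          (sat⇒Rel d₂ (++-conicalʳ (proj₂ (interp d₁)) _ nc) (x ∘ ten₂ Γ Δ A B)
            (sat-ren (ten₂ Γ Δ A B) (interp d₂) (AllP.++⁻ʳ (proj₁ (ren (ten₁ Γ Δ A B) (interp d₁))) h)))

-- Coherence and acyclicity

-- the three cases of the relation between two points of a coherence space:
-- strictly incoherent, equal, strictly coherent
data Sign : Set where
  minus null plus : Sign

infixr 6 _⅋₃_ _⊗₃_
-- As in the par of coherence spaces, strict coherence of one component suffices, while equality
-- requires both.
_⅋₃_ : Sign → Sign → Sign
plus  ⅋₃ t     = plus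
null  ⅋₃ t     = t
minus ⅋₃ plus  = plus
minus ⅋₃ t     = minus

opp : Sign → Sign
opp minus = plus
opp null  = null
opp plus  = minus

_⊗₃_ : Sign → Sign → Sign
minus ⊗₃ t     = minus
null  ⊗₃ t     = t
plus  ⊗₃ minus = minus
plus  ⊗₃ t     = plus

opp-⅋ : ∀ s t → opp (s ⅋₃ t) ≡ opp s ⊗₃ opp t
opp-⅋ minus minus = refl
opp-⅋ minus null  = refl
opp-⅋ minus plus  = refl
opp-⅋ null  t     = refl
opp-⅋ plus  t     = refl

opp-⊗ : ∀ s t → opp (s ⊗₃ t) ≡ opp s ⅋₃ opp t
opp-⊗ plus  minus = refl
opp-⊗ plus  null  = refl
opp-⊗ plus  plus  = refl
opp-⊗ null  t     = refl
opp-⊗ minus t     = refl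

⅋₃-assoc : ∀ s t u → (s ⅋₃ t) ⅋₃ u ≡ s ⅋₃ (t ⅋₃ u)
⅋₃-assoc plus t u = refl
⅋₃-assoc null t u = refl
⅋₃-assoc minus plus u = refl
⅋₃-assoc minus null u = refl
⅋₃-assoc minus minus plus = refl
⅋₃-assoc minus minus null = refl
⅋₃-assoc minus minus minus = refl

⅋₃-comm : ∀ s t → s ⅋₃ t ≡ t ⅋₃ s
⅋₃-comm plus plus = refl
⅋₃-comm plus null = refl
⅋₃-comm plus minus = refl
⅋₃-comm null plus = refl
⅋₃-comm null null = refl
⅋₃-comm null minus = refl
⅋₃-comm minus plus = refl
⅋₃-comm minus null = refl
⅋₃-comm minus minus = refl

⅋₃-null : ∀ s → s ⅋₃ null ≡ s
⅋₃-null s = ⅋₃-comm s null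

⅋₃-≡null : ∀ s t → s ⅋₃ t ≡ null → s ≡ null × t ≡ null
⅋₃-≡null null t e = refl , e
⅋₃-≡null minus null ()
⅋₃-≡null minus plus ()
⅋₃-≡null minus minus ()

⊗₃-≡null : ∀ s t → s ⊗₃ t ≡ null → s ≡ null × t ≡ null
⊗₃-≡null null t e = refl , e
⊗₃-≡null plus null ()
⊗₃-≡null plus minus ()
⊗₃-≡null plus plus ()

opp-≡null : ∀ s → opp s ≡ null → s ≡ null
opp-≡null null e = refl

Coh : Sign → Set
Coh s = s ≢ minus

coh-id : ∀ s → Coh (opp s ⅋₃ s)
coh-id minus ()
coh-id null ()
coh-id plus ()

coh-cut : ∀ g c d → Coh (g ⅋₃ c) → Coh (opp c ⅋₃ d) → Coh (g ⅋₃ d)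
coh-cut plus c d p q = λ ()
coh-cut null minus d p q = ⊥-elim (p refl)
coh-cut null null d p q = q
coh-cut null plus plus p q = λ ()
coh-cut null plus null p q = λ ()
coh-cut null plus minus p q = q
coh-cut minus minus d p q = ⊥-elim (p refl)
coh-cut minus null d p q = ⊥-elim (p refl)
coh-cut minus plus plus p q = λ ()
coh-cut minus plus null p q = ⊥-elim (q refl)
coh-cut minus plus minus p q = ⊥-elim (q refl)

coh-ten : ∀ g a b d → Coh (g ⅋₃ a) → Coh (b ⅋₃ d) → Coh (g ⅋₃ (a ⊗₃ b) ⅋₃ d)
coh-ten plus a b d p q = λ ()
coh-ten null minus b d p q = ⊥-elim (p refl)
coh-ten null null b d p q = q
coh-ten null plus minus plus p q = λ ()
coh-ten null plus minus null p q = ⊥-elim (q refl)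
coh-ten null plus minus minus p q = ⊥-elim (q refl)
coh-ten null plus null d p q = λ ()
coh-ten null plus plus d p q = λ ()
coh-ten minus minus b d p q = ⊥-elim (p refl)
coh-ten minus null b d p q = ⊥-elim (p refl)
coh-ten minus plus minus plus p q = λ ()
coh-ten minus plus minus null p q = ⊥-elim (q refl)
coh-ten minus plus minus minus p q = ⊥-elim (q refl)
coh-ten minus plus null d p q = λ ()
coh-ten minus plus plus d p q = λ ()

module Coherence {L : Set} (k : L → L → Sign) where

  -- (null on formulas of different shape)
  coh : Fml L → Fml L → Sign
  coh (pos l) (pos l') = k l l'
  coh (neg l) (neg l') = opp (k l l')
  coh (a ⊗ b) (a' ⊗ b') = coh a a' ⊗₃ coh b b'
  coh (a ⅋ b) (a' ⅋ b') = coh a a' ⅋₃ coh b b'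
  coh _ _ = null

  opp-opp : ∀ s → s ≡ opp (opp s)
  opp-opp minus = refl
  opp-opp null = refl
  opp-opp plus = refl

  coh-dual : ∀ a a' → coh (a ᵈ) (a' ᵈ) ≡ opp (coh a a')
  coh-dual (pos l) (pos l') = refl
  coh-dual (neg l) (neg l') = opp-opp _
  coh-dual (a ⊗ b) (a' ⊗ b') = trans (cong₂ _⅋₃_ (coh-dual a a') (coh-dual b b')) (sym (opp-⊗ (coh a a') (coh b b')))
  coh-dual (a ⅋ b) (a' ⅋ b') = trans (cong₂ _⊗₃_ (coh-dual a a') (coh-dual b b')) (sym (opp-⅋ (coh a a') (coh b b')))
  coh-dual (pos _) (neg _) = refl
  coh-dual (pos _) (_ ⊗ _) = refl
  coh-dual (pos _) (_ ⅋ _) = refl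
  coh-dual (neg _) (pos _) = refl
  coh-dual (neg _) (_ ⊗ _) = refl
  coh-dual (neg _) (_ ⅋ _) = refl
  coh-dual (_ ⊗ _) (pos _) = refl
  coh-dual (_ ⊗ _) (neg _) = refl
  coh-dual (_ ⊗ _) (_ ⅋ _) = refl
  coh-dual (_ ⅋ _) (pos _) = refl
  coh-dual (_ ⅋ _) (neg _) = refl
  coh-dual (_ ⅋ _) (_ ⊗ _) = refl

  cohs : List (Fml L) → List (Fml L) → Sign
  cohs (a ∷ Θ) (a' ∷ Θ') = coh a a' ⅋₃ cohs Θ Θ'
  cohs _ _ = null

  cohs-++ : ∀ Θ Θ' {Ξ Ξ'} → length Θ ≡ length Θ' → cohs (Θ ++ Ξ) (Θ' ++ Ξ') ≡ cohs Θ Θ' ⅋₃ cohs Ξ Ξ'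
  cohs-++ [] [] e = refl
  cohs-++ (a ∷ Θ) (a' ∷ Θ') e =
    trans (cong (coh a a' ⅋₃_) (cohs-++ Θ Θ' (NatP.suc-injective e))) (sym (⅋₃-assoc (coh a a') (cohs Θ Θ') _))

  module _ (k-refl : ∀ l → k l l ≡ null) where
    coh-refl : ∀ a → coh a a ≡ null
    coh-refl (pos l) = k-refl l
    coh-refl (neg l) rewrite k-refl l = refl
    coh-refl (a ⊗ b) rewrite coh-refl a | coh-refl b = refl
    coh-refl (a ⅋ b) rewrite coh-refl a | coh-refl b = refl

    cohs-refl : ∀ Θ → cohs Θ Θ ≡ null
    cohs-refl [] = refl
    cohs-refl (a ∷ Θ) rewrite coh-refl a = cohs-refl Θ

boolAction : (T : Set) → Action T
boolAction T = record
  { D = Bool ; W = λ _ x y → x ≡ y ; default = true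
  ; W-nil = λ e → e  ; W-split = λ w e → _ , refl , e }

module Acyclic (T : Set) (n : ℕ) (litBd : Fin n → Bd) (Lex : List (LL.Entry T n litBd)) where
  open Relational T n litBd Lex (boolAction T)

  module _ (k : RL → RL → Sign) (k-refl : ∀ l → k l l ≡ null) (k-null : ∀ {P v v'} → k (P , v) (P , v') ≡ null → v ≡ v')
           (lex-matching : ∀ e → e ∈ Lex → Matching ⟦ Entry.seq e ⟧ᶜ (edges (Entry.mw e)))
           (lex-acyclic : ∀ e → e ∈ Lex → cycles (Entry.mw e) ≡ []) where
    open Coherence k

    module _ (lex-coh : ∀ e → e ∈ Lex → ∀ x x' → sat x (edges (Entry.mw e)) → sat x' (edges (Entry.mw e)) →
               Coh (cohs (rfc (Entry.seq e) x) (rfc (Entry.seq e) x'))) where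

      -- Each rule preserves cliques by the corresponding fact on signs. Lengths align the contexts
      -- of the two solutions, which is why `Rel` records one for exchange.
      Rel-coh : ∀ {Γ} (d : Deriv Γ) {Θ Θ'} → Rel d Θ → Rel d Θ' → Coh (cohs Θ Θ')
      Rel-coh (lex e i) (x , refl , h) (x' , refl , h') = lex-coh e i x x' h h'
      Rel-coh (idR A) (a , _ , refl) (a' , _ , refl) =
        subst Coh (cong₂ _⅋₃_ (sym (coh-dual a a')) (sym (⅋₃-null (coh a a')))) (coh-id (coh a a'))
      Rel-coh (cut {Γ} {Δ} A d₁ d₂) (Θ₁ , Θ₂ , a , refl , r₁ , r₂) (Θ₁' , Θ₂' , a' , refl , r₁' , r₂') =
        subst Coh (sym (cohs-++ Θ₁ Θ₁' le))
          (coh-cut (cohs Θ₁ Θ₁') (coh a a') (cohs Θ₂ Θ₂')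
            (subst Coh (trans (cohs-++ Θ₁ Θ₁' le) (cong (cohs Θ₁ Θ₁' ⅋₃_) (⅋₃-null (coh a a')))) (Rel-coh d₁ r₁ r₁'))
            (subst Coh (cong (_⅋₃ cohs Θ₂ Θ₂') (coh-dual a a')) (Rel-coh d₂ r₂ r₂')))
        where
        le : length Θ₁ ≡ length Θ₁'
        le = trans (length-last Θ₁ Γ (Rel-length d₁ r₁)) (sym (length-last Θ₁' Γ (Rel-length d₁ r₁')))
      Rel-coh (exR Γ A B d) (Θ₁ , a , b , Θ₂ , refl , l , r) (Θ₁' , a' , b' , Θ₂' , refl , l' , r') =
        subst Coh (trans (cohs-++ Θ₁ Θ₁' le) (trans (cong (cohs Θ₁ Θ₁' ⅋₃_) sw) (sym (cohs-++ Θ₁ Θ₁' le)))) (Rel-coh d r r')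
        where
        le : length Θ₁ ≡ length Θ₁'
        le = trans l (sym l')
        sw : coh a a' ⅋₃ coh b b' ⅋₃ cohs Θ₂ Θ₂' ≡ coh b b' ⅋₃ coh a a' ⅋₃ cohs Θ₂ Θ₂'
        sw = trans (sym (⅋₃-assoc (coh a a') (coh b b') _)) (trans (cong (_⅋₃ cohs Θ₂ Θ₂') (⅋₃-comm (coh a a') (coh b b')))
               (⅋₃-assoc (coh b b') (coh a a') _))
      Rel-coh (parR Γ A B d) (Θ₁ , a , b , refl , r) (Θ₁' , a' , b' , refl , r') =
        subst Coh (trans (cohs-++ Θ₁ Θ₁' le) (trans (cong (cohs Θ₁ Θ₁' ⅋₃_) (sym (⅋₃-assoc (coh a a') (coh b b') null))) (sym (cohs-++ Θ₁ Θ₁' le)))) (Rel-coh d r r')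
        where
        le : length Θ₁ ≡ length Θ₁'
        le = NatP.+-cancelʳ-≡ 2 (length Θ₁) (length Θ₁') (trans (sym (length-++ Θ₁)) (trans (Rel-length d r) (trans (sym (Rel-length d r')) (length-++ Θ₁'))))
      Rel-coh (tenR Γ A B d₁ d₂) (Θ₁ , a , b , Θ₂ , refl , r₁ , r₂) (Θ₁' , a' , b' , Θ₂' , refl , r₁' , r₂') =
        subst Coh (sym (cohs-++ Θ₁ Θ₁' le))
          (coh-ten (cohs Θ₁ Θ₁') (coh a a') (coh b b') (cohs Θ₂ Θ₂')
            (subst Coh (trans (cohs-++ Θ₁ Θ₁' le) (cong (cohs Θ₁ Θ₁' ⅋₃_) (⅋₃-null (coh a a')))) (Rel-coh d₁ r₁ r₁'))
            (Rel-coh d₂ r₂ r₂'))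
        where
        le : length Θ₁ ≡ length Θ₁'
        le = trans (length-last Θ₁ Γ (Rel-length d₁ r₁)) (sym (length-last Θ₁' Γ (Rel-length d₁ r₁')))

      -- `k-null` separates values at literals, and either connective is null only if both
      -- components are.
      null⇒≡ : ∀ A {x x' : Fin ∣ A ∣ → Bool} → coh (rf A x) (rf A x') ≡ null → ∀ i → x i ≡ x' i
      null⇒≡ (pos P) {x} {x'} e i = trans (sym (VecP.lookup∘tabulate x i))
        (trans (cong (λ v → Vec.lookup v i) (k-null e)) (VecP.lookup∘tabulate x' i))
      null⇒≡ (neg P) {x} {x'} e i = trans (cong x (sym (opposite-involutive i))) (trans (sym (VecP.lookup∘tabulate (x ∘ opposite) (opposite i)))
        (trans (cong (λ v → Vec.lookup v (opposite i)) (k-null (opp-≡null _ e)))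
          (trans (VecP.lookup∘tabulate (x' ∘ opposite) (opposite i)) (cong x' (opposite-involutive i)))))
        where
        open import Data.Fin using (opposite)
        open import Data.Fin.Properties using (opposite-involutive)
      null⇒≡ (A ⊗ B) {x} {x'} e v
        with ⊗₃-≡null (coh (rf A (x ∘ (_↑ˡ ∣ B ∣))) (rf A (x' ∘ (_↑ˡ ∣ B ∣)))) (coh (rf B (x ∘ (∣ A ∣ ↑ʳ_))) (rf B (x' ∘ (∣ A ∣ ↑ʳ_)))) e
           | splitV ∣ A ∣ v
      ... | p , q | isˡ i = null⇒≡ A {x ∘ (_↑ˡ ∣ B ∣)} {x' ∘ (_↑ˡ ∣ B ∣)} p i
      ... | p , q | isʳ j = null⇒≡ B {x ∘ (∣ A ∣ ↑ʳ_)} {x' ∘ (∣ A ∣ ↑ʳ_)} q j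
      null⇒≡ (A ⅋ B) {x} {x'} e v
        with ⅋₃-≡null (coh (rf A (x ∘ inPA A B)) (rf A (x' ∘ inPA A B))) (coh (rf B (x ∘ inPB A B)) (rf B (x' ∘ inPB A B))) e
           | splitP A B v
      ... | p , q | isA i = null⇒≡ A {x ∘ inPA A B} {x' ∘ inPA A B} p i
      ... | p , q | isB j = null⇒≡ B {x ∘ inPB A B} {x' ∘ inPB A B} q j

      both-coh : ∀ s → Coh s → Coh (opp s) → s ≡ null
      both-coh minus p q = ⊥-elim (p refl)
      both-coh null p q = refl
      both-coh plus p q = ⊥-elim (q refl)

      -- A cycle would give two solutions with the same outer values but different cut formulas `a`
      -- and `a'`. The first premise makes `a` and `a'` coherent, the second makes their duals
      -- coherent, so `both-coh` and `null⇒≡` force equal values.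
      acyclic : ∀ {Γ} (d : Deriv Γ) → proj₂ (interp d) ≡ []
      acyclic (lex e i) = lex-acyclic e i
      acyclic (idR A) = refl
      acyclic (cut {Γ} {Δ} A d₁ d₂) = go (proj₂ (CutGlue.glued {Γ} {Δ} A (interp d₁) (interp d₂))) refl
        where
        m₁ = interp-matching lex-matching d₁
        m₂ = interp-matching lex-matching d₂
        go : ∀ cs → proj₂ (CutGlue.glued {Γ} {Δ} A (interp d₁) (interp d₂)) ≡ cs → cs ≡ []
        go [] e = refl
        go (c ∷ cs) e with cycle-ambiguous (boolAction T) (allFin ∣ A ∣) (allFin⁺ ∣ A ∣)
                             (CutGlue.joined-contracted {Γ} {Δ} A (interp d₁) (interp d₂) m₁ m₂)
                             (λ w x y q → q) (cong₂ _++_ (acyclic d₁) (acyclic d₂)) false (λ ()) (λ q → ∷≢[] (trans (sym e) q))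
          where
          ∷≢[] : c ∷ cs ≢ []
          ∷≢[] ()
        ... | x , x' , i , s , s' , out , inn
            with cut-split lex-matching {Γ} {Δ} A (interp d₁) (interp d₂) x s | cut-split lex-matching {Γ} {Δ} A (interp d₁) (interp d₂) x' s'
        ... | (s₁ , e₁) , (s₂ , e₂) | (s₁' , e₁') , (s₂' , e₂') =
          ⊥-elim (inn (null⇒≡ A (both-coh (coh a a') c₁ c₂) i))
          where
          a = rf A (x ∘ inj₂)
          a' = rf A (x' ∘ inj₂)
          Θ₁ = rfc Γ (x ∘ inj₁ ∘ (sz Δ ↑ʳ_))
          Θ₂ = rfc Δ (x ∘ inj₁ ∘ (_↑ˡ sz Γ))
          r₁ : Rel d₁ (Θ₁ ++ a ∷ [])
          r₁ = subst (Rel d₁) e₁ (sat⇒Rel lex-matching d₁ (acyclic d₁) _ s₁)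
          r₁' : Rel d₁ (Θ₁ ++ a' ∷ [])
          r₁' = subst (Rel d₁) (trans e₁' (cong (_++ a' ∷ []) (rfc-cong Γ λ i → sym (out _)))) (sat⇒Rel lex-matching d₁ (acyclic d₁) _ s₁')
          r₂ : Rel d₂ (a ᵈ ∷ Θ₂)
          r₂ = subst (Rel d₂) e₂ (sat⇒Rel lex-matching d₂ (acyclic d₂) _ s₂)
          r₂' : Rel d₂ (a' ᵈ ∷ Θ₂)
          r₂' = subst (Rel d₂) (trans e₂' (cong (a' ᵈ ∷_) (rfc-cong Δ λ i → sym (out _)))) (sat⇒Rel lex-matching d₂ (acyclic d₂) _ s₂')
          c₁ : Coh (coh a a')
          c₁ = subst Coh (trans (cohs-++ Θ₁ Θ₁ refl) (cong₂ _⅋₃_ (cohs-refl k-refl Θ₁) (⅋₃-null (coh a a')))) (Rel-coh d₁ r₁ r₁')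
          c₂ : Coh (opp (coh a a'))
          c₂ = subst Coh (trans (cong₂ _⅋₃_ (coh-dual a a') (cohs-refl k-refl Θ₂)) (⅋₃-null _)) (Rel-coh d₂ r₂ r₂')
      acyclic (exR Γ A B d) = acyclic d
      acyclic (parR Γ A B d) = acyclic d
      acyclic (tenR Γ A B d₁ d₂) = cong₂ _++_ (acyclic d₁) (acyclic d₂)

-- Typed terms as derivations

infix 25 _⁺ᵗ _⁻ᵗ
mutual
  _⁺ᵗ : ∀ {n} → Ty n → Fm n
  atom p ⁺ᵗ  = pos p
  (A ⊸ B) ⁺ᵗ = (A ⁻ᵗ) ⅋ (B ⁺ᵗ)

  _⁻ᵗ : ∀ {n} → Ty n → Fm n
  atom p ⁻ᵗ  = neg p
  (A ⊸ B) ⁻ᵗ = (A ⁺ᵗ) ⊗ (B ⁻ᵗ)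

mutual
  ⁺ᵗ-dual : ∀ {n} (A : Ty n) → (A ⁺ᵗ) ⁻ ≡ A ⁻ᵗ
  ⁺ᵗ-dual (atom p) = refl
  ⁺ᵗ-dual (A ⊸ B) = cong₂ _⊗_ (⁻ᵗ-dual A) (⁺ᵗ-dual B)

  ⁻ᵗ-dual : ∀ {n} (A : Ty n) → (A ⁻ᵗ) ⁻ ≡ A ⁺ᵗ
  ⁻ᵗ-dual (atom p) = refl
  ⁻ᵗ-dual (A ⊸ B) = cong₂ _⅋_ (⁺ᵗ-dual A) (⁻ᵗ-dual B)

mutual
  ⁺ᶠ-injective : ∀ {L} (a b : STy L) → a ⁺ᶠ ≡ b ⁺ᶠ → a ≡ b
  ⁺ᶠ-injective (at l) (at .l) refl = refl
  ⁺ᶠ-injective (a ⊸ˢ b) (a' ⊸ˢ b') e with ⅋-injective e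
    where
    ⅋-injective : ∀ {L} {x y x' y' : Fml L} → (x ⅋ y) ≡ (x' ⅋ y') → x ≡ x' × y ≡ y'
    ⅋-injective refl = refl , refl
  ... | p , q = cong₂ _⊸ˢ_ (⁻ᶠ-injective a a' p) (⁺ᶠ-injective b b' q)

  ⁻ᶠ-injective : ∀ {L} (a b : STy L) → a ⁻ᶠ ≡ b ⁻ᶠ → a ≡ b
  ⁻ᶠ-injective (at l) (at .l) refl = refl
  ⁻ᶠ-injective (a ⊸ˢ b) (a' ⊸ˢ b') e with ⊗-injective e
    where
    ⊗-injective : ∀ {L} {x y x' y' : Fml L} → (x ⊗ y) ≡ (x' ⊗ y') → x ≡ x' × y ≡ y'
    ⊗-injective refl = refl , refl
  ... | p , q = cong₂ _⊸ˢ_ (⁺ᶠ-injective a a' p) (⁻ᶠ-injective b b' q)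

++-split : ∀ {A : Set} (xs xs' : List A) {ys ys'} → length xs ≡ length xs' → xs ++ ys ≡ xs' ++ ys' → xs ≡ xs' × ys ≡ ys'
++-split [] [] l e = refl , e
++-split (x ∷ xs) (x' ∷ xs') l e with ∷-injective e
... | refl , e' with ++-split xs xs' (NatP.suc-injective l) e'
... | refl , e'' = refl , e''

++-splitʳ : ∀ {A : Set} (xs xs' : List A) {ys ys'} → length ys ≡ length ys' → xs ++ ys ≡ xs' ++ ys' → xs ≡ xs' × ys ≡ ys'
++-splitʳ xs xs' {ys} {ys'} l e = ++-split xs xs'
  (NatP.+-cancelʳ-≡ (length ys) _ _ (trans (sym (length-++ xs)) (trans (cong length e) (trans (length-++ xs') (cong (length xs' +_) (sym l)))))) e

module TypedDerivations (T : Set) (sg : Sig) (litBd : Fin (nAt sg) → Bd) (Lex : List (LL.Entry T (nAt sg) litBd)) where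
  open LL T (nAt sg) litBd
  open Derivations Lex

  castD : ∀ {Γ Γ'} → Γ ≡ Γ' → Deriv Γ → Deriv Γ'
  castD = subst Deriv

  mvL : ∀ Π Δ X E → Deriv (Π ++ Δ ++ X ∷ E) → Deriv (Π ++ X ∷ Δ ++ E)
  mvL Π [] X E d = d
  mvL Π (C ∷ Δ) X E d = exR Π C X (castD (++-assoc Π (C ∷ []) (X ∷ Δ ++ E))
    (mvL (Π ++ C ∷ []) Δ X E (castD (sym (++-assoc Π (C ∷ []) (Δ ++ X ∷ E))) d)))

  mvR : ∀ Π Δ X E → Deriv (Π ++ X ∷ Δ ++ E) → Deriv (Π ++ Δ ++ X ∷ E)
  mvR Π [] X E d = d
  mvR Π (C ∷ Δ) X E d = castD (++-assoc Π (C ∷ []) (Δ ++ X ∷ E))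
    (mvR (Π ++ C ∷ []) Δ X E (castD (sym (++-assoc Π (C ∷ []) (X ∷ Δ ++ E))) (exR Π X C d)))

  nctx : Cx (nAt sg) → List (Fm (nAt sg))
  nctx = map (λ p → proj₂ p ⁻ᵗ)

  identD : ∀ A → Deriv (A ⁻ᵗ ∷ A ⁺ᵗ ∷ [])
  identD A = castD (cong (_∷ A ⁺ᵗ ∷ []) (⁺ᵗ-dual A)) (idR (A ⁺ᵗ))

  module _ (lexD : ∀ c → Deriv (typeOf sg c ⁺ᵗ ∷ [])) where

    -- The left rule of implication, shaped as the right premise of a cut: the tensor joins the
    -- argument with an identity on the result.
    argD : ∀ {Δ} A B → Deriv (Δ ++ A ⁺ᵗ ∷ []) → Deriv (((A ⊸ B) ⁺ᵗ) ⁻ ∷ Δ ++ B ⁺ᵗ ∷ [])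
    argD {Δ} A B d = castD (cong (_∷ Δ ++ B ⁺ᵗ ∷ []) (sym (⁺ᵗ-dual (A ⊸ B))))
      (mvL [] Δ ((A ⁺ᵗ) ⊗ (B ⁻ᵗ)) (B ⁺ᵗ ∷ []) (tenR Δ (A ⁺ᵗ) (B ⁻ᵗ) d (identD B)))

    app-eq : ∀ Γ Δ B → nctx Γ ++ nctx Δ ++ B ≡ nctx (Γ ++ Δ) ++ B
    app-eq Γ Δ B = trans (sym (++-assoc (nctx Γ) (nctx Δ) B)) (cong (_++ B) (sym (map-++ _ Γ Δ)))

    lam-eq : ∀ Γ x A Δ B → nctx (Γ ++ (x , A) ∷ Δ) ++ B ≡ nctx Γ ++ A ⁻ᵗ ∷ nctx Δ ++ B
    lam-eq Γ x A Δ B = trans (cong (_++ B) (map-++ _ Γ ((x , A) ∷ Δ))) (++-assoc (nctx Γ) (A ⁻ᵗ ∷ nctx Δ) B)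

    trD : ∀ {Γ t A} → Typed sg Γ t A → Deriv (nctx Γ ++ A ⁺ᵗ ∷ [])
    trD (ax {x} {A}) = identD A
    trD (cn c) = lexD c
    trD (app {Γ} {Δ} {A = A} {B} d e _) = castD (app-eq Γ Δ (B ⁺ᵗ ∷ []))
      (cut {nctx Γ} {nctx Δ ++ B ⁺ᵗ ∷ []} ((A ⊸ B) ⁺ᵗ) (trD d) (argD {nctx Δ} A B (trD e)))
    trD (lam {Γ} {Δ} {x} {A = A} {B} d) = castD (cong (_++ (A ⊸ B) ⁺ᵗ ∷ []) (sym (map-++ _ Γ Δ)))
      (parR (nctx Γ ++ nctx Δ) (A ⁻ᵗ) (B ⁺ᵗ) (castD (sym (++-assoc (nctx Γ) (nctx Δ) _))
        (mvR (nctx Γ) (nctx Δ) (A ⁻ᵗ) (B ⁺ᵗ ∷ []) (castD (lam-eq Γ x A Δ (B ⁺ᵗ ∷ [])) (trD d)))))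

    module _ (𝓐 : Action T) where
      open Relational T (nAt sg) litBd Lex 𝓐 using (RL; Rel; er; Rel-length; length-last)

      Rel-cast : ∀ {Γ Γ'} (e : Γ ≡ Γ') {d : Deriv Γ} {Θ} → Rel (castD e d) Θ → Rel d Θ
      Rel-cast refl r = r

      unsnoc : ∀ (π : List (Fml RL)) (Π : List (Fm (nAt sg))) {C} → length π ≡ length (Π ++ C ∷ []) →
               ∃ λ π' → ∃ λ c → π ≡ π' ++ c ∷ [] × length π' ≡ length Π
      unsnoc (c ∷ []) [] e = [] , c , refl , refl
      unsnoc (p ∷ π) (P ∷ Π) e with unsnoc π Π (NatP.suc-injective e)
      ... | π' , c , refl , l = p ∷ π' , c , refl , cong suc l

      split-length : ∀ (Θ : List (Fml RL)) (Π : List (Fm (nAt sg))) {X E} → length Θ ≡ length (Π ++ X ∷ E) →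
               ∃ λ π → ∃ λ x → ∃ λ ζ → Θ ≡ π ++ x ∷ ζ × length π ≡ length Π
      split-length (x ∷ ζ) [] l = [] , x , ζ , refl , refl
      split-length (q ∷ Θ) (_ ∷ Π) l with split-length Θ Π (NatP.suc-injective l)
      ... | π , x , ζ , refl , m = q ∷ π , x , ζ , refl , cong suc m

      Rel-mvL : ∀ Π Δ X E (d : Deriv (Π ++ Δ ++ X ∷ E)) {Θ} → Rel (mvL Π Δ X E d) Θ →
        ∃ λ π → ∃ λ x → ∃ λ δ → ∃ λ ζ → Θ ≡ π ++ x ∷ δ ++ ζ × length π ≡ length Π × length δ ≡ length Δ × Rel d (π ++ δ ++ x ∷ ζ)
      Rel-mvL Π [] X E d {Θ} r with split-length Θ Π (Rel-length d r)
      ... | π , x , ζ , refl , l = π , x , [] , ζ , refl , l , refl , r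
      Rel-mvL Π (C ∷ Δ) X E d (Θ₁ , c , x , Θ₂ , refl , l₁ , r)
        with Rel-mvL (Π ++ C ∷ []) Δ X E _ (Rel-cast (++-assoc Π (C ∷ []) (X ∷ Δ ++ E)) r)
      ... | π , x' , δ , ζ , e , lπ , lδ , r' with unsnoc π Π lπ
      ... | π' , c' , refl , lπ' with ++-split Θ₁ π' (trans l₁ (sym lπ')) (trans e (++-assoc π' (c' ∷ []) _))
      ... | refl , refl = Θ₁ , x , c ∷ δ , ζ , refl , lπ' , cong suc lδ
          , subst (Rel d) (++-assoc Θ₁ (c ∷ []) (δ ++ x ∷ ζ)) (Rel-cast (sym (++-assoc Π (C ∷ []) (Δ ++ X ∷ E))) r')

      Rel-mvR : ∀ Π Δ X E (d : Deriv (Π ++ X ∷ Δ ++ E)) {Θ} → Rel (mvR Π Δ X E d) Θ →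
        ∃ λ π → ∃ λ x → ∃ λ δ → ∃ λ ζ → Θ ≡ π ++ δ ++ x ∷ ζ × length π ≡ length Π × length δ ≡ length Δ × Rel d (π ++ x ∷ δ ++ ζ)
      Rel-mvR Π [] X E d {Θ} r with split-length Θ Π (Rel-length d r)
      ... | π , x , ζ , refl , l = π , x , [] , ζ , refl , l , refl , r
      Rel-mvR Π (C ∷ Δ) X E d r
        with Rel-mvR (Π ++ C ∷ []) Δ X E _ (Rel-cast (++-assoc Π (C ∷ []) (Δ ++ X ∷ E)) r)
      ... | π , x , δ , ζ , refl , lπ , lδ , r' with unsnoc π Π lπ
      ... | π' , c , refl , lπ' with Rel-cast (sym (++-assoc Π (C ∷ []) (X ∷ Δ ++ E))) r'
      ... | Θ₁ , x' , c' , Θ₂ , e , l₁ , r'' with ++-split π' Θ₁ (trans lπ' (sym l₁)) (trans (sym (++-assoc π' (c ∷ []) _)) e)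
      ... | refl , refl = π' , x , c ∷ δ , ζ , ++-assoc π' (c ∷ []) (δ ++ x ∷ ζ) , lπ' , cong suc lδ , r''

      mutual
        er-⁺ : ∀ A (a : Fml RL) → er a ≡ A ⁺ᵗ → ∃ λ s → a ≡ s ⁺ᶠ
        er-⁺ (atom p) (pos l) e = at l , refl
        er-⁺ (A ⊸ B) (a ⅋ b) e with er-⁻ A a (⅋ˡ e) | er-⁺ B b (⅋ʳ e)
          where
          ⅋ˡ : ∀ {x y x' y' : Fm (nAt sg)} → (x ⅋ y) ≡ (x' ⅋ y') → x ≡ x'
          ⅋ˡ refl = refl
          ⅋ʳ : ∀ {x y x' y' : Fm (nAt sg)} → (x ⅋ y) ≡ (x' ⅋ y') → y ≡ y'
          ⅋ʳ refl = refl
        ... | s , refl | s' , refl = (s ⊸ˢ s') , refl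

        er-⁻ : ∀ A (a : Fml RL) → er a ≡ A ⁻ᵗ → ∃ λ s → a ≡ s ⁻ᶠ
        er-⁻ (atom p) (neg l) e = at l , refl
        er-⁻ (A ⊸ B) (a ⊗ b) e with er-⁺ A a (⊗ˡ e) | er-⁻ B b (⊗ʳ e)
          where
          ⊗ˡ : ∀ {x y x' y' : Fm (nAt sg)} → (x ⊗ y) ≡ (x' ⊗ y') → x ≡ x'
          ⊗ˡ refl = refl
          ⊗ʳ : ∀ {x y x' y' : Fm (nAt sg)} → (x ⊗ y) ≡ (x' ⊗ y') → y ≡ y'
          ⊗ʳ refl = refl
        ... | s , refl | s' , refl = (s ⊸ˢ s') , refl

      rctx : SCx RL → List (Fml RL)
      rctx = map (λ p → proj₂ p ⁻ᶠ)

      Rel-argD : ∀ {Δ} A B (d : Deriv (Δ ++ A ⁺ᵗ ∷ [])) {Θ} → Rel (argD {Δ} A B d) Θ →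
        ∃ λ δ → ∃ λ a → ∃ λ b → Θ ≡ (a ⊗ b ᵈ) ∷ δ ++ b ∷ [] × Rel d (δ ++ a ∷ [])
      Rel-argD {Δ} A B d r
        with Rel-mvL [] Δ ((A ⁺ᵗ) ⊗ (B ⁻ᵗ)) (B ⁺ᵗ ∷ []) _ (Rel-cast (cong (_∷ Δ ++ B ⁺ᵗ ∷ []) (sym (⁺ᵗ-dual (A ⊸ B)))) r)
      ... | [] , x , δ , ζ , refl , _ , lδ , (Θ₁ , a , b , Θ₂ , e , r₁ , r₂)
        with Rel-cast (cong (_∷ B ⁺ᵗ ∷ []) (⁺ᵗ-dual B)) r₂
      ... | y , _ , refl with ++-split δ Θ₁ (trans lδ (sym (length-last Θ₁ Δ (Rel-length d r₁)))) e
      ... | refl , refl = δ , a , y , refl , r₁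

      -- The cut formulas that `Rel` quantifies over become the refined types of subterms. Sequents
      -- are split by length, since refining keeps the number of formulas.
      Rel-trD : {R : Fin (nC sg) → STy RL → Set} →
        (∀ c {Θ} → Rel (lexD c) Θ → ∃ λ a → Θ ≡ a ⁺ᶠ ∷ [] × R c a) →
        ∀ {Γ t A} (d : Typed sg Γ t A) {Θ} → Rel (trD d) Θ →
        ∃ λ Ξ → ∃ λ a → Θ ≡ rctx Ξ ++ a ⁺ᶠ ∷ [] × map proj₁ Ξ ≡ map proj₁ Γ × STyped R Ξ t a
      Rel-trD lexR (ax {x} {A}) r with Rel-cast (cong (_∷ A ⁺ᵗ ∷ []) (⁺ᵗ-dual A)) r
      ... | a , e , refl with er-⁺ A a e
      ... | s , refl = (x , s) ∷ [] , s , cong (_∷ s ⁺ᶠ ∷ []) (⁺ᶠ-dual s) , refl , ax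
      Rel-trD lexR (cn c) r with lexR c r
      ... | a , refl , ra = [] , a , refl , refl , cn ra
      Rel-trD {R} lexR (app {Γ} {Δ} {t} {s} {A} {B} d e u) r with Rel-cast (app-eq Γ Δ (B ⁺ᵗ ∷ [])) r
      ... | Θ₁ , Θ₂ , c , refl , r₁ , r₂ with Rel-trD lexR d r₁ | Rel-argD {nctx Δ} A B (trD e) r₂
      ... | Ξ , ab , e₁ , n₁ , d₁ | δ , a , b , e₂ , r₃ with Rel-trD lexR e r₃ | ++-splitʳ Θ₁ (rctx Ξ) refl e₁
      ... | Ξ' , a' , e₃ , n₂ , d₂ | refl , refl with ++-splitʳ δ (rctx Ξ') refl e₃
      ... | refl , refl = fin ab d₁ (proj₁ (∷-injective e₂)) (proj₂ (∷-injective e₂))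
        where
        names : map proj₁ (Ξ ++ Ξ') ≡ map proj₁ (Γ ++ Δ)
        names = trans (map-++ proj₁ Ξ Ξ') (trans (cong₂ _++_ n₁ n₂) (sym (map-++ proj₁ Γ Δ)))
        fin : ∀ ab → STyped R Ξ t ab → ab ⁺ᶠ ᵈ ≡ (a' ⁺ᶠ ⊗ b ᵈ) → Θ₂ ≡ rctx Ξ' ++ b ∷ [] →
          ∃ λ Ξ₀ → ∃ λ a → rctx Ξ ++ Θ₂ ≡ rctx Ξ₀ ++ a ⁺ᶠ ∷ [] × map proj₁ Ξ₀ ≡ map proj₁ (Γ ++ Δ) × STyped R Ξ₀ (app t s) a
        fin (a₁ ⊸ˢ b₁) dt q refl with ⁺ᶠ-injective a₁ a' (trans (sym (⁻ᶠ-dual a₁)) (⊗ˡ q)) | dual-inj (⊗ʳ q)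
          where
          ⊗ˡ : ∀ {x y x' y' : Fml RL} → (x ⊗ y) ≡ (x' ⊗ y') → x ≡ x'
          ⊗ˡ refl = refl
          ⊗ʳ : ∀ {x y x' y' : Fml RL} → (x ⊗ y) ≡ (x' ⊗ y') → y ≡ y'
          ⊗ʳ refl = refl
          dual-inj : ∀ {x y : Fml RL} → x ᵈ ≡ y ᵈ → x ≡ y
          dual-inj {x} {y} e = trans (sym (ᵈ-involutive x)) (trans (cong _ᵈ e) (ᵈ-involutive y))
        ... | refl | refl = Ξ ++ Ξ' , b₁
            , trans (sym (++-assoc (rctx Ξ) (rctx Ξ') _)) (cong (_++ b₁ ⁺ᶠ ∷ []) (sym (map-++ _ Ξ Ξ')))
            , names , app dt d₂ (subst Unique (sym names) u)
      Rel-trD {R} lexR (lam {Γ} {Δ} {x} {t} {A} {B} d) r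
        with Rel-cast (cong (_++ (A ⊸ B) ⁺ᵗ ∷ []) (sym (map-++ (λ p → proj₂ p ⁻ᵗ) Γ Δ))) r
      ... | Θ₁ , p , q , refl , r₁
        with Rel-mvR (nctx Γ) (nctx Δ) (A ⁻ᵗ) (B ⁺ᵗ ∷ []) _ (Rel-cast (sym (++-assoc (nctx Γ) (nctx Δ) _)) r₁)
      ... | π , y , δ , ζ , e , lπ , lδ , r₂
        with Rel-trD lexR d (Rel-cast (lam-eq Γ x A Δ (B ⁺ᵗ ∷ [])) r₂)
      ... | Ξ , b , e₁ , n , dt with map-++⁻ proj₁ (map proj₁ Γ) Ξ (trans n (map-++ proj₁ Γ ((x , A) ∷ Δ)))
      ... | Ξ₁ , (x' , α') ∷ Ξ₂ , refl , n₁ , n₂ with ∷-injective n₂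
      ... | refl , n₂' with ++-split π (rctx Ξ₁) (trans lπ (trans (length-map _ Γ) (trans (sym (length-map proj₁ Γ)) (trans (cong length (sym n₁)) (trans (length-map proj₁ Ξ₁) (sym (length-map _ Ξ₁)))))))
                              (trans e₁ (trans (cong (_++ b ⁺ᶠ ∷ []) (map-++ _ Ξ₁ ((x , α') ∷ Ξ₂))) (++-assoc (rctx Ξ₁) _ _)))
      ... | refl , e₂ with ∷-injective e₂
      ... | refl , e₃ with ++-split δ (rctx Ξ₂) (trans lδ (trans (length-map _ Δ) (trans (sym (length-map proj₁ Δ)) (trans (cong length (sym n₂')) (trans (length-map proj₁ Ξ₂) (sym (length-map _ Ξ₂))))))) e₃
      ... | refl , refl with ++-splitʳ Θ₁ (rctx Ξ₁ ++ rctx Ξ₂) refl (trans e (sym (++-assoc (rctx Ξ₁) (rctx Ξ₂) _)))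
      ... | refl , refl = Ξ₁ ++ Ξ₂ , (α' ⊸ˢ b) , cong (_++ (α' ⊸ˢ b) ⁺ᶠ ∷ []) (sym (map-++ _ Ξ₁ Ξ₂))
          , trans (map-++ proj₁ Ξ₁ Ξ₂) (trans (cong₂ _++_ n₁ n₂') (sym (map-++ proj₁ Γ Δ)))
          , lam dt

-- From counts to perfect matchings

module _ {A : Set} (_≟_ : DecidableEquality A) where
  open Counting _≟_

  cnt≢0⇒∈ : ∀ y xs → cnt y xs ≢ 0 → y ∈ xs
  cnt≢0⇒∈ y [] h = ⊥-elim (h refl)
  cnt≢0⇒∈ y (x ∷ xs) h with y ≟ x
  ... | yes e = here e
  ... | no n = there (cnt≢0⇒∈ y xs h)

  cnt-≡⇒↭ : ∀ xs ys → (∀ y → cnt y xs ≡ cnt y ys) → xs ↭ ys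
  cnt-≡⇒↭ [] [] h = ↭-refl
  cnt-≡⇒↭ [] (y ∷ ys) h = ⊥-elim (cnt-∈ (y ∷ ys) (here refl) (sym (h y)))
  cnt-≡⇒↭ (x ∷ xs) ys h with ∈-∃++ (cnt≢0⇒∈ x ys λ e → cnt-∈ (x ∷ xs) (here refl) (trans (h x) e))
  ... | ys₁ , ys₂ , refl = ↭-trans (prep x (cnt-≡⇒↭ xs (ys₁ ++ ys₂) λ y →
          NatP.+-cancelˡ-≡ (ind y x) _ _ (trans (h y) (cnt-↭ (PermP.shift x ys₁ ys₂))))) (↭-sym (PermP.shift x ys₁ ys₂))

module _ {T : Set} (X : Bd) (es : List (Edge T (Fin (size X)))) (m : Matching X es) where
  open Counting (FinP._≟_ {size X})

  matching-left : ∀ b {e} → e ∈ es → own b (left X (end b e)) ≡ true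
  matching-left b {e} i with own b (left X (end b e)) in q
  ... | true = refl
  ... | false = ⊥-elim (cnt-∈ (ends b es) (∈-map⁺ (end b) i) (trans (m b (end b e)) (cong b2n q)))

  matching-oriented : All (λ e → left X (proj₁ e) ≡ true × left X (proj₂ (proj₂ e)) ≡ false) es
  matching-oriented = All.tabulate λ i → matching-left true i , not-true (matching-left false i)
    where
    not-true : ∀ {b} → not b ≡ true → b ≡ false
    not-true {false} e = refl

  matching-perfect : endpoints es ↭ allFin (size X)
  matching-perfect = cnt-≡⇒↭ FinP._≟_ (endpoints es) (allFin (size X)) λ v →
    trans (both v es) (trans (cong₂ _+_ (m true v) (m false v)) (trans (b2n-own-not true (left X v))
      (sym (trans (cnt-tabulate id v (λ _ e → e)) (ind-refl v)))))
    where
    both : ∀ v (es : List (Edge T (Fin (size X)))) → cnt v (endpoints es) ≡ cnt v (ends true es) + cnt v (ends false es)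
    both v [] = refl
    both v ((i , w , j) ∷ es) = trans (cong (λ n → ind v i + (ind v j + n)) (both v es))
      (four (ind v i) (ind v j) (cnt v (ends true es)) (cnt v (ends false es)))
      where
      four : ∀ a b c d → a + (b + (c + d)) ≡ (a + c) + (b + d)
      four a b c d = trans (cong (a +_) (trans (sym (NatP.+-assoc b c d)) (trans (cong (_+ d) (NatP.+-comm b c)) (NatP.+-assoc c b d))))
                           (sym (NatP.+-assoc a c (b + d)))

-- Types read from values at vertices

module TypePositions (T : Set) (n : ℕ) (litBd : Fin n → Bd) where
  open RuleMaps T n litBd public

  size⁺⁻ : ∀ A → ∣ A ⁻ᵗ ∣ ≡ ∣ A ⁺ᵗ ∣
  size⁺⁻ A = trans (cong ∣_∣ (sym (⁺ᵗ-dual A))) (sizeNeg (A ⁺ᵗ))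

  left-cast : ∀ {X Y} (e : X ≡ Y) (j : Fin ∣ Y ∣) → left ⟦ Y ⟧ j ≡ left ⟦ X ⟧ (cast (cong ∣_∣ (sym e)) j)
  left-cast {X} refl j = cong (left ⟦ X ⟧) (sym (FinP.toℕ-injective (FinP.toℕ-cast refl j)))

  left-dualᵗ : ∀ A {i j} → Mirror i j → left ⟦ A ⁻ᵗ ⟧ j ≡ not (left ⟦ A ⁺ᵗ ⟧ i)
  left-dualᵗ A {i} {j} m = trans (left-cast (⁺ᵗ-dual A) j)
    (trans (cong (left ⟦ (A ⁺ᵗ) ⁻ ⟧) (sym (mirror⇒dual (A ⁺ᵗ) {i} {j'} (trans (cong (λ k → suc (toℕ i + k)) (FinP.toℕ-cast e j)) m))))
      (left-dual (A ⁺ᵗ) i))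
    where
    e = cong ∣_∣ (sym (⁺ᵗ-dual A))
    j' = cast e j

  module TypeReading (D : Set) where
    open Reading T n litBd D public

    mutual
      rt⁺ : ∀ A → (Fin ∣ A ⁺ᵗ ∣ → D) → STy RL
      rt⁺ (atom p) x = at (p , Vec.tabulate x)
      rt⁺ (A ⊸ B) x = rt⁻ A (x ∘ inPA (A ⁻ᵗ) (B ⁺ᵗ)) ⊸ˢ rt⁺ B (x ∘ inPB (A ⁻ᵗ) (B ⁺ᵗ))

      rt⁻ : ∀ A → (Fin ∣ A ⁻ᵗ ∣ → D) → STy RL
      rt⁻ (atom p) x = at (p , Vec.tabulate (x ∘ opposite))
      rt⁻ (A ⊸ B) x = rt⁺ A (x ∘ (_↑ˡ ∣ B ⁻ᵗ ∣)) ⊸ˢ rt⁻ B (x ∘ (∣ A ⁺ᵗ ∣ ↑ʳ_))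

    mutual
      rf-rt⁺ : ∀ A x → rf (A ⁺ᵗ) x ≡ rt⁺ A x ⁺ᶠ
      rf-rt⁺ (atom p) x = refl
      rf-rt⁺ (A ⊸ B) x = cong₂ _⅋_ (rf-rt⁻ A _) (rf-rt⁺ B _)

      rf-rt⁻ : ∀ A x → rf (A ⁻ᵗ) x ≡ rt⁻ A x ⁻ᶠ
      rf-rt⁻ (atom p) x = refl
      rf-rt⁻ (A ⊸ B) x = cong₂ _⊗_ (rf-rt⁺ A _) (rf-rt⁻ B _)

    rt⁺-cong : ∀ A {x y : Fin ∣ A ⁺ᵗ ∣ → D} → (∀ i → x i ≡ y i) → rt⁺ A x ≡ rt⁺ A y
    rt⁺-cong A {x} {y} h = ⁺ᶠ-injective _ _ (trans (sym (rf-rt⁺ A x)) (trans (rf-cong (A ⁺ᵗ) h) (rf-rt⁺ A y)))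

    rt⁻-cong : ∀ A {x y : Fin ∣ A ⁻ᵗ ∣ → D} → (∀ i → x i ≡ y i) → rt⁻ A x ≡ rt⁻ A y
    rt⁻-cong A {x} {y} h = ⁻ᶠ-injective _ _ (trans (sym (rf-rt⁻ A x)) (trans (rf-cong (A ⁻ᵗ) h) (rf-rt⁻ A y)))

    rf-cast : ∀ {X Y} (e : X ≡ Y) (y : Fin ∣ Y ∣ → D) → rf Y y ≡ rf X (y ∘ cast (cong ∣_∣ e))
    rf-cast {X} refl y = rf-cong X λ i → cong y (sym (FinP.toℕ-injective (FinP.toℕ-cast refl i)))

    -- This carries `rf-dual` over from formulas to types, by injectivity of `_⁻ᶠ`.
    rt-mirror : ∀ A {x : Fin ∣ A ⁺ᵗ ∣ → D} {y : Fin ∣ A ⁻ᵗ ∣ → D} → (∀ i j → Mirror i j → x i ≡ y j) → rt⁺ A x ≡ rt⁻ A y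
    rt-mirror A {x} {y} h = ⁻ᶠ-injective _ _ (trans (sym (⁺ᶠ-dual (rt⁺ A x))) (trans (cong _ᵈ (sym (rf-rt⁺ A x)))
      (trans (sym (rf-dual (A ⁺ᵗ) λ i j m → h i (cast e j) (trans (cong (λ k → suc (toℕ i + k)) (FinP.toℕ-cast e j)) m)))
        (trans (sym (rf-cast (⁺ᵗ-dual A) y)) (rf-rt⁻ A y)))))
      where
      e = cong ∣_∣ (⁺ᵗ-dual A)

    mutual
      erase-rt⁺ : ∀ A x → eraseTy proj₁ (rt⁺ A x) ≡ A
      erase-rt⁺ (atom p) x = refl
      erase-rt⁺ (A ⊸ B) x = cong₂ _⊸_ (erase-rt⁻ A _) (erase-rt⁺ B _)

      erase-rt⁻ : ∀ A x → eraseTy proj₁ (rt⁻ A x) ≡ A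
      erase-rt⁻ (atom p) x = refl
      erase-rt⁻ (A ⊸ B) x = cong₂ _⊸_ (erase-rt⁺ A _) (erase-rt⁻ B _)

-- Interpreting abstract atoms by object types

module Interpreted (T : Set) {n m : ℕ} (litBd : Fin m → Bd) (F : Fin n → Ty m) where
  open module O = TypePositions T m litBd using () renaming (∣_∣ to ∣_∣ₒ; ⟦_⟧ to ⟦_⟧ₒ)

  litBdᶠ : Fin n → Bd
  litBdᶠ p = ⟦ F p ⁺ᵗ ⟧ₒ

  open module P = TypePositions T n litBdᶠ using (∣_∣; ⟦_⟧)

  mutual
    size⁺ : ∀ A → ∣ mapTy F A ⁺ᵗ ∣ₒ ≡ ∣ A ⁺ᵗ ∣
    size⁺ (atom p) = refl
    size⁺ (A ⊸ B) = cong₂ _+_ (size⁻ A) (size⁺ B)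

    size⁻ : ∀ A → ∣ mapTy F A ⁻ᵗ ∣ₒ ≡ ∣ A ⁻ᵗ ∣
    size⁻ (atom p) = O.size⁺⁻ (F p)
    size⁻ (A ⊸ B) = cong₂ _+_ (size⁺ A) (size⁻ B)

  -- The vertices of a type and of its interpretation come in the same order. For a negative atom
  -- this holds because `_⊥B` reverses the boundary just as the negative object type does.
  κ⁺ : ∀ A → Fin ∣ mapTy F A ⁺ᵗ ∣ₒ → Fin ∣ A ⁺ᵗ ∣
  κ⁺ A = cast (size⁺ A)

  κ⁻ : ∀ A → Fin ∣ mapTy F A ⁻ᵗ ∣ₒ → Fin ∣ A ⁻ᵗ ∣
  κ⁻ A = cast (size⁻ A)

  κ-atom : ∀ p i → κ⁺ (atom p) i ≡ i
  κ-atom p i = FinP.toℕ-injective (FinP.toℕ-cast refl i)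

  κ-opposite : ∀ p {i j} → Mirror i j → κ⁻ (atom p) j ≡ opposite i
  κ-opposite p {i} {j} m = sym (mirror⇒opposite (trans (cong (λ k → suc (toℕ i + k)) (FinP.toℕ-cast (size⁻ (atom p)) j)) m))

  module _ (A B : Ty n) where
    private
      A' = mapTy F A
      B' = mapTy F B

    κ-inPA : ∀ i → κ⁺ (A ⊸ B) (O.inPA (A' ⁻ᵗ) (B' ⁺ᵗ) i) ≡ P.inPA (A ⁻ᵗ) (B ⁺ᵗ) (κ⁻ A i)
    κ-inPA i = FinP.toℕ-injective (trans (FinP.toℕ-cast (size⁺ (A ⊸ B)) (O.inPA (A' ⁻ᵗ) (B' ⁺ᵗ) i))
      (trans (O.toℕ-inPA (A' ⁻ᵗ) (B' ⁺ᵗ) i) (trans (cong₂ _+_ (size⁺ B) (sym (FinP.toℕ-cast (size⁻ A) i))) (sym (P.toℕ-inPA (A ⁻ᵗ) (B ⁺ᵗ) (κ⁻ A i))))))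

    κ-inPB : ∀ j → κ⁺ (A ⊸ B) (O.inPB (A' ⁻ᵗ) (B' ⁺ᵗ) j) ≡ P.inPB (A ⁻ᵗ) (B ⁺ᵗ) (κ⁺ B j)
    κ-inPB j = FinP.toℕ-injective (trans (FinP.toℕ-cast (size⁺ (A ⊸ B)) (O.inPB (A' ⁻ᵗ) (B' ⁺ᵗ) j))
      (trans (O.toℕ-inPB (A' ⁻ᵗ) (B' ⁺ᵗ) j) (trans (sym (FinP.toℕ-cast (size⁺ B) j)) (sym (P.toℕ-inPB (A ⁻ᵗ) (B ⁺ᵗ) (κ⁺ B j))))))

    κ-↑ˡ : ∀ i → κ⁻ (A ⊸ B) (i ↑ˡ ∣ B' ⁻ᵗ ∣ₒ) ≡ κ⁺ A i ↑ˡ ∣ B ⁻ᵗ ∣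
    κ-↑ˡ i = FinP.toℕ-injective (trans (FinP.toℕ-cast (size⁻ (A ⊸ B)) (i ↑ˡ ∣ B' ⁻ᵗ ∣ₒ))
      (trans (FinP.toℕ-↑ˡ i ∣ B' ⁻ᵗ ∣ₒ) (trans (sym (FinP.toℕ-cast (size⁺ A) i)) (sym (FinP.toℕ-↑ˡ (κ⁺ A i) ∣ B ⁻ᵗ ∣)))))

    κ-↑ʳ : ∀ j → κ⁻ (A ⊸ B) (∣ A' ⁺ᵗ ∣ₒ ↑ʳ j) ≡ ∣ A ⁺ᵗ ∣ ↑ʳ κ⁻ B j
    κ-↑ʳ j = FinP.toℕ-injective (trans (FinP.toℕ-cast (size⁻ (A ⊸ B)) (∣ A' ⁺ᵗ ∣ₒ ↑ʳ j))
      (trans (FinP.toℕ-↑ʳ ∣ A' ⁺ᵗ ∣ₒ j) (trans (cong₂ _+_ (size⁺ A) (sym (FinP.toℕ-cast (size⁻ B) j))) (sym (FinP.toℕ-↑ʳ ∣ A ⁺ᵗ ∣ (κ⁻ B j))))))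

  mutual
    left⁺ : ∀ A i → left ⟦ A ⁺ᵗ ⟧ (κ⁺ A i) ≡ left ⟦ mapTy F A ⁺ᵗ ⟧ₒ i
    left⁺ (atom p) i = cong (left (litBdᶠ p)) (κ-atom p i)
    left⁺ (A ⊸ B) v with O.splitP (mapTy F A ⁻ᵗ) (mapTy F B ⁺ᵗ) v
    ... | O.isA i = trans (cong (left ⟦ (A ⊸ B) ⁺ᵗ ⟧) (κ-inPA A B i)) (trans (P.left-PA (A ⁻ᵗ) (B ⁺ᵗ) (κ⁻ A i))
                      (trans (left⁻ A i) (sym (O.left-PA (mapTy F A ⁻ᵗ) (mapTy F B ⁺ᵗ) i))))
    ... | O.isB j = trans (cong (left ⟦ (A ⊸ B) ⁺ᵗ ⟧) (κ-inPB A B j)) (trans (P.left-PB (A ⁻ᵗ) (B ⁺ᵗ) (κ⁺ B j))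
                      (trans (left⁺ B j) (sym (O.left-PB (mapTy F A ⁻ᵗ) (mapTy F B ⁺ᵗ) j))))

    left⁻ : ∀ A i → left ⟦ A ⁻ᵗ ⟧ (κ⁻ A i) ≡ left ⟦ mapTy F A ⁻ᵗ ⟧ₒ i
    left⁻ (atom p) j = sym (O.left-dualᵗ (F p) {i'} {j} mir)
      where
      i' = opposite (κ⁻ (atom p) j)
      mir : Mirror i' j
      mir = trans (cong suc (NatP.+-comm (toℕ i') (toℕ j)))
            (trans (cong (λ k → suc (k + toℕ i')) (sym (FinP.toℕ-cast (size⁻ (atom p)) j))) (opposite-mirror (κ⁻ (atom p) j)))
    left⁻ (A ⊸ B) v with splitV ∣ mapTy F A ⁺ᵗ ∣ₒ v
    ... | isˡ i = trans (cong (left ⟦ (A ⊸ B) ⁻ᵗ ⟧) (κ-↑ˡ A B i)) (trans (P.left-⊗ˡ ⟦ A ⁺ᵗ ⟧ ⟦ B ⁻ᵗ ⟧ (κ⁺ A i))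
                    (trans (left⁺ A i) (sym (O.left-⊗ˡ ⟦ mapTy F A ⁺ᵗ ⟧ₒ ⟦ mapTy F B ⁻ᵗ ⟧ₒ i))))
    ... | isʳ j = trans (cong (left ⟦ (A ⊸ B) ⁻ᵗ ⟧) (κ-↑ʳ A B j)) (trans (P.left-⊗ʳ ⟦ A ⁺ᵗ ⟧ ⟦ B ⁻ᵗ ⟧ (κ⁻ B j))
                    (trans (left⁻ B j) (sym (O.left-⊗ʳ ⟦ mapTy F A ⁺ᵗ ⟧ₒ ⟦ mapTy F B ⁻ᵗ ⟧ₒ j))))

  module InterpretedReading (D : Set) where
    module OR = O.TypeReading D
    module PR = P.TypeReading D

    -- A refined abstract literal carries a value for every vertex of `F p`, which is exactly a
    -- refined object type.
    unfold : PR.RL → STy OR.RL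
    unfold (p , v) = OR.rt⁺ (F p) (Vec.lookup v)

    mutual
      unfold-rt⁺ : ∀ A x → bindS unfold (PR.rt⁺ A x) ≡ OR.rt⁺ (mapTy F A) (x ∘ κ⁺ A)
      unfold-rt⁺ (atom p) x = OR.rt⁺-cong (F p) λ i → trans (VecP.lookup∘tabulate x i) (cong x (sym (κ-atom p i)))
      unfold-rt⁺ (A ⊸ B) x = cong₂ _⊸ˢ_
        (trans (unfold-rt⁻ A _) (OR.rt⁻-cong (mapTy F A) λ i → cong x (sym (κ-inPA A B i))))
        (trans (unfold-rt⁺ B _) (OR.rt⁺-cong (mapTy F B) λ j → cong x (sym (κ-inPB A B j))))

      unfold-rt⁻ : ∀ A x → bindS unfold (PR.rt⁻ A x) ≡ OR.rt⁻ (mapTy F A) (x ∘ κ⁻ A)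
      unfold-rt⁻ (atom p) x = OR.rt-mirror (F p) λ i j m → trans (VecP.lookup∘tabulate (x ∘ opposite) i) (cong x (sym (κ-opposite p m)))
      unfold-rt⁻ (A ⊸ B) x = cong₂ _⊸ˢ_
        (trans (unfold-rt⁺ A _) (OR.rt⁺-cong (mapTy F A) λ i → cong x (sym (κ-↑ˡ A B i))))
        (trans (unfold-rt⁻ B _) (OR.rt⁻-cong (mapTy F B) λ j → cong x (sym (κ-↑ʳ A B j))))

-- The grammar of a string ACG

map≡[] : ∀ {A B : Set} {f : A → B} xs → map f xs ≡ [] → xs ≡ []
map≡[] [] e = refl

module StrGrammar (k : ℕ) where

  litO : Fin 1 → Bd
  litO _ = bd 1 (λ _ → true)

  -- Par lists its second component first, so vertex 0 is the result and vertex 1 the argument. The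
  -- edge runs from result to argument, so under composition the outermost letter comes first.
  letterEntry : Fin k → LL.Entry (Fin k) 1 litO
  letterEntry a = record
    { seq = (atom zero ⊸ atom zero) ⁺ᵗ ∷ []
    ; mw  = record { edges = (zero , a ∷ [] , suc zero) ∷ [] ; cycles = []
                   ; oriented = (refl , refl) ∷ [] ; perfect = ↭-refl } }

  lexO : List (LL.Entry (Fin k) 1 litO)
  lexO = map letterEntry (allFin k)

  ∈lexO : ∀ {e} → e ∈ lexO → ∃ λ a → e ≡ letterEntry a
  ∈lexO i with ∈-map⁻ letterEntry i
  ... | a , _ , e = a , e

  open DerivationMatching (Fin k) 1 litO lexO

  lexO-matching : ∀ e → e ∈ lexO → Matching ⟦ Entry.seq e ⟧ᶜ (edges (Entry.mw e))
  lexO-matching e i with ∈lexO i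
  ... | a , refl = m
    where
    m : Matching ⟦ Entry.seq (letterEntry a) ⟧ᶜ (edges (Entry.mw (letterEntry a)))
    m true zero = refl
    m true (suc zero) = refl
    m false zero = refl
    m false (suc zero) = refl

  -- Distinct values are strictly coherent. A letter joins equal values, so its solutions form the
  -- clique of the identity.
  kO : (l l' : Reading.RL (Fin k) 1 litO Bool) → Sign
  kO (_ , x ∷ []) (_ , y ∷ []) with x BoolP.≟ y
  ... | yes _ = null
  ... | no _  = plus

  kO-refl : ∀ l → kO l l ≡ null
  kO-refl (_ , x ∷ []) with x BoolP.≟ x
  ... | yes _ = refl
  ... | no n = ⊥-elim (n refl)

  kO-null : ∀ {P v v'} → kO (P , v) (P , v') ≡ null → v ≡ v'
  kO-null {P} {x ∷ []} {y ∷ []} e with x BoolP.≟ y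
  ... | yes refl = refl

  open Acyclic (Fin k) 1 litO lexO using (acyclic; Rel-coh; null⇒≡) public

  lexO-acyclic : ∀ e → e ∈ lexO → cycles (Entry.mw e) ≡ []
  lexO-acyclic e i with ∈lexO i
  ... | a , refl = refl

  lexO-coh : ∀ e → e ∈ lexO → ∀ x x' → Sat.sat (boolAction (Fin k)) x (edges (Entry.mw e)) →
             Sat.sat (boolAction (Fin k)) x' (edges (Entry.mw e)) →
             Coh (Coherence.cohs kO (Reading.rfc (Fin k) 1 litO Bool (Entry.seq e) x) (Reading.rfc (Fin k) 1 litO Bool (Entry.seq e) x'))
  lexO-coh e i x x' h h' with ∈lexO i
  lexO-coh e i x x' (h ∷ []) (h' ∷ []) | a , refl =
    subst Coh (sym (⅋₃-null (opp s₁ ⅋₃ s₀)))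
      (subst (λ s → Coh (opp s ⅋₃ s₀)) (cong₂ (λ u v → kO (zero , u ∷ []) (zero , v ∷ [])) h h') (coh-id s₀))
    where
    s₀ = kO (zero , x zero ∷ []) (zero , x' zero ∷ [])
    s₁ = kO (zero , x (suc zero) ∷ []) (zero , x' (suc zero) ∷ [])

  interpO-acyclic : ∀ {Γ} (d : Deriv Γ) → proj₂ (interp d) ≡ []
  interpO-acyclic = acyclic kO kO-refl kO-null lexO-matching lexO-acyclic lexO-coh

  open TypedDerivations (Fin k) (StrSig k) litO lexO public

  letterD : ∀ a → Deriv ((atom zero ⊸ atom zero) ⁺ᵗ ∷ [])
  letterD a = lex (letterEntry a) (∈-map⁺ letterEntry (∈-allFin a))

  module _ (𝓐 : Action (Fin k)) where
    open Action 𝓐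
    open Relational (Fin k) 1 litO lexO 𝓐 using (sat; Rel; sat⇒Rel; rfc; RL)
    open TypePositions.TypeReading (Fin k) 1 litO D using (rt⁺; rf-rt⁺)

    -- The edge of a letter leads from the result to the argument, hence the order `v`, `u` in the
    -- action.
    LetterTy : Fin k → STy RL → Set
    LetterTy a s = ∃ λ u → ∃ λ v → s ≡ (at (zero , u ∷ []) ⊸ˢ at (zero , v ∷ [])) × W (a ∷ []) v u

    -- Acyclicity discharges the proviso of `sat⇒Rel`, and for a closed term the sequent consists of
    -- its type only.
    closed-sat : ∀ {t A} (d : Typed (StrSig k) [] t A) x → sat x (proj₁ (interp (trD letterD d))) →
                 STyped LetterTy [] t (rt⁺ A x)
    closed-sat {t} {A} d x h
      with Rel-trD letterD 𝓐 letterR d (sat⇒Rel lexO-matching (trD letterD d) (interpO-acyclic (trD letterD d)) x h)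
      where
      letterR : ∀ a {Θ} → Rel (letterD a) Θ → ∃ λ s → Θ ≡ s ⁺ᶠ ∷ [] × LetterTy a s
      letterR a (x , refl , (h ∷ [])) = _ , refl , x (suc zero) , x zero , refl , h
    ... | Ξ , s , e , n , dt with map≡[] Ξ n
    ... | refl with ⁺ᶠ-injective (rt⁺ A x) s (trans (sym (rf-rt⁺ A x)) (proj₁ (∷-injective e)))
    ... | refl = dt

module Grammar (k : ℕ) (G : StringACG k) where
  open StrGrammar k

  Σₐ = abstr G
  Fₐ = F (φ G)
  n = nAt Σₐ

  open Interpreted (Fin k) litO Fₐ public
  module OD = DerivationMatching (Fin k) 1 litO lexO

  open TypePositions (Fin k) n litBdᶠ hiding (Entry; module Entry; module Derivations) public

  objD : ∀ c → OD.Deriv (mapTy Fₐ (typeOf Σₐ c) ⁺ᵗ ∷ [])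
  objD c = trD letterD (G-typed (φ G) c)

  constEdges : ∀ c → List (Edge (Fin k) (Fin ∣ typeOf Σₐ c ⁺ᵗ ∣))
  constEdges c = proj₁ (OD.ren (κ⁺ (typeOf Σₐ c)) (OD.interp (objD c)))

  const-matching : ∀ c → Matching ⟦ typeOf Σₐ c ⁺ᵗ ∷ [] ⟧ᶜ (constEdges c)
  const-matching c = OD.ren-matching {OD.⟦ mapTy Fₐ A ⁺ᵗ ∷ [] ⟧ᶜ} {⟦ A ⁺ᵗ ∷ [] ⟧ᶜ}
      (κ⁺ A) (cast (sym (size⁺ A))) (cast-injective (size⁺ A)) (cast-cast⁻ (size⁺ A)) (left⁺ A)
      {OD.interp (objD c)} (OD.interp-matching lexO-matching (objD c))
    where A = typeOf Σₐ c

  constEntry : Fin (nC Σₐ) → LL.Entry (Fin k) n litBdᶠ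
  constEntry c = record
    { seq = typeOf Σₐ c ⁺ᵗ ∷ []
    -- No cycle is dropped here: by `interpO-acyclic` the derivation `objD c` has none.
    ; mw  = record { edges = constEdges c ; cycles = []
                   ; oriented = matching-oriented _ (constEdges c) (const-matching c)
                   ; perfect = matching-perfect _ (constEdges c) (const-matching c) } }

  Lexᶠ : List (LL.Entry (Fin k) n litBdᶠ)
  Lexᶠ = map constEntry (allFin (nC Σₐ))

  ∈Lexᶠ : ∀ {e} → e ∈ Lexᶠ → ∃ λ c → e ≡ constEntry c
  ∈Lexᶠ i with ∈-map⁻ constEntry i
  ... | c , _ , e = c , e

  open LL.Entry using (seq; mw)
  module AD = DerivationMatching (Fin k) n litBdᶠ Lexᶠ

  Lexᶠ-matching : ∀ e → e ∈ Lexᶠ → Matching ⟦ seq e ⟧ᶜ (edges (mw e))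
  Lexᶠ-matching e i with ∈Lexᶠ i
  ... | c , refl = const-matching c

  Lexᶠ-acyclic : ∀ e → e ∈ Lexᶠ → cycles (mw e) ≡ []
  Lexᶠ-acyclic e i with ∈Lexᶠ i
  ... | c , refl = refl

  module IB = InterpretedReading Bool
  module CO = Coherence kO

  -- A literal inherits the coherence of the object type that it unfolds to, so `Lexᶠ-coh` reduces
  -- to the cliques of the object grammar.
  kᶠ : IB.PR.RL → IB.PR.RL → Sign
  kᶠ l l' = CO.coh (IB.unfold l ⁺ᶠ) (IB.unfold l' ⁺ᶠ)

  module CP = Coherence kᶠ

  kᶠ-null : ∀ {P v v'} → kᶠ (P , v) (P , v') ≡ null → v ≡ v'
  kᶠ-null {P} {v} {v'} e = trans (sym (VecP.tabulate∘lookup v)) (trans (VecP.tabulate-cong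
    (null⇒≡ kO kO-refl kO-null lexO-matching lexO-acyclic lexO-coh (Fₐ P ⁺ᵗ)
      (trans (cong₂ CO.coh (IB.OR.rf-rt⁺ (Fₐ P) (Vec.lookup v)) (IB.OR.rf-rt⁺ (Fₐ P) (Vec.lookup v'))) e))) (VecP.tabulate∘lookup v'))

  mutual
    -- Coherence is computed atom by atom and thus commutes with unfolding; a negative atom is
    -- settled by `coh-dual`.
    coh⁺ : ∀ A x x' → CP.coh (IB.PR.rt⁺ A x ⁺ᶠ) (IB.PR.rt⁺ A x' ⁺ᶠ) ≡ CO.coh (bindS IB.unfold (IB.PR.rt⁺ A x) ⁺ᶠ) (bindS IB.unfold (IB.PR.rt⁺ A x') ⁺ᶠ)
    coh⁺ (atom p) x x' = refl
    coh⁺ (A ⊸ B) x x' = cong₂ _⅋₃_ (coh⁻ A _ _) (coh⁺ B _ _)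

    coh⁻ : ∀ A x x' → CP.coh (IB.PR.rt⁻ A x ⁻ᶠ) (IB.PR.rt⁻ A x' ⁻ᶠ) ≡ CO.coh (bindS IB.unfold (IB.PR.rt⁻ A x) ⁻ᶠ) (bindS IB.unfold (IB.PR.rt⁻ A x') ⁻ᶠ)
    coh⁻ (atom p) x x' = trans (sym (CO.coh-dual (s ⁺ᶠ) (s' ⁺ᶠ))) (cong₂ CO.coh (⁺ᶠ-dual s) (⁺ᶠ-dual s'))
      where
      s = bindS IB.unfold (IB.PR.rt⁻ (atom p) x)
      s' = bindS IB.unfold (IB.PR.rt⁻ (atom p) x')
    coh⁻ (A ⊸ B) x x' = cong₂ _⊗₃_ (coh⁺ A _ _) (coh⁻ B _ _)

  sat-κ : ∀ (𝓐 : Action (Fin k)) c x → Sat.sat 𝓐 x (constEdges c) → Sat.sat 𝓐 (x ∘ κ⁺ (typeOf Σₐ c)) (proj₁ (OD.interp (objD c)))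
  sat-κ 𝓐 c x h = Relational.sat-ren (Fin k) 1 litO lexO 𝓐 (κ⁺ (typeOf Σₐ c)) (OD.interp (objD c)) h

  Lexᶠ-coh : ∀ e → e ∈ Lexᶠ → ∀ x x' → Sat.sat (boolAction (Fin k)) x (edges (mw e)) → Sat.sat (boolAction (Fin k)) x' (edges (mw e)) →
             Coh (CP.cohs (IB.PR.rfc (seq e) x) (IB.PR.rfc (seq e) x'))
  Lexᶠ-coh e i x x' h h' with ∈Lexᶠ i
  ... | c , refl = subst Coh (cong (_⅋₃ null) (trans (cong₂ CO.coh (step x) (step x')) (trans (sym (coh⁺ A x x')) (cong₂ CP.coh (sym (IB.PR.rf-rt⁺ A x)) (sym (IB.PR.rf-rt⁺ A x'))))))
      (Rel-coh kO kO-refl kO-null lexO-matching lexO-acyclic lexO-coh (objD c) (rel x h) (rel x' h'))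
    where
    A = typeOf Σₐ c
    step : ∀ x → IB.OR.rf (mapTy Fₐ A ⁺ᵗ) (x ∘ κ⁺ A) ≡ bindS IB.unfold (IB.PR.rt⁺ A x) ⁺ᶠ
    step x = trans (IB.OR.rf-rt⁺ (mapTy Fₐ A) (x ∘ κ⁺ A)) (cong _⁺ᶠ (sym (IB.unfold-rt⁺ A x)))
    rel : ∀ x → Sat.sat (boolAction (Fin k)) x (constEdges c) →
          Relational.Rel (Fin k) 1 litO lexO (boolAction (Fin k)) (objD c) (IB.OR.rfc (mapTy Fₐ A ⁺ᵗ ∷ []) (x ∘ κ⁺ A))
    rel x h = Relational.sat⇒Rel (Fin k) 1 litO lexO (boolAction (Fin k)) lexO-matching (objD c) (interpO-acyclic (objD c)) _ (sat-κ (boolAction (Fin k)) c x h)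

  interp-acyclic : ∀ {Γ} (d : AD.Deriv Γ) → proj₂ (AD.interp d) ≡ []
  interp-acyclic = Acyclic.acyclic (Fin k) n litBdᶠ Lexᶠ kᶠ (λ l → CO.coh-refl kO-refl (IB.unfold l ⁺ᶠ)) kᶠ-null Lexᶠ-matching Lexᶠ-acyclic Lexᶠ-coh

  module TD = TypedDerivations (Fin k) Σₐ litBdᶠ Lexᶠ

  constD : ∀ c → AD.Deriv (typeOf Σₐ c ⁺ᵗ ∷ [])
  constD c = AD.lex (constEntry c) (∈-map⁺ constEntry (∈-allFin c))

  termD : ∀ {t A} → Typed Σₐ [] t A → AD.Deriv (A ⁺ᵗ ∷ [])
  termD = TD.trD constD

  module _ (𝓐 : Action (Fin k)) where
    open Action 𝓐
    open Sat 𝓐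
    open InterpretedReading D public
    open Relational (Fin k) n litBdᶠ Lexᶠ 𝓐 using (Rel; sat⇒Rel)

    ConstTy : Fin (nC Σₐ) → STy PR.RL → Set
    ConstTy c s = ∃ λ x → s ≡ PR.rt⁺ (typeOf Σₐ c) x × sat x (constEdges c)

    ConstTy-erase : ∀ c s → ConstTy c s → eraseTy proj₁ s ≡ typeOf Σₐ c
    ConstTy-erase c s (x , refl , _) = PR.erase-rt⁺ (typeOf Σₐ c) x

    refine-term : ∀ {t A} (d : Typed Σₐ [] t A) x → sat x (proj₁ (AD.interp (termD d))) → STyped ConstTy [] t (PR.rt⁺ A x)
    refine-term {t} {A} d x h
      with TD.Rel-trD constD 𝓐 constR d (sat⇒Rel Lexᶠ-matching (termD d) (interp-acyclic (termD d)) x h)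
      where
      constR : ∀ c {Θ} → Rel (constD c) Θ → ∃ λ s → Θ ≡ s ⁺ᶠ ∷ [] × ConstTy c s
      constR c (x , refl , h) = _ , cong (_∷ []) (PR.rf-rt⁺ (typeOf Σₐ c) x) , x , refl , h
    ... | Ξ , s , e , m , dt with map≡[] Ξ m
    ... | refl with ⁺ᶠ-injective (PR.rt⁺ A x) s (trans (sym (PR.rf-rt⁺ A x)) (proj₁ (∷-injective e)))
    ... | refl = dt

    -- A solution at a constant also solves the derivation of its image, which therefore has the
    -- unfolded type by `closed-sat`.
    object-typing : ∀ {t s} → STyped ConstTy [] t s → STyped (LetterTy 𝓐) [] (mapTm (φ G) t) (bindS unfold s)
    object-typing = STyped-bind unfold (mapTm (φ G)) (λ _ → refl) (λ _ _ → refl) (λ _ _ → refl) const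
      where
      const : ∀ c s → ConstTy c s → STyped (LetterTy 𝓐) [] (SigMap.G (φ G) c) (bindS unfold s)
      const c s (x , refl , h) = subst (STyped (LetterTy 𝓐) [] (SigMap.G (φ G) c)) (sym (unfold-rt⁺ (typeOf Σₐ c) x))
        (closed-sat 𝓐 (G-typed (φ G) c) _ (sat-κ 𝓐 c x h))

    open Naming ConstTy using (Ax; name-closed)

    Rel⇒MLL : ∀ {Γ} (d : AD.Deriv Γ) {Θ} → Rel d Θ → MLL Ax Θ
    Rel⇒MLL (AD.lex e i) (x , refl , h) with ∈Lexᶠ i
    ... | c , refl = subst (λ a → MLL Ax (a ∷ [])) (sym (PR.rf-rt⁺ (typeOf Σₐ c) x)) (axiom (c , x , refl , h))
    Rel⇒MLL (AD.idR A) (a , _ , refl) = ident a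
    Rel⇒MLL (AD.cut A d₁ d₂) (Θ₁ , Θ₂ , a , refl , r₁ , r₂) = cut a (Rel⇒MLL d₁ r₁) (Rel⇒MLL d₂ r₂)
    Rel⇒MLL (AD.exR Γ A B d) (Θ₁ , a , b , Θ₂ , refl , _ , r) = exch Θ₁ a b (Rel⇒MLL d r)
    Rel⇒MLL (AD.parR Γ A B d) (Θ₁ , a , b , refl , r) = par Θ₁ a b (Rel⇒MLL d r)
    Rel⇒MLL (AD.tenR Γ A B d₁ d₂) (Θ₁ , a , b , Θ₂ , refl , r₁ , r₂) = ten Θ₁ a b (Rel⇒MLL d₁ r₁) (Rel⇒MLL d₂ r₂)

    extract-term : ∀ {p} (d : AD.Deriv (pos p ∷ [])) x → sat x (proj₁ (AD.interp d)) →
                   ∃ λ t → STyped ConstTy [] t (at (p , Vec.tabulate x))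
    extract-term d x h = name-closed (Conservativity.conservative Ax
      (Rel⇒MLL d (sat⇒Rel Lexᶠ-matching d (interp-acyclic d) x h)))

-- Start type str

strTy : Ty 1
strTy = atom zero ⊸ atom zero

-- The value at a vertex is the word still to be read from there; following an edge removes its
-- label.
wordAction : (T : Set) → Action T
wordAction T = record
  { D = List T ; W = λ w x y → x ≡ w ++ y ; default = []
  ; W-nil = id  ; W-split = λ w {w'} {x} {y} e → w' ++ y , trans e (++-assoc w w' y) , refl }

Append : ∀ {k} → Fin k → List (Fin k) → List (Fin k) → Set
Append c x y = y ≡ c ∷ x

module _ {k : ℕ} where
  open FilterModel (List (Fin k)) Append using (QTy; Q*; convertible-ρ)

  Q*-word : ∀ w {x y} → Q* w x y → y ≡ w ++ x
  Q*-word [] refl = refl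
  Q*-word (c ∷ w) (z , q , refl) = cong (c ∷_) (Q*-word w q)

  Letter⇒QTy : ∀ {t : Tm k} {s} → STyped Letter [] t s → STyped QTy [] t s
  Letter⇒QTy {t} {s} d = subst (STyped QTy [] t) (bind-at s)
    (STyped-bind at id (λ _ → refl) (λ _ _ → refl) (λ _ _ → refl) (λ { c _ (v , refl) → cn (v , c ∷ v , refl , refl) }) d)
    where
    bind-at : ∀ {L : Set} (s : STy L) → bindS at s ≡ s
    bind-at (at l) = refl
    bind-at (a ⊸ˢ b) = cong₂ _⊸ˢ_ (bind-at a) (bind-at b)

  -- If the type is an identity, both words are empty; otherwise the path from `[]` to `w'` spells
  -- `w`.
  word-unique : ∀ {w w'} {t : Tm k} → ρ w ≈βη t → STyped Letter [] t (at [] ⊸ˢ at w') → w ≡ w'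
  word-unique {w} r d with convertible-ρ {w} r (Letter⇒QTy d)
  ... | inj₁ (refl , _ , refl) = refl
  ... | inj₂ (_ , _ , refl , q) = trans (sym (++-identityʳ w)) (sym (Q*-word w q))

module _ (k : ℕ) where
  open StrGrammar k
  module SG = DerivationMatching (Fin k) 1 litO lexO
  open TypePositions.TypeReading (Fin k) 1 litO (List (Fin k)) using (rt⁺; RL)
  open Sat (wordAction (Fin k))

  -- Counting ends at the two vertices leaves one edge, from 0 to 1. `B` is a variable so that its
  -- equation with `strTy` can be matched; for `F S` it holds only propositionally.
  single-edge : ∀ B → B ≡ strTy → (es : List (Edge (Fin k) (Fin (SG.sz (B ⁺ᵗ ∷ []))))) → Matching SG.⟦ B ⁺ᵗ ∷ [] ⟧ᶜ es →
    ∃ λ i → ∃ λ w → ∃ λ j → es ≡ (i , w , j) ∷ [] ×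
      (∃ λ x → sat x es × rt⁺ B x ≡ (at (zero , [] ∷ []) ⊸ˢ at (zero , w ∷ [])))
  single-edge _ refl [] m with m true zero
  ... | ()
  single-edge _ refl ((suc zero , w , j) ∷ es) m with m true (suc zero)
  ... | ()
  single-edge _ refl ((zero , w , zero) ∷ es) m with m false zero
  ... | ()
  single-edge _ refl ((zero , w , suc zero) ∷ (zero , _) ∷ es) m with m true zero
  ... | ()
  single-edge _ refl ((zero , w , suc zero) ∷ (suc zero , _) ∷ es) m with m true (suc zero)
  ... | ()
  single-edge _ refl ((zero , w , suc zero) ∷ []) m =
    zero , w , suc zero , refl , (λ { zero → w ; (suc _) → [] }) , (sym (++-identityʳ w) ∷ []) , refl

  toWord : RL → STy (List (Fin k))
  toWord (_ , u ∷ []) = at u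

  LetterTy⇒Letter : ∀ {t s} → STyped (LetterTy (wordAction (Fin k))) [] t s → STyped Letter [] t (bindS toWord s)
  LetterTy⇒Letter = STyped-bind toWord id (λ _ → refl) (λ _ _ → refl) (λ _ _ → refl)
    λ { c _ (u , v , refl , refl) → cn (u , refl) }

module StrCase (k : ℕ) (G : StringACG k) (FS : F (φ G) (S G) ≡ strTy) where
  open Grammar k G
  open Sat (wordAction (Fin k))
  open InterpretedReading (List (Fin k)) hiding (module PR; module OR)
  module R = InterpretedReading (List (Fin k))

  grammar : LLG (Fin k)
  grammar = record
    { nLit = n ; litBd = litBdᶠ ; lexicon = Lexᶠ ; start = S G
    ; start-size = cong (λ B → OD.∣ B ⁺ᵗ ∣) FS
    ; start-left = trans (cong (λ B → numLeft OD.⟦ B ⁺ᵗ ⟧) FS) refl }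

  word-typing : ∀ {t x w} → R.OR.rt⁺ (Fₐ (S G)) x ≡ (at (zero , [] ∷ []) ⊸ˢ at (zero , w ∷ [])) →
                STyped (ConstTy (wordAction (Fin k))) [] t (at (S G , Vec.tabulate x)) →
                STyped Letter [] (mapTm (φ G) t) (at [] ⊸ˢ at w)
  word-typing {t} {x} e d = LetterTy⇒Letter k (subst (STyped _ [] (mapTm (φ G) t))
    (trans (R.OR.rt⁺-cong (Fₐ (S G)) (VecP.lookup∘tabulate x)) e) (object-typing (wordAction (Fin k)) d))

  to : ∀ w → LangACG G w → LangLLG grammar w
  to w (t , d , r)
    with single-edge k (Fₐ (S G)) FS _ (AD.interp-matching Lexᶠ-matching (termD d))
  ... | i , w' , j , e , x , h , rx with word-unique {w = w} r (word-typing {w = w'} rx (refine-term (wordAction (Fin k)) d x h))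
  ... | refl = termD d , interp-acyclic (termD d) , i , j , e

  from : ∀ w → LangLLG grammar w → LangACG G w
  from w (d , _ , i , j , e)
    with single-edge k (Fₐ (S G)) FS _ (AD.interp-matching Lexᶠ-matching d)
  ... | i' , w' , j' , e' , x , h , rx with trans (sym e) e'
  ... | refl with extract-term (wordAction (Fin k)) d x h
  ... | t , dt = t , STyped⇒Typed proj₁ (ConstTy-erase (wordAction (Fin k))) dt , typed⇒≈ρ (word-typing {t} {x} {w'} rx dt)

  str-theorem : Σ (LLG (Fin k)) (λ G' → ∀ w → LangACG G w ⇔ LangLLG G' w)
  str-theorem = grammar , λ w → mk⇔ (to w) (from w)

-- Start types other than str

-- Edges transport colours unchanged, so colours record which vertices are joined; words are read as
-- in `wordAction`.
colourAction : (T : Set) → Action T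
colourAction T = record
  { D = ℕ × List T ; W = λ w x y → proj₁ x ≡ proj₁ y × proj₂ x ≡ w ++ proj₂ y ; default = 0 , []
  ; W-nil = λ { {_ , _} {_ , _} (refl , refl) → refl }
  ; W-split = λ { w {w'} {_} {c , u} (refl , e) → (c , w' ++ u) , (refl , trans e (++-assoc w w' u)) , refl , refl } }

module _ {T : Set} {m : ℕ} where
  open Counting (FinP._≟_ {m})

  -- The colour of an edge is its target.
  colouring : List (Edge T (Fin m)) → Fin m → ℕ × List T
  colouring [] v = toℕ v , []
  colouring ((i , w , j) ∷ es) v with v FinP.≟ i
  ... | yes _ = toℕ j , w
  ... | no _ = colouring es v

  colouring-target : ∀ es {v} → cnt v (ends true es) ≡ 0 → colouring es v ≡ (toℕ v , [])
  colouring-target [] h = refl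
  colouring-target ((i , w , j) ∷ es) {v} h with v FinP.≟ i
  colouring-target ((i , w , j) ∷ es) {v} () | yes _
  ... | no _ = colouring-target es h

  colouring-source : ∀ es {i w j} → cnt i (ends true es) ≡ 1 → (i , w , j) ∈ es → colouring es i ≡ (toℕ j , w)
  colouring-source ((i' , w' , j') ∷ es) {i} h e with i FinP.≟ i'
  colouring-source ((i' , w' , j') ∷ es) {i} h (here refl) | yes _ = refl
  colouring-source ((i' , w' , j') ∷ es) {i} h (there e) | yes _ =
    ⊥-elim (cnt-∈ (ends true es) (∈-map⁺ (end true) e) (NatP.suc-injective h))
  colouring-source ((i' , w' , j') ∷ es) {i} h (here refl) | no n = ⊥-elim (n refl)
  colouring-source ((i' , w' , j') ∷ es) {i} h (there e) | no n = colouring-source es h e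

module _ {T : Set} (X : Bd) (es : List (Edge T (Fin (size X)))) (m : Matching X es) where

  colour-right : ∀ {v} → left X v ≡ false → colouring es v ≡ (toℕ v , [])
  colour-right {v} l = colouring-target es (trans (m true v) (cong b2n l))

  colour-edge : ∀ {i w j} → (i , w , j) ∈ es → colouring es i ≡ (toℕ j , w) × colouring es j ≡ (toℕ j , [])
  colour-edge {i} {w} {j} e =
    colouring-source es (trans (m true i) (cong b2n (matching-left X es m true e))) e
    , colour-right (not-true (matching-left X es m false e))
    where
    not-true : ∀ {b} → not b ≡ true → b ≡ false
    not-true {false} _ = refl

  colouring-sat : Sat.sat (colourAction T) (colouring es) es
  colouring-sat = All.tabulate λ { {i , w , j} e → eq (colour-edge e) }
    where
    eq : ∀ {i w j} → colouring es i ≡ (toℕ j , w) × colouring es j ≡ (toℕ j , []) →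
         proj₁ (colouring es i) ≡ proj₁ (colouring es j) × proj₂ (colouring es i) ≡ w ++ proj₂ (colouring es j)
    eq {w = w} (p , q) rewrite p | q = refl , sym (++-identityʳ w)

-- Only ε relates any values, and there are finitely many of them, so the refined signature is
-- finite. The `K` colours proper are the successors; `zero` is the default.
pureAction : (T : Set) → ℕ → Action T
pureAction T K = record
  { D = Fin (suc K) ; W = λ w x y → w ≡ [] × x ≡ y ; default = zero
  ; W-nil = proj₂
  ; W-split = λ { w {w'} (e , refl) → _ , (++-conicalˡ w w' e , refl) , ++-conicalʳ w w' e , refl } }

module _ (k : ℕ) where
  open StrGrammar k
  open TypePositions (Fin k) 1 litO hiding (Entry; module Entry; module Derivations)

  headAtom : ∀ {D M : Set} → (D → M) → TypeReading.RL D → STy M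
  headAtom f (_ , u ∷ []) = at (f u)

  module _ {D : Set} where
    open TypeReading D

    headAtom-injective : ∀ (s s' : STy RL) → bindS (headAtom id) s ≡ bindS (headAtom id) s' → s ≡ s'
    headAtom-injective (at (zero , u ∷ [])) (at (zero , .u ∷ [])) refl = refl
    headAtom-injective (at (zero , u ∷ [])) (a ⊸ˢ b) ()
    headAtom-injective (a ⊸ˢ b) (at (zero , u ∷ [])) ()
    headAtom-injective (a ⊸ˢ b) (a' ⊸ˢ b') e = cong₂ _⊸ˢ_ (headAtom-injective a a' (l e)) (headAtom-injective b b' (r e))
      where
      l : ∀ {a b a' b' : STy D} → (a ⊸ˢ b) ≡ (a' ⊸ˢ b') → a ≡ a'
      l refl = refl
      r : ∀ {a b a' b' : STy D} → (a ⊸ˢ b) ≡ (a' ⊸ˢ b') → b ≡ b'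
      r refl = refl

    erase-head : ∀ (s : STy RL) → eraseTy (λ _ → zero) (bindS (headAtom id) s) ≡ eraseTy {n = 1} proj₁ s
    erase-head (at (zero , u ∷ [])) = refl
    erase-head (a ⊸ˢ b) = cong₂ _⊸_ (erase-head a) (erase-head b)

    mutual
      rt⁺-injective : ∀ A {x y : Fin ∣ A ⁺ᵗ ∣ → D} → rt⁺ A x ≡ rt⁺ A y → ∀ i → x i ≡ y i
      rt⁺-injective (atom zero) {x} {y} e i = trans (sym (VecP.lookup∘tabulate x i)) (trans (cong (λ { (at (zero , v)) → Vec.lookup v i ; (_ ⊸ˢ _) → x i }) e) (VecP.lookup∘tabulate y i))
      rt⁺-injective (A ⊸ B) e v with ⊸-inj e | splitP (A ⁻ᵗ) (B ⁺ᵗ) v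
      ... | p , q | isA i = rt⁻-injective A p i
      ... | p , q | isB j = rt⁺-injective B q j

      rt⁻-injective : ∀ A {x y : Fin ∣ A ⁻ᵗ ∣ → D} → rt⁻ A x ≡ rt⁻ A y → ∀ i → x i ≡ y i
      rt⁻-injective (atom zero) {x} {y} e zero = cong (λ { (at (zero , v)) → Vec.lookup v zero ; (_ ⊸ˢ _) → x zero }) e
      rt⁻-injective (A ⊸ B) e v with ⊸-inj e | splitV ∣ A ⁺ᵗ ∣ v
      ... | p , q | isˡ i = rt⁺-injective A p i
      ... | p , q | isʳ j = rt⁻-injective B q j

      ⊸-inj : ∀ {a b a' b' : STy RL} → (a ⊸ˢ b) ≡ (a' ⊸ˢ b') → a ≡ a' × b ≡ b'
      ⊸-inj refl = refl , refl

  mirrorᵗ : ∀ E → Fin ∣ E ⁻ᵗ ∣ → Fin ∣ E ⁺ᵗ ∣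
  mirrorᵗ E j = opposite (cast (size⁺⁻ E) j)

  mirrorᵗ-mirror : ∀ E j → Mirror (mirrorᵗ E j) j
  mirrorᵗ-mirror E j = trans (cong suc (NatP.+-comm (toℕ (mirrorᵗ E j)) (toℕ j)))
    (trans (cong (λ l → suc (l + toℕ (mirrorᵗ E j))) (sym (FinP.toℕ-cast (size⁺⁻ E) j))) (opposite-mirror (cast (size⁺⁻ E) j)))

  mirrorᵗ-unique : ∀ E {i j} → Mirror i j → mirrorᵗ E j ≡ i
  mirrorᵗ-unique E {i} {j} m = FinP.toℕ-injective (NatP.+-cancelʳ-≡ (suc (toℕ j)) _ _
    (trans (NatP.+-suc (toℕ (mirrorᵗ E j)) (toℕ j)) (trans (trans (mirrorᵗ-mirror E j) (sym m)) (sym (NatP.+-suc (toℕ i) (toℕ j))))))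

  -- the point (v , v) of E ⊸ E, where v has pairwise distinct colours
  diagonal : ∀ E → Fin ∣ (E ⊸ E) ⁺ᵗ ∣ → Fin (suc ∣ E ⁺ᵗ ∣)
  diagonal E v with splitP (E ⁻ᵗ) (E ⁺ᵗ) v
  ... | isA j = suc (mirrorᵗ E j)
  ... | isB i = suc i

  diagonal-A : ∀ E j → diagonal E (inPA (E ⁻ᵗ) (E ⁺ᵗ) j) ≡ suc (mirrorᵗ E j)
  diagonal-A E j = go refl
    where
    go : ∀ {v} → inPA (E ⁻ᵗ) (E ⁺ᵗ) j ≡ v → diagonal E v ≡ suc (mirrorᵗ E j)
    go {v} e with splitP (E ⁻ᵗ) (E ⁺ᵗ) v
    ... | isA j' = cong (λ l → suc (mirrorᵗ E l)) (sym (FinP.toℕ-injective (NatP.+-cancelˡ-≡ ∣ E ⁺ᵗ ∣ _ _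
          (trans (sym (toℕ-inPA (E ⁻ᵗ) (E ⁺ᵗ) j)) (trans (cong toℕ e) (toℕ-inPA (E ⁻ᵗ) (E ⁺ᵗ) j'))))))
    ... | isB i = ⊥-elim (NatP.<-irrefl (trans (sym (toℕ-inPB (E ⁻ᵗ) (E ⁺ᵗ) i)) (trans (cong toℕ (sym e)) (toℕ-inPA (E ⁻ᵗ) (E ⁺ᵗ) j)))
          (NatP.<-≤-trans (FinP.toℕ<n i) (NatP.m≤m+n ∣ E ⁺ᵗ ∣ (toℕ j))))

  diagonal-B : ∀ E i → diagonal E (inPB (E ⁻ᵗ) (E ⁺ᵗ) i) ≡ suc i
  diagonal-B E i = go refl
    where
    go : ∀ {v} → inPB (E ⁻ᵗ) (E ⁺ᵗ) i ≡ v → diagonal E v ≡ suc i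
    go {v} e with splitP (E ⁻ᵗ) (E ⁺ᵗ) v
    ... | isB i' = cong suc (sym (FinP.toℕ-injective (trans (sym (toℕ-inPB (E ⁻ᵗ) (E ⁺ᵗ) i)) (trans (cong toℕ e) (toℕ-inPB (E ⁻ᵗ) (E ⁺ᵗ) i')))))
    ... | isA j = ⊥-elim (NatP.<-irrefl (trans (sym (toℕ-inPB (E ⁻ᵗ) (E ⁺ᵗ) i)) (trans (cong toℕ e) (toℕ-inPA (E ⁻ᵗ) (E ⁺ᵗ) j)))
          (NatP.<-≤-trans (FinP.toℕ<n i) (NatP.m≤m+n ∣ E ⁺ᵗ ∣ (toℕ j))))

  -- A matching all of whose colourings are diagonal is the identity, so the diagonal point solves it.
  diagonal-sat : ∀ E (es : List (Edge (Fin k) (Fin ∣ (E ⊸ E) ⁺ᵗ ∣))) → Matching ⟦ (E ⊸ E) ⁺ᵗ ∷ [] ⟧ᶜ es → ∀ {a} →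
    bindS (headAtom id) (TypeReading.rt⁺ _ (E ⊸ E) (colouring es)) ≡ (a ⊸ˢ a) →
    Sat.sat (pureAction (Fin k) ∣ E ⁺ᵗ ∣) (diagonal E) es
  diagonal-sat E es m {a} eq = All.tabulate λ { {i , w , j} e → edge e (splitP (E ⁻ᵗ) (E ⁺ᵗ) i) }
    where
    open TypeReading (ℕ × List (Fin k))
    X = ⟦ (E ⊸ E) ⁺ᵗ ∷ [] ⟧ᶜ
    col = colouring es
    pA = inPA (E ⁻ᵗ) (E ⁺ᵗ)
    pB = inPB (E ⁻ᵗ) (E ⁺ᵗ)
    parts : ∀ {a' b' c : STy (ℕ × List (Fin k))} → (a' ⊸ˢ b') ≡ (c ⊸ˢ c) → a' ≡ b'
    parts refl = refl
    same : rt⁻ E (col ∘ pA) ≡ rt⁺ E (col ∘ pB)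
    same = headAtom-injective _ _ (parts eq)
    agree : ∀ j → col (pA j) ≡ col (pB (mirrorᵗ E j))
    agree = rt⁻-injective E (trans same (rt-mirror E λ i j mi → cong (col ∘ pB) (sym (mirrorᵗ-unique E mi))))
    opposite-left : ∀ {u v} → left X u ≡ not (left X v) → left X v ≡ true → left X u ≡ false
    opposite-left p q = trans p (cong not q)
    -- The mirror image of a left endpoint is a right endpoint, whose value is its own index with ε.
    -- Mirrored vertices have equal values, so the edge ends at the mirror image of its source and
    -- has label ε.
    edge : ∀ {i w j} → (i , w , j) ∈ es → SplitP (E ⁻ᵗ) (E ⁺ᵗ) i → w ≡ [] × diagonal E i ≡ diagonal E j
    edge {_} {w} {j} e (isA i) = cong proj₂ q , trans (diagonal-A E i) (trans (sym (diagonal-B E (mirrorᵗ E i))) (cong (diagonal E) (sym (FinP.toℕ-injective (cong proj₁ q)))))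
      where
      rt : left X (pB (mirrorᵗ E i)) ≡ false
      rt = opposite-left {pB (mirrorᵗ E i)} {pA i} (trans (left-PB (E ⁻ᵗ) (E ⁺ᵗ) (mirrorᵗ E i)) (sym (trans (cong not (trans (left-PA (E ⁻ᵗ) (E ⁺ᵗ) i) (left-dualᵗ E (mirrorᵗ-mirror E i)))) (BoolP.not-involutive _))))
             (matching-left X es m true e)
      q : (toℕ j , w) ≡ (toℕ (pB (mirrorᵗ E i)) , [])
      q = trans (sym (proj₁ (colour-edge X es m e))) (trans (agree i) (colour-right X es m rt))
    edge {_} {w} {j} e (isB i) = cong proj₂ q , trans (diagonal-B E i) (trans (cong suc (sym (mirrorᵗ-unique E mi))) (trans (sym (diagonal-A E i')) (cong (diagonal E) (sym (FinP.toℕ-injective (cong proj₁ q))))))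
      where
      i' = cast (sym (size⁺⁻ E)) (opposite i)
      mi : Mirror i i'
      mi = trans (cong (λ l → suc (toℕ i + l)) (FinP.toℕ-cast (sym (size⁺⁻ E)) (opposite i))) (opposite-mirror i)
      rt : left X (pA i') ≡ false
      rt = opposite-left {pA i'} {pB i} (trans (left-PA (E ⁻ᵗ) (E ⁺ᵗ) i') (trans (left-dualᵗ E mi) (cong not (sym (left-PB (E ⁻ᵗ) (E ⁺ᵗ) i)))))
             (matching-left X es m true e)
      q : (toℕ j , w) ≡ (toℕ (pA i') , [])
      q = trans (sym (proj₁ (colour-edge X es m e))) (trans (cong (col ∘ pB) (sym (mirrorᵗ-unique E mi))) (trans (sym (agree i')) (colour-right X es m rt)))

  module _ {D : Set} (f : D → ℕ) where
    open TypeReading D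

    shape : STy RL → STy ℕ
    shape = bindS (headAtom f)

    colours : STy ℕ → List ℕ
    colours a = tgt a ∷ nontgt a

    colours-⊸ : ∀ a b {c} → c ∈ colours (a ⊸ˢ b) → c ∈ colours a ⊎ c ∈ colours b
    colours-⊸ a b (here e) = inj₂ (here e)
    colours-⊸ a b (there i) with ∈-++⁻ (colours a) i
    ... | inj₁ j = inj₁ j
    ... | inj₂ j = inj₂ (there j)

    mutual
      colours⁺ : ∀ A x {c} → c ∈ colours (shape (rt⁺ A x)) → ∃ λ i → f (x i) ≡ c
      colours⁺ (atom zero) x (here e) = zero , sym e
      colours⁺ (A ⊸ B) x i with colours-⊸ (shape (rt⁻ A _)) (shape (rt⁺ B _)) i
      ... | inj₁ j = let (v , e) = colours⁻ A _ j in inPA (A ⁻ᵗ) (B ⁺ᵗ) v , e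
      ... | inj₂ j = let (v , e) = colours⁺ B _ j in inPB (A ⁻ᵗ) (B ⁺ᵗ) v , e

      colours⁻ : ∀ A x {c} → c ∈ colours (shape (rt⁻ A x)) → ∃ λ i → f (x i) ≡ c
      colours⁻ (atom zero) x (here e) = zero , sym e
      colours⁻ (A ⊸ B) x i with colours-⊸ (shape (rt⁺ A _)) (shape (rt⁻ B _)) i
      ... | inj₁ j = let (v , e) = colours⁺ A _ j in v ↑ˡ ∣ B ⁻ᵗ ∣ , e
      ... | inj₂ j = let (v , e) = colours⁻ B _ j in ∣ A ⁺ᵗ ∣ ↑ʳ v , e

    generic-⊸ : ∀ a b → Generic a → Generic b → (∀ {c} → c ∈ colours a → c ∉ colours b) → Generic (a ⊸ˢ b)
    generic-⊸ a b ga (pb ∷ gb) dis =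
      AllP.++⁺ (All.tabulate λ i e → dis i (here (sym e))) pb ∷ UniqueP.++⁺ ga gb λ (i , j) → dis i (there j)

    mutual
      generic⁺ : ∀ A x → (∀ {i j} → f (x i) ≡ f (x j) → i ≡ j) → Generic (shape (rt⁺ A x))
      generic⁺ (atom zero) x inj = [] ∷ []
      generic⁺ (A ⊸ B) x inj = generic-⊸ (shape (rt⁻ A xA)) (shape (rt⁺ B xB))
        (generic⁻ A xA λ {i} {j} e → FinP.toℕ-injective (NatP.+-cancelˡ-≡ ∣ B ⁺ᵗ ∣ _ _ (trans (sym (toℕ-inPA (A ⁻ᵗ) (B ⁺ᵗ) i)) (trans (cong toℕ (inj e)) (toℕ-inPA (A ⁻ᵗ) (B ⁺ᵗ) j)))))
        (generic⁺ B xB λ {i} {j} e → FinP.toℕ-injective (trans (sym (toℕ-inPB (A ⁻ᵗ) (B ⁺ᵗ) i)) (trans (cong toℕ (inj e)) (toℕ-inPB (A ⁻ᵗ) (B ⁺ᵗ) j))))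
        λ i j → let (u , e) = colours⁻ A xA i ; (v , e') = colours⁺ B xB j in
          NatP.<-irrefl (trans (sym (toℕ-inPB (A ⁻ᵗ) (B ⁺ᵗ) v)) (trans (cong toℕ (inj (trans e' (sym e)))) (toℕ-inPA (A ⁻ᵗ) (B ⁺ᵗ) u)))
            (NatP.<-≤-trans (FinP.toℕ<n v) (NatP.m≤m+n ∣ B ⁺ᵗ ∣ (toℕ u)))
        where
        xA = x ∘ inPA (A ⁻ᵗ) (B ⁺ᵗ)
        xB = x ∘ inPB (A ⁻ᵗ) (B ⁺ᵗ)

      generic⁻ : ∀ A x → (∀ {i j} → f (x i) ≡ f (x j) → i ≡ j) → Generic (shape (rt⁻ A x))
      generic⁻ (atom zero) x inj = [] ∷ []
      generic⁻ (A ⊸ B) x inj = generic-⊸ (shape (rt⁺ A xA)) (shape (rt⁻ B xB))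
        (generic⁺ A xA λ {i} {j} e → FinP.↑ˡ-injective ∣ B ⁻ᵗ ∣ i j (inj e))
        (generic⁻ B xB λ {i} {j} e → FinP.↑ʳ-injective ∣ A ⁺ᵗ ∣ i j (inj e))
        λ i j → let (u , e) = colours⁺ A xA i ; (v , e') = colours⁻ B xB j in
          NatP.<-irrefl (trans (sym (FinP.toℕ-↑ˡ u ∣ B ⁻ᵗ ∣)) (trans (cong toℕ (inj (trans e (sym e')))) (FinP.toℕ-↑ʳ ∣ A ⁺ᵗ ∣ v)))
            (NatP.<-≤-trans (FinP.toℕ<n u) (NatP.m≤m+n ∣ A ⁺ᵗ ∣ (toℕ v)))
        where
        xA = x ∘ (_↑ˡ ∣ B ⁻ᵗ ∣)
        xB = x ∘ (∣ A ⁺ᵗ ∣ ↑ʳ_)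

  diagonal-point : ∀ E → ∃ λ v → Generic v ×
    bindS (headAtom toℕ) (TypeReading.rt⁺ (Fin (suc ∣ E ⁺ᵗ ∣)) (E ⊸ E) (diagonal E)) ≡ (v ⊸ˢ v)
  diagonal-point E = bindS (headAtom toℕ) (rt⁺ E suc) , generic⁺ toℕ E suc (λ e → FinP.suc-injective (FinP.toℕ-injective e))
    , cong₂ _⊸ˢ_ (cong (bindS (headAtom toℕ)) (trans (rt⁻-cong E (diagonal-A E)) (sym (rt-mirror E λ i j m → cong suc (sym (mirrorᵗ-unique E m))))))
                  (cong (bindS (headAtom toℕ)) (rt⁺-cong E (diagonal-B E)))
    where open TypeReading (Fin (suc ∣ E ⁺ᵗ ∣))

-- Every type over str has a canonical closed linear inhabitant: str can be erased by
-- composing it with the result, and every type can be mapped to str.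
module _ {n m : ℕ} where
  mutual
    inhabit discard compose : Ty n → Tm m
    inhabit (atom p) = lam 0 (var 0)
    inhabit (A ⊸ B)  = lam 0 (app (app (compose B) (app (discard A) (var 0))) (inhabit B))

    discard (atom p) = lam 0 (var 0)
    discard (A ⊸ B)  = lam 0 (app (discard B) (app (var 0) (inhabit A)))

    compose (atom p) = lam 0 (lam 1 (lam 2 (app (var 0) (app (var 1) (var 2)))))
    compose (A ⊸ B)  = lam 0 (lam 1 (lam 2 (app (app (compose B) (var 0)) (app (var 1) (var 2)))))

  module _ {L : Set} (o : L) (R : Fin m → STy L → Set) where

    strS : STy L
    strS = at o ⊸ˢ at o

    overStr : Ty n → STy L
    overStr (atom p) = strS
    overStr (A ⊸ B)  = overStr A ⊸ˢ overStr B

    private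
      u₁ : Unique (0 ∷ [])
      u₁ = [] ∷ []
      u₂ : Unique (1 ∷ 2 ∷ [])
      u₂ = ((λ ()) ∷ []) ∷ [] ∷ []
      u₃ : Unique (0 ∷ 1 ∷ 2 ∷ [])
      u₃ = ((λ ()) ∷ (λ ()) ∷ []) ∷ u₂

    mutual
      inhabit-typed : ∀ A → STyped R [] (inhabit A) (overStr A)
      inhabit-typed (atom p) = lam {Γ = []} {Δ = []} ax
      inhabit-typed (A ⊸ B) = lam {Γ = []} {Δ = []}
        (app (app (compose-typed B) (app (discard-typed A) ax u₁) u₁) (inhabit-typed B) u₁)

      discard-typed : ∀ A → STyped R [] (discard A) (overStr A ⊸ˢ strS)
      discard-typed (atom p) = lam {Γ = []} {Δ = []} ax
      discard-typed (A ⊸ B) = lam {Γ = []} {Δ = []} (app (discard-typed B) (app ax (inhabit-typed A) u₁) u₁)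

      compose-typed : ∀ A → STyped R [] (compose A) (strS ⊸ˢ (overStr A ⊸ˢ overStr A))
      compose-typed (atom p) = lam {Γ = []} {Δ = []} (lam {Γ = _ ∷ []} {Δ = []} (lam {Γ = _ ∷ _ ∷ []} {Δ = []}
        (app ax (app ax ax u₂) u₃)))
      compose-typed (A ⊸ B) = lam {Γ = []} {Δ = []} (lam {Γ = _ ∷ []} {Δ = []} (lam {Γ = _ ∷ _ ∷ []} {Δ = []}
        (app (app (compose-typed B) ax u₁) (app ax ax u₂) u₃)))

toS : ∀ {n} → Ty n → STy (Fin n)
toS (atom p) = at p
toS (A ⊸ B)  = toS A ⊸ˢ toS B

Typed⇒STyped : ∀ {sg Γ t A} → Typed sg Γ t A → STyped (λ c s → s ≡ toS (typeOf sg c)) (mapCx toS Γ) t (toS A)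
Typed⇒STyped ax = ax
Typed⇒STyped (cn c) = cn refl
Typed⇒STyped (app {Γ} {Δ} {t} {s} {A} {B} d e u) =
  subst (λ Θ → STyped _ Θ (app t s) (toS B)) (sym (map-++ _ Γ Δ))
    (app (Typed⇒STyped d) (Typed⇒STyped e)
      (subst Unique (trans (sym (names-mapCx toS (Γ ++ Δ))) (cong (map proj₁) (map-++ _ Γ Δ))) u))
Typed⇒STyped (lam {Γ} {Δ} {x} {t} {A} {B} d) =
  subst (λ Θ → STyped _ Θ (lam x t) _) (sym (map-++ _ Γ Δ))
    (lam {Γ = mapCx toS Γ} (subst (λ Θ → STyped _ Θ t (toS B)) (map-++ _ Γ ((x , A) ∷ Δ)) (Typed⇒STyped d)))

mapCon : ∀ {m m'} → (Fin m → Fin m') → Tm m → Tm m'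
mapCon f (var x)   = var x
mapCon f (con c)   = con (f c)
mapCon f (app t s) = app (mapCon f t) (mapCon f s)
mapCon f (lam x t) = lam x (mapCon f t)

allVec : ∀ K m → List (Vec (Fin K) m)
allVec K zero    = [] ∷ []
allVec K (suc m) = concatMap (λ i → map (i ∷_) (allVec K m)) (allFin K)

∈-allVec : ∀ {K m} (v : Vec (Fin K) m) → v ∈ allVec K m
∈-allVec [] = here refl
∈-allVec {K} {suc m} (i ∷ v) = ∈-concatMap⁺ (λ i → map (i ∷_) (allVec K m)) (lose (∈-allFin i) (∈-map⁺ (i ∷_) (∈-allVec v)))

module NonString (k : ℕ) (G : StringACG k) (FS≢ : F (φ G) (S G) ≢ strTy) where
  open Grammar k G
  𝓒 = colourAction (Fin k)
  module FM = FilterModel (ℕ × List (Fin k)) {k} (λ c x y → proj₁ y ≡ proj₁ x × proj₂ y ≡ c ∷ proj₂ x)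
  module RC = InterpretedReading (ℕ × List (Fin k))

  termEdges : ∀ {t} → Typed Σₐ [] t (atom (S G)) → List (Edge (Fin k) (Fin (sz (pos (S G) ∷ []))))
  termEdges d = proj₁ (AD.interp (termD d))

  term-matching : ∀ {t} (d : Typed Σₐ [] t (atom (S G))) → Matching ⟦ pos (S G) ∷ [] ⟧ᶜ (termEdges d)
  term-matching d = AD.interp-matching Lexᶠ-matching (termD d)

  -- The colouring yields a refined type of `φ t` over `F S`. By `convertible-ρ` it is an identity
  -- type or an arrow between atoms, and the latter would make `F S` equal to str.
  identity-like : ∀ {w t} (d : Typed Σₐ [] t (atom (S G))) → ρ w ≈βη mapTm (φ G) t →
    w ≡ [] × ∃ λ a → bindS (headAtom k id) (RC.OR.rt⁺ (Fₐ (S G)) (colouring (termEdges d))) ≡ (a ⊸ˢ a)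
  identity-like {w} {t} d r with FM.convertible-ρ {w} r typing
    where
    x = colouring (termEdges d)
    letters : ∀ c s → StrGrammar.LetterTy k 𝓒 c s → STyped FM.QTy [] (con c) (bindS (headAtom k id) s)
    letters c _ (u , v , refl , e) = cn (u , v , refl , e)
    typing : STyped FM.QTy [] (mapTm (φ G) t) (bindS (headAtom k id) (RC.OR.rt⁺ (Fₐ (S G)) x))
    typing = STyped-bind (headAtom k id) id (λ _ → refl) (λ _ _ → refl) (λ _ _ → refl) letters
      (subst (STyped _ [] (mapTm (φ G) t)) (RC.OR.rt⁺-cong (Fₐ (S G)) (VecP.lookup∘tabulate x))
        (object-typing 𝓒 (refine-term 𝓒 d x (colouring-sat _ (termEdges d) (term-matching d)))))
  ... | inj₁ p = p
  ... | inj₂ (u , v , e , _) = ⊥-elim (FS≢ (trans (sym (trans (erase-head k (RC.OR.rt⁺ (Fₐ (S G)) _)) (RC.OR.erase-rt⁺ (Fₐ (S G)) _)))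
                                       (cong (eraseTy λ _ → zero) e)))

  not-endo⇒empty : (∀ E → Fₐ (S G) ≢ (E ⊸ E)) → ∀ {w} → ¬ LangACG G w
  not-endo⇒empty h {w} (t , d , r) with identity-like {w} d r
  ... | _ , a , e = h (eraseTy (λ _ → zero) a)
    (trans (sym (trans (erase-head k (RC.OR.rt⁺ (Fₐ (S G)) _)) (RC.OR.erase-rt⁺ (Fₐ (S G)) _))) (cong (eraseTy λ _ → zero) e))

  module Endo (E : Ty 1) (FS : Fₐ (S G) ≡ (E ⊸ E)) where
    module O1 = TypePositions (Fin k) 1 (StrGrammar.litO k)
    K = O1.∣ E ⁺ᵗ ∣
    𝓟 = pureAction (Fin k) K
    module RP = InterpretedReading (Fin (suc K))
    open Sat 𝓟

    -- This and the next two declarations abstract `F S` to a variable `B`, so that its equation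
    -- with `E ⊸ E` can be matched.
    diag : ∀ B → B ≡ (E ⊸ E) → Fin O1.∣ B ⁺ᵗ ∣ → Fin (suc K)
    diag _ refl = diagonal k E

    diag-sat : ∀ B (e : B ≡ (E ⊸ E)) (es : List (Edge (Fin k) (Fin O1.∣ B ⁺ᵗ ∣))) → Matching O1.⟦ B ⁺ᵗ ∷ [] ⟧ᶜ es → ∀ {a} →
      bindS (headAtom k id) (RC.OR.rt⁺ B (colouring es)) ≡ (a ⊸ˢ a) → sat (diag B e) es
    diag-sat _ refl = diagonal-sat k E

    diag-point : ∀ B (e : B ≡ (E ⊸ E)) → ∃ λ v → Generic v × bindS (headAtom k toℕ) (RP.OR.rt⁺ B (diag B e)) ≡ (v ⊸ˢ v)
    diag-point _ refl = diagonal-point k E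

    vv = diag (Fₐ (S G)) FS

    atoms : List RP.PR.RL
    atoms = concatMap (λ p → map (p ,_) (allVec (suc K) (size (litBdᶠ p)))) (allFin n)

    ∈-atoms : ∀ l → l ∈ atoms
    ∈-atoms (p , v) = ∈-concatMap⁺ (λ p → map (p ,_) (allVec (suc K) (size (litBdᶠ p)))) (lose (∈-allFin p) (∈-map⁺ (p ,_) (∈-allVec v)))

    encode : STy RP.PR.RL → Ty (length atoms)
    encode (at l)    = atom (Any.index (∈-atoms l))
    encode (a ⊸ˢ b) = encode a ⊸ encode b

    decode : Fin (length atoms) → STy RP.PR.RL
    decode i = at (lookup atoms i)

    decode-encode : ∀ s → bindS decode (toS (encode s)) ≡ s
    decode-encode (at l) = cong at (sym (AnyP.lookup-index (∈-atoms l)))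
    decode-encode (a ⊸ˢ b) = cong₂ _⊸ˢ_ (decode-encode a) (decode-encode b)

    Const : Set
    Const = Σ (Fin (nC Σₐ)) λ c → Σ (Vec (Fin (suc K)) ∣ typeOf Σₐ c ⁺ᵗ ∣) λ v → sat (Vec.lookup v) (constEdges c)

    sat? : ∀ {V : Set} (x : V → Fin (suc K)) es → Dec (sat x es)
    sat? x = All.all? λ { (i , [] , j) → dec (x i) (x j) ; (i , _ ∷ _ , j) → no λ () }
      where
      dec : ∀ (a b : Fin (suc K)) → Dec (([] {A = Fin k}) ≡ [] × a ≡ b)
      dec a b = yes refl ×-dec (a FinP.≟ b)

    solutions : ∀ c → List (Vec (Fin (suc K)) ∣ typeOf Σₐ c ⁺ᵗ ∣) → List Const
    solutions c [] = []
    solutions c (v ∷ vs) with sat? (Vec.lookup v) (constEdges c)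
    ... | yes h = (c , v , h) ∷ solutions c vs
    ... | no _  = solutions c vs

    -- The enumerated constant carries the proof found by `sat?`, which may differ from the given
    -- one; hence the existential.
    ∈-solutions : ∀ c vs {v} → v ∈ vs → sat (Vec.lookup v) (constEdges c) → ∃ λ h → (c , v , h) ∈ solutions c vs
    ∈-solutions c (v ∷ vs) i h with sat? (Vec.lookup v) (constEdges c)
    ∈-solutions c (v ∷ vs) (here refl) h | yes h' = h' , here refl
    ∈-solutions c (v ∷ vs) (there i) h | yes _ with ∈-solutions c vs i h
    ... | h' , j = h' , there j
    ∈-solutions c (v ∷ vs) (here refl) h | no nh = ⊥-elim (nh h)
    ∈-solutions c (v ∷ vs) (there i) h | no _ = ∈-solutions c vs i h

    consts : List Const
    consts = concatMap (λ c → solutions c (allVec (suc K) ∣ typeOf Σₐ c ⁺ᵗ ∣)) (allFin (nC Σₐ))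

    ∈-consts : ∀ c v → sat (Vec.lookup v) (constEdges c) → ∃ λ h → (c , v , h) ∈ consts
    ∈-consts c v h with ∈-solutions c (allVec (suc K) ∣ typeOf Σₐ c ⁺ᵗ ∣) (∈-allVec v) h
    ... | h' , i = h' , ∈-concatMap⁺ (λ c → solutions c (allVec (suc K) ∣ typeOf Σₐ c ⁺ᵗ ∣)) (lose (∈-allFin c) i)

    constTy : Const → STy RP.PR.RL
    constTy (c , v , _) = RP.PR.rt⁺ (typeOf Σₐ c) (Vec.lookup v)

    sig₂ : Sig
    sig₂ = record { nAt = length atoms ; nC = length consts ; typeOf = λ i → encode (constTy (lookup consts i)) }

    o : List (Fin k)
    o = []

    erase-overStr : ∀ {m} (A : Ty m) → eraseTy {n = 1} (λ _ → zero) (overStr {m} {k} o Letter A) ≡ mapTy (λ _ → strTy) A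
    erase-overStr (atom p) = refl
    erase-overStr (A ⊸ B) = cong₂ _⊸_ (erase-overStr A) (erase-overStr B)

    -- Only inhabitation of the start symbol has to survive. By `image-typed` each closed term of
    -- atomic type has an image of type `at [] ⊸ˢ at []`, so the new grammar generates ε alone or
    -- nothing.
    φ₂ : SigMap sig₂ (StrSig k)
    φ₂ = record { F = λ _ → strTy ; G = λ i → inhabit (typeOf sig₂ i)
                ; G-typed = λ i → subst (Typed (StrSig k) [] _) (erase-overStr (typeOf sig₂ i))
                    (STyped⇒Typed (λ _ → zero) (λ { _ _ (_ , refl) → refl }) (inhabit-typed o Letter (typeOf sig₂ i))) }

    G₂ : StringACG k
    G₂ = record { abstr = sig₂ ; φ = φ₂ ; S = Any.index (∈-atoms (S G , Vec.tabulate vv)) }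

    image-typed : ∀ {t A} → Typed sig₂ [] t A → STyped Letter [] (mapTm φ₂ t) (bindS (λ _ → strS {length atoms} {k} o Letter) (toS A))
    image-typed d = STyped-bind (λ _ → strS {length atoms} {k} o Letter) (mapTm φ₂) (λ _ → refl) (λ _ _ → refl) (λ _ _ → refl)
      (λ { c _ refl → subst (STyped Letter [] _) (sym (over (typeOf sig₂ c))) (inhabit-typed o Letter (typeOf sig₂ c)) }) (Typed⇒STyped d)
      where
      over : ∀ A → bindS (λ _ → strS {length atoms} {k} o Letter) (toS A) ≡ overStr {length atoms} {k} o Letter A
      over (atom p) = refl
      over (A ⊸ B) = cong₂ _⊸ˢ_ (over A) (over B)

    refined : ∀ {Γ t s} → STyped (ConstTy 𝓟) Γ t s → ∃ λ t₂ → Typed sig₂ (mapCx encode Γ) t₂ (encode s)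
    refined (ax {x}) = var x , ax
    refined (cn {c} (x , refl , h))
      with ∈-consts c (Vec.tabulate x) (All.map (λ { {i , w , j} (e , q) → e , trans (VecP.lookup∘tabulate x i) (trans q (sym (VecP.lookup∘tabulate x j))) }) h)
    ... | h' , i = con (Any.index i) , subst (Typed sig₂ [] (con (Any.index i)))
          (cong encode (trans (cong constTy (sym (AnyP.lookup-index i))) (RP.PR.rt⁺-cong (typeOf Σₐ c) (VecP.lookup∘tabulate x)))) (cn (Any.index i))
    refined (app {Γ} {Δ} {b = b} d e u) with refined d | refined e
    ... | t , dt | s , ds = app t s , subst (λ Θ → Typed sig₂ Θ (app t s) (encode b)) (sym (map-++ _ Γ Δ))
      (app dt ds (subst Unique (trans (sym (names-mapCx encode (Γ ++ Δ))) (cong (map proj₁) (map-++ _ Γ Δ))) u))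
    refined (lam {Γ} {Δ} {x} {a = a} {b} d) with refined d
    ... | t , dt = lam x t , subst (λ Θ → Typed sig₂ Θ (lam x t) _) (sym (map-++ _ Γ Δ))
      (lam {Γ = mapCx encode Γ} (subst (λ Θ → Typed sig₂ Θ t (encode b)) (map-++ _ Γ ((x , a) ∷ Δ)) dt))

    unrefined : ∀ {t A} → Typed sig₂ [] t A → STyped (ConstTy 𝓟) [] (mapCon (proj₁ ∘ lookup consts) t) (bindS decode (toS A))
    unrefined d = STyped-bind decode (mapCon (proj₁ ∘ lookup consts)) (λ _ → refl) (λ _ _ → refl) (λ _ _ → refl)
      (λ { i _ refl → cn (Vec.lookup (proj₁ (proj₂ (lookup consts i))) , decode-encode (constTy (lookup consts i)) , proj₂ (proj₂ (lookup consts i))) }) (Typed⇒STyped d)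

    to₂ : ∀ w → LangACG G w → LangACG G₂ w
    to₂ w (t , d , r) with identity-like {w} d r
    ... | refl , a , e with refined (refine-term 𝓟 d vv (diag-sat (Fₐ (S G)) FS (termEdges d) (term-matching d) e))
    ... | t₂ , d₂ = t₂ , d₂ , typed⇒≈ρ (image-typed d₂)

    from₂ : ∀ w → LangACG G₂ w → LangACG G w
    from₂ w (t₂ , d₂ , r) with word-unique {w = w} r (image-typed d₂)
    ... | refl = t , STyped⇒Typed proj₁ (ConstTy-erase 𝓟) dt , generic⇒≈id (proj₁ (proj₂ point))
        (subst (STyped NoConst [] (mapTm (φ G) t)) (trans (cong (bindS (headAtom k toℕ)) (RP.OR.rt⁺-cong (Fₐ (S G)) (VecP.lookup∘tabulate vv))) (proj₂ (proj₂ point)))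
          (STyped-bind (headAtom k toℕ) id (λ _ → refl) (λ _ _ → refl) (λ _ _ → refl)
            -- Under `pureAction` a letter relates no values, so the typing of `φ t` contains no
            -- constant.
            (λ { c _ (_ , _ , _ , () , _) }) (object-typing 𝓟 dt)))
      where
      t = mapCon (proj₁ ∘ lookup consts) t₂
      point = diag-point (Fₐ (S G)) FS
      dt : STyped (ConstTy 𝓟) [] t (at (S G , Vec.tabulate vv))
      dt = subst (STyped (ConstTy 𝓟) [] t) (decode-encode (at (S G , Vec.tabulate vv))) (unrefined d₂)

-- The empty grammar and the case distinction

emptyACG : ∀ k → StringACG k
emptyACG k = record
  { abstr = record { nAt = 1 ; nC = 0 ; typeOf = λ () }
  ; φ = record { F = λ _ → strTy ; G = λ () ; G-typed = λ () }
  ; S = zero }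

-- Without constants a term evaluates under every interpretation of the atoms, in particular under
-- the empty set.
emptyACG-empty : ∀ k {w} → ¬ LangACG (emptyACG k) w
emptyACG-empty k (t , d , _) = eval d []
  where
  El : Ty 1 → Set
  El (atom p) = ⊥
  El (A ⊸ B)  = El A → El B
  eval : ∀ {Γ t A} → Typed (abstr (emptyACG k)) Γ t A → All (El ∘ proj₂) Γ → El A
  eval ax (a ∷ []) = a
  eval (app {Γ} d e _) h = eval d (AllP.++⁻ˡ Γ h) (eval e (AllP.++⁻ʳ Γ h))
  eval (lam {Γ} d) h a = eval d (AllP.++⁺ (AllP.++⁻ˡ Γ h) (a ∷ AllP.++⁻ʳ Γ h))

_≟ᵗ_ : (A B : Ty 1) → Dec (A ≡ B)
atom zero ≟ᵗ atom zero = yes refl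
atom _ ≟ᵗ (_ ⊸ _) = no λ ()
(_ ⊸ _) ≟ᵗ atom _ = no λ ()
(A ⊸ B) ≟ᵗ (A' ⊸ B') with A ≟ᵗ A' | B ≟ᵗ B'
... | yes refl | yes refl = yes refl
... | no n | _ = no λ { refl → n refl }
... | _ | no n = no λ { refl → n refl }

endo? : (A : Ty 1) → Dec (∃ λ E → A ≡ (E ⊸ E))
endo? (atom p) = no λ { (_ , ()) }
endo? (A ⊸ B) with A ≟ᵗ B
... | yes refl = yes (A , refl)
... | no n = no λ { (_ , refl) → n refl }

Represented : ∀ {k} → (List (Fin k) → Set) → Set
Represented {k} L = Σ (LLG (Fin k)) (λ G' → ∀ w → L w ⇔ LangLLG G' w)

transfer : ∀ {k} {L L' : List (Fin k) → Set} → (∀ w → L w → L' w) → (∀ w → L' w → L w) → Represented L' → Represented L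
transfer f g (G' , h) = G' , λ w → mk⇔ (Equivalence.to (h w) ∘ f w) (g w ∘ Equivalence.from (h w))

-- Only the shape of `F S` is decided, by comparing finite types; whether ε is generated stays open.
represent : ∀ k (G : StringACG k) → Represented (LangACG G)
represent k G with F (φ G) (S G) ≟ᵗ strTy
... | yes e = StrCase.str-theorem k G e
... | no n with endo? (F (φ G) (S G))
...   | yes (E , e) = transfer to₂ from₂ (StrCase.str-theorem k G₂ refl)
  where open NonString.Endo k G n E e
...   | no m = transfer (λ w l → ⊥-elim (NonString.not-endo⇒empty k G n (λ E e → m (E , e)) {w} l))
                        (λ w l → ⊥-elim (emptyACG-empty k {w} l)) (StrCase.str-theorem k (emptyACG k) refl)

mainTheorem2 : (k : ℕ) (L : List (Fin k) → Set) (G : StringACG k) →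
    (∀ w → L w ⇔ LangACG G w) →
    Σ (LLG (Fin k)) (λ G' → ∀ w → L w ⇔ LangLLG G' w)
mainTheorem2 k L G h = transfer (λ w → Equivalence.to (h w)) (λ w → Equivalence.from (h w)) (represent k G)
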